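{- The Diophantine equation \[ (2am+1)^x+(2m)^y=(2am-1)^z \] has only the solutions $(a,m,x,y,z)=(2,1,2,1,3)$ and $(a,m,x,y,z)=(2,1,1,2,2)$ in positive integers $a,m,x,y,z$ with $a>1$. -}

module Defs where

{-# OPTIONS --safe #-}

-- Put A = 2am, B = A + 1, C = A - 1, M = 2m, so that B^x + M^y = C^z.
--
-- z odd.  Modulo M the equation gives m = 1, and modulo A it gives
-- a ∣ 2^(y-1) + 1.  If y = 1 then a = 2 and 5^x + 2 = 3^z is settled by
-- congruences.  If y > 1 then x and y are even, so C^z is a sum of two squares
-- and descent in ℤ[i] gives C = u² + 2^y; the divisibility forces u = 1, and
-- then the imaginary part of (1 + 2^(y/2) i)^z is ± 2^(y/2), which a 2-adic
-- argument excludes.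
--
-- z even, x odd.  Modulo 2A, M^y is an odd multiple of A.  If y is odd, -2M
-- would be a square modulo C, contradicting Gauss's lemma, which applies to the
-- composite modulus C.  If y ≥ 4 is even, -2 would be a square modulo
-- C ≡ 7 (mod 8).  If y = 2, then C^(z/2) ± M are coprime x-th powers.
--
-- z even, x even.  The factors C^(z/2) ± B^(x/2) of M^y, whose only common
-- factor is 2, must be 2m^y and 2^(y-1), and x/2 is even, whence
-- B^(x/2) + 2^(y-2) = m^y.  This is impossible by size if y is even; if y is
-- odd, descent in ℤ[√-2] gives m = u² + 2^(y-2), against am ∣ 2^(y-2) + 1.
module Submission where

open import Defs
open import Algebra.Bundles using (CommutativeRing)
import Algebra.Properties.CommutativeMonoid.Sum as Sum
open import Data.Bool.Base using (Bool; true; false; not; _xor_)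
open import Data.Bool.Properties using (xor-∧-commutativeRing; xor-same; xor-assoc)
open import Data.Empty using (⊥; ⊥-elim)
open import Data.Fin.Base using (Fin; zero; suc; toℕ; fromℕ<)
open import Data.Fin.Permutation using (permutation)
open import Data.Fin.Properties using (toℕ<n; toℕ-fromℕ<; toℕ-injective; all?)
open import Data.Integer.Base as ℤ using (ℤ; +_; -[1+_]; 0ℤ; 1ℤ; ∣_∣)
import Data.Integer.DivMod as ℤ
open import Data.Integer.Divisibility.Signed using (∣ᵤ⇒∣; divides)
import Data.Integer.Properties as ℤ
open import Data.Integer.Tactic.RingSolver using (solve-∀)
open import Data.Nat.Base as ℕ using (ℕ; zero; suc; z≤n; s≤s; NonZero)
open import Data.Nat.Coprimality as Coprime using (Coprime; coprime-divisor)
import Data.Nat.Divisibility as ℕ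
import Data.Nat.DivMod as ℕ
open import Data.Nat.GCD using (gcd; gcd[m,n]∣m; gcd[m,n]∣n; gcd-greatest; gcd[m,n]≡0⇒n≡0; c*gcd[m,n]≡gcd[cm,cn])
open import Data.Nat.Induction using (<-rec)
import Data.Nat.Properties as ℕ
import Data.Nat.Tactic.RingSolver as ℕ-Ring
open import Data.Product using (∃; ∃₂; _×_; _,_; proj₁; proj₂)
open import Data.Sum using (_⊎_; inj₁; inj₂; [_,_]′)
open import Function using (_∘_; _$_)
open import Relation.Binary.PropositionalEquality
open import Relation.Nullary using (¬_; Dec; yes; no; contradiction; ¬?; _→-dec_)
open import Relation.Nullary.Decidable using (from-no; from-yes; does; dec-true)

-- The bases are composite in general and nothing is known about their prime factors, so neither
-- Legendre symbols nor a comparison of prime factorisations is at hand. Both descents start instead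
-- from a square root `ρ` of -d modulo cⁿ. It singles out one ideal of norm c, `represent` finds a
-- generator of it, and dividing by that generator n times leaves a unit. That the imaginary part is
-- a power of two matters twice: it is invertible modulo the odd base, which supplies `ρ`, and an
-- odd power has imaginary part v times an odd number, which must then be ±1.
--
-- Non-residues come from two sources. For -1 and -2, `represent` again: a divisor of ρ² + d with d
-- ≤ 2 has the form u² + d v², so a residue modulo 4 or 8 decides. For -2M no such form is
-- available. But y ≥ 3 puts a factor 4 into a, so that C = 8cm - 1 with a = 4c, and multiplication
-- by -4m modulo 8cm - 1 has a periodic pattern of signs that can be counted outright.

module _ where

  open import Data.Integer.Base using (_+_; _-_; _*_; -_; _^_)
  open Sum (CommutativeRing.+-commutativeMonoid xor-∧-commutativeRing) using (sum; sum-cong-≗; sum-permute; ∑-distrib-+)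

  -- Congruences of integers

  infix 4 _≋_[mod_]

  -- The quotient is stored with an equation, not a divisibility: matching the equation with `refl`
  -- turns each congruence law into a polynomial identity for the ring solver, and the quotients
  -- serve as explicit cofactors later.
  record _≋_[mod_] (x y n : ℤ) : Set where
    constructor modulo
    field
      quotient : ℤ
      equality : x ≡ y + quotient * n

  module _ {n : ℤ} where

    ≋-reflexive : ∀ {x y} → x ≡ y → x ≋ y [mod n ]
    ≋-reflexive {x} refl = modulo 0ℤ (eq x n)
      where
      eq : ∀ x n → x ≡ x + 0ℤ * n
      eq = solve-∀

    ≋-refl : ∀ {x} → x ≋ x [mod n ]
    ≋-refl = ≋-reflexive refl

    ≋-sym : ∀ {x y} → x ≋ y [mod n ] → y ≋ x [mod n ]
    ≋-sym {y = y} (modulo q refl) = modulo (- q) (eq y q n)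
      where
      eq : ∀ y q n → y ≡ y + q * n + - q * n
      eq = solve-∀

    ≋-trans : ∀ {x y z} → x ≋ y [mod n ] → y ≋ z [mod n ] → x ≋ z [mod n ]
    ≋-trans {z = z} (modulo q refl) (modulo r refl) = modulo (r + q) (eq z q r n)
      where
      eq : ∀ z q r n → z + r * n + q * n ≡ z + (r + q) * n
      eq = solve-∀

    +-cong-≋ : ∀ {w x y z} → w ≋ x [mod n ] → y ≋ z [mod n ] → w + y ≋ x + z [mod n ]
    +-cong-≋ {x = x} {z = z} (modulo q refl) (modulo r refl) = modulo (q + r) (eq x z q r n)
      where
      eq : ∀ x z q r n → (x + q * n) + (z + r * n) ≡ x + z + (q + r) * n
      eq = solve-∀

    *-cong-≋ : ∀ {w x y z} → w ≋ x [mod n ] → y ≋ z [mod n ] → w * y ≋ x * z [mod n ]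
    *-cong-≋ {x = x} {z = z} (modulo q refl) (modulo r refl) =
      modulo (q * z + x * r + q * r * n) (eq x z q r n)
      where
      eq : ∀ x z q r n → (x + q * n) * (z + r * n) ≡ x * z + (q * z + x * r + q * r * n) * n
      eq = solve-∀

    neg-cong-≋ : ∀ {x y} → x ≋ y [mod n ] → - x ≋ - y [mod n ]
    neg-cong-≋ {y = y} (modulo q refl) = modulo (- q) (eq y q n)
      where
      eq : ∀ y q n → - (y + q * n) ≡ - y + - q * n
      eq = solve-∀

    ^-cong-≋ : ∀ {x y} k → x ≋ y [mod n ] → x ^ k ≋ y ^ k [mod n ]
    ^-cong-≋ zero    p = ≋-refl
    ^-cong-≋ (suc k) p = *-cong-≋ p (^-cong-≋ k p)

    ≋-respˡ : ∀ {x y z} → x ≡ y → y ≋ z [mod n ] → x ≋ z [mod n ]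
    ≋-respˡ refl p = p

    ≋-respʳ : ∀ {x y z} → x ≋ y [mod n ] → y ≡ z → x ≋ z [mod n ]
    ≋-respʳ p refl = p

  ≋⇒∣ : ∀ {x y n} → x ≋ y [mod n ] → ∣ n ∣ ℕ.∣ ∣ x - y ∣
  ≋⇒∣ {x} {y} {n} (modulo q refl) = ℕ.divides ∣ q ∣ (trans (cong ∣_∣ (eq y q n)) (ℤ.abs-* q n))
    where
    eq : ∀ y q n → y + q * n - y ≡ q * n
    eq = solve-∀

  ∣⇒≋0 : ∀ {n x} → n ℕ.∣ x → + x ≋ 0ℤ [mod + n ]
  ∣⇒≋0 {n} (ℕ.divides q refl) = modulo (+ q) (trans (ℤ.pos-* q n) (sym (ℤ.+-identityˡ _)))

  ≋0⇒∣ : ∀ {n x} → + x ≋ 0ℤ [mod + n ] → n ℕ.∣ x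
  ≋0⇒∣ {n} {x} p = subst (n ℕ.∣_) (cong ∣_∣ (ℤ.+-identityʳ (+ x))) (≋⇒∣ p)

  ≋-weaken : ∀ {x y m n} → m ≋ 0ℤ [mod n ] → x ≋ y [mod m ] → x ≋ y [mod n ]
  ≋-weaken {y = y} {n = n} (modulo q refl) (modulo r refl) = modulo (r * q) (eq y r q n)
    where
    eq : ∀ y r q n → y + r * (0ℤ + q * n) ≡ y + r * q * n
    eq = solve-∀

  pos-^ : ∀ x k → + (x ℕ.^ k) ≡ (+ x) ^ k
  pos-^ x zero    = refl
  pos-^ x (suc k) = trans (ℤ.pos-* x (x ℕ.^ k)) (cong (+ x *_) (pos-^ x k))

  ^-distribʳ-* : ∀ x y k → (x * y) ^ k ≡ x ^ k * y ^ k
  ^-distribʳ-* x y zero    = refl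
  ^-distribʳ-* x y (suc k) = trans (cong (x * y *_) (^-distribʳ-* x y k)) (eq x y (x ^ k) (y ^ k))
    where
    eq : ∀ x y a b → x * y * (a * b) ≡ x * a * (y * b)
    eq = solve-∀

  -- Representation by u² + d v², and division by a generator in ℤ[√-d]

  -- With ρ² + d = k c and k = s² + d t², s = ρ t + v k, the element
  -- (ρ + √-d) / (s + t √-d) is integral of norm c.
  represent : ∀ d → 1 ℕ.≤ d → d ℕ.≤ 2 → ∀ c ρ → 0 ℕ.< c → c ℕ.∣ ρ ℕ.* ρ ℕ.+ d →
    ∃₂ λ u v → u * u + + d * (v * v) ≡ + c × u ≋ + ρ * v [mod + c ]
  represent d 1≤d d≤2 = <-rec _ step
    where
    Goal : ℕ → Set
    Goal c = ∀ ρ → 0 ℕ.< c → c ℕ.∣ ρ ℕ.* ρ ℕ.+ d →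
      ∃₂ λ u v → u * u + + d * (v * v) ≡ + c × u ≋ + ρ * v [mod + c ]

    norm : ∀ d ρ s t v c k → .{{ℤ.NonZero k}} → ρ * ρ + d ≡ k * c → s ≡ ρ * t + v * k →
      s * s + d * (t * t) ≡ k → (ρ * v + t * c) * (ρ * v + t * c) + d * (v * v) ≡ c
    norm d ρ s t v c k ρ²+d s≡ N = begin
      (ρ * v + t * c) * (ρ * v + t * c) + d * (v * v)                    ≡⟨ expand d ρ t v c ⟩
      v * v * (ρ * ρ + d) + c * (t * t * c + t * ρ * v + t * ρ * v)      ≡⟨ cong (λ r → v * v * r + _) ρ²+d ⟩
      v * v * (k * c) + c * (t * t * c + t * ρ * v + t * ρ * v)          ≡⟨ factor ρ t v c k ⟩
      c * (t * t * c + t * ρ * v + t * ρ * v + k * (v * v))              ≡⟨ cong (c *_) (ℤ.*-cancelˡ-≡ k _ _ kZ) ⟩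
      c * 1ℤ                                                             ≡⟨ ℤ.*-identityʳ c ⟩
      c                                                                  ∎
      where
      open ≡-Reasoning
      expand : ∀ d ρ t v c → (ρ * v + t * c) * (ρ * v + t * c) + d * (v * v) ≡
        v * v * (ρ * ρ + d) + c * (t * t * c + t * ρ * v + t * ρ * v)
      expand = solve-∀
      factor : ∀ ρ t v c k → v * v * (k * c) + c * (t * t * c + t * ρ * v + t * ρ * v) ≡
        c * (t * t * c + t * ρ * v + t * ρ * v + k * (v * v))
      factor = solve-∀
      collect : ∀ ρ t v c k → k * (t * t * c + t * ρ * v + t * ρ * v + k * (v * v)) ≡
        t * t * (k * c) + v * k * (ρ * t + ρ * t + v * k)
      collect = solve-∀
      square : ∀ d ρ t v k → t * t * (ρ * ρ + d) + v * k * (ρ * t + ρ * t + v * k) ≡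
        (ρ * t + v * k) * (ρ * t + v * k) + d * (t * t)
      square = solve-∀
      kZ : k * (t * t * c + t * ρ * v + t * ρ * v + k * (v * v)) ≡ k * 1ℤ
      kZ = begin
        k * (t * t * c + t * ρ * v + t * ρ * v + k * (v * v))            ≡⟨ collect ρ t v c k ⟩
        t * t * (k * c) + v * k * (ρ * t + ρ * t + v * k)                ≡⟨ cong (λ r → t * t * r + _) ρ²+d ⟨
        t * t * (ρ * ρ + d) + v * k * (ρ * t + ρ * t + v * k)            ≡⟨ square d ρ t v k ⟩
        (ρ * t + v * k) * (ρ * t + v * k) + d * (t * t)                  ≡⟨ cong (λ r → r * r + _) s≡ ⟨
        s * s + d * (t * t)                                              ≡⟨ N ⟩
        k                                                                ≡⟨ ℤ.*-identityʳ k ⟨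
        k * 1ℤ                                                           ∎

    step : ∀ c → (∀ {k} → k ℕ.< c → Goal k) → Goal c
    step 1 _ ρ _ _ = 1ℤ , 0ℤ , cong (λ r → 1ℤ + r) (ℤ.*-zeroʳ (+ d)) , modulo 1ℤ (cong (λ r → r + 1ℤ) (sym (ℤ.*-zeroʳ (+ ρ))))
    step c@(suc (suc b)) rec ρ _ c∣ =
      from-quotient (ℕ.∣m+n∣m⇒∣n (subst (c ℕ.∣_) (eq r (ρ ℕ./ c) c d) (subst (λ x → c ℕ.∣ x ℕ.* x ℕ.+ d) (ℕ.m≡m%n+[m/n]*n ρ c) c∣))
        (ℕ.∣m⇒∣m*n (ρ ℕ./ c ℕ.* (ρ ℕ./ c ℕ.* c ℕ.+ r ℕ.+ r)) ℕ.∣-refl))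
      where
      r = ρ ℕ.% c
      eq : ∀ r q c d → (r ℕ.+ q ℕ.* c) ℕ.* (r ℕ.+ q ℕ.* c) ℕ.+ d ≡ c ℕ.* (q ℕ.* (q ℕ.* c ℕ.+ r ℕ.+ r)) ℕ.+ (r ℕ.* r ℕ.+ d)
      eq = ℕ-Ring.solve-∀
      from-quotient : c ℕ.∣ r ℕ.* r ℕ.+ d → ∃₂ λ u v → u * u + + d * (v * v) ≡ + c × u ≋ + ρ * v [mod + c ]
      from-quotient (ℕ.divides zero r²+d) = contradiction (ℕ.m+n≡0⇒n≡0 (r ℕ.* r) r²+d) (ℕ.>⇒≢ 1≤d)
      from-quotient (ℕ.divides k@(suc _) r²+d) with rec k<c r (s≤s z≤n) (ℕ.divides c (trans r²+d (ℕ.*-comm k c)))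
        where
        square : ∀ b → suc (suc b) ℕ.* suc (suc b) ≡ suc ((b ℕ.+ 1) ℕ.* (b ℕ.+ 1) ℕ.+ 2 ℕ.+ (b ℕ.+ b))
        square = ℕ-Ring.solve-∀
        -- The remainder r is at most c - 1, and (c - 1)² + 2 < c² for c ≥ 2. This is where `d ≤ 2`
        -- makes the descent go down.
        k<c : k ℕ.< c
        k<c = ℕ.*-cancelʳ-< c k c (begin-strict
          k ℕ.* c                                                   ≡⟨ r²+d ⟨
          r ℕ.* r ℕ.+ d                                             ≤⟨ ℕ.+-mono-≤ (ℕ.*-mono-≤ r≤ r≤) d≤2 ⟩
          (b ℕ.+ 1) ℕ.* (b ℕ.+ 1) ℕ.+ 2                             ≤⟨ ℕ.m≤m+n _ (b ℕ.+ b) ⟩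
          (b ℕ.+ 1) ℕ.* (b ℕ.+ 1) ℕ.+ 2 ℕ.+ (b ℕ.+ b)               <⟨ ℕ.≤-reflexive (sym (square b)) ⟩
          c ℕ.* c                                                   ∎)
          where
          open ℕ.≤-Reasoning
          r≤ : r ℕ.≤ b ℕ.+ 1
          r≤ = subst (r ℕ.≤_) (ℕ.+-comm 1 b) (ℕ.≤-pred (ℕ.m%n<n ρ c))
      ... | s , t , N , modulo v s≡ =
        + r * v + t * + c , v ,
        norm (+ d) (+ r) s t v (+ c) (+ k) r²+d′ s≡ N ,
        modulo (t - + (ρ ℕ./ c) * v) (trans (shift (+ r) (+ (ρ ℕ./ c)) (+ c) t v) (cong (λ x → x * v + (t - + (ρ ℕ./ c) * v) * + c) (sym ρ≡)))
        where
        r²+d′ : + r * + r + + d ≡ + k * + c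
        r²+d′ = trans (cong (λ x → x + + d) (sym (ℤ.pos-* r r))) (trans (cong +_ r²+d) (ℤ.pos-* k c))
        ρ≡ : + ρ ≡ + r + + (ρ ℕ./ c) * + c
        ρ≡ = trans (cong +_ (ℕ.m≡m%n+[m/n]*n ρ c)) (cong (λ x → + r + x) (ℤ.pos-* (ρ ℕ./ c) c))
        shift : ∀ r q c t v → r * v + t * c ≡ (r + q * c) * v + (t - q * v) * c
        shift = solve-∀

  -- (u + √-D)ⁿ = re u D n + im u D n √-D
  re im : (u D : ℤ) → ℕ → ℤ
  re u D zero    = 1ℤ
  re u D (suc n) = u * re u D n - D * im u D n
  im u D zero    = 0ℤ
  im u D (suc n) = re u D n + u * im u D n

  -- An element X + Y √-d of norm cⁿ in the kernel of √-d ↦ -ρ modulo cⁿ is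
  -- divisible by the generator π = u + v √-d of the corresponding ideal of norm c.
  root : ∀ d c ρ u v → .{{ℤ.NonZero c}} → u * u + d * (v * v) ≡ c → u ≋ ρ * v [mod c ] →
    ∀ n X Y → ρ * ρ + d ≋ 0ℤ [mod c ^ n ] → X * X + d * (Y * Y) ≡ c ^ n → X ≋ ρ * Y [mod c ^ n ] →
    ∃₂ λ a b → a * a + d * (b * b) ≡ 1ℤ ×
      X ≡ a * re u (d * (v * v)) n - d * (b * (v * im u (d * (v * v)) n)) ×
      Y ≡ a * (v * im u (d * (v * v)) n) + b * re u (d * (v * v)) n
  root d c ρ u v N (modulo t u≡) = go
    where
    -- With this D, √-D is v √-d, so (u + v √-d)ⁿ has the coordinates `re u D n` and `v * im u D n`;
    -- the conclusion says that X + Y √-d is a unit a + b √-d times this power.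
    D = d * (v * v)
    go : ∀ n X Y → ρ * ρ + d ≋ 0ℤ [mod c ^ n ] → X * X + d * (Y * Y) ≡ c ^ n → X ≋ ρ * Y [mod c ^ n ] →
      ∃₂ λ a b → a * a + d * (b * b) ≡ 1ℤ ×
        X ≡ a * re u D n - d * (b * (v * im u D n)) × Y ≡ a * (v * im u D n) + b * re u D n
    go zero X Y _ NX _ = X , Y , NX , eqX d X Y v , eqY X Y v
      where
      eqX : ∀ d X Y v → X ≡ X * 1ℤ - d * (Y * (v * 0ℤ))
      eqX = solve-∀
      eqY : ∀ X Y v → Y ≡ X * (v * 0ℤ) + Y * 1ℤ
      eqY = solve-∀
    go (suc n) X Y (modulo r ρ²+d) NX (modulo q X≡) = multiply $ go n x y
      (modulo (r * c) (trans ρ²+d (cong (λ z → 0ℤ + z) (sym (ℤ.*-assoc r c (c ^ n))))))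
      (ℤ.*-cancelˡ-≡ c _ _ (begin
        c * (x * x + d * (y * y))                                          ≡⟨ cong (_* (x * x + d * (y * y))) N ⟨
        (u * u + d * (v * v)) * (x * x + d * (y * y))                      ≡⟨ brahmagupta d u v x y ⟩
        (u * x - d * (v * y)) * (u * x - d * (v * y)) + d * ((u * y + v * x) * (u * y + v * x))
          ≡⟨ cong₂ (λ w z → w * w + d * (z * z)) X≡πβ Y≡πβ ⟨
        X * X + d * (Y * Y)                                                ≡⟨ NX ⟩
        c * c ^ n                                                          ∎))
      (modulo (r * Y * v + q * u + ρ * q * v) (φβ ρ u v t r q (c ^ n) Y))
      where
      open ≡-Reasoning
      x = r * c ^ n * (Y * v) + ρ * Y * t + q * c ^ n * u
      y = Y * t - q * c ^ n * v
      brahmagupta : ∀ d u v x y → (u * u + d * (v * v)) * (x * x + d * (y * y)) ≡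
        (u * x - d * (v * y)) * (u * x - d * (v * y)) + d * ((u * y + v * x) * (u * y + v * x))
      brahmagupta = solve-∀
      φβ : ∀ ρ u v t r q C Y → r * C * (Y * v) + ρ * Y * t + q * C * u ≡
        ρ * (Y * t - q * C * v) + (r * Y * v + q * u + ρ * q * v) * C
      φβ = solve-∀
      cx : c * x ≡ X * u + d * (Y * v)
      cx = begin
        c * x                                                              ≡⟨ l₁ c (c ^ n) ρ u v t r q Y ⟩
        (0ℤ + r * (c * c ^ n)) * (Y * v) + ρ * Y * (t * c) + q * (c * c ^ n) * u    ≡⟨ cong (λ z → z * (Y * v) + ρ * Y * (t * c) + q * (c * c ^ n) * u) ρ²+d ⟨
        (ρ * ρ + d) * (Y * v) + ρ * Y * (t * c) + q * (c * c ^ n) * u      ≡⟨ l₂ d c (c ^ n) ρ u v t q Y ⟩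
        (ρ * Y) * (ρ * v + t * c) + q * (c * c ^ n) * u + d * (Y * v)      ≡⟨ cong (λ z → (ρ * Y) * z + q * (c * c ^ n) * u + d * (Y * v)) u≡ ⟨
        (ρ * Y) * u + q * (c * c ^ n) * u + d * (Y * v)                    ≡⟨ cong (_+ d * (Y * v)) (ℤ.*-distribʳ-+ u (ρ * Y) _) ⟨
        (ρ * Y + q * (c * c ^ n)) * u + d * (Y * v)                        ≡⟨ cong (λ z → z * u + d * (Y * v)) X≡ ⟨
        X * u + d * (Y * v)                                                ∎
        where
        l₁ : ∀ c C ρ u v t r q Y → c * (r * C * (Y * v) + ρ * Y * t + q * C * u) ≡
          (0ℤ + r * (c * C)) * (Y * v) + ρ * Y * (t * c) + q * (c * C) * u
        l₁ = solve-∀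
        l₂ : ∀ d c C ρ u v t q Y → (ρ * ρ + d) * (Y * v) + ρ * Y * (t * c) + q * (c * C) * u ≡
          (ρ * Y) * (ρ * v + t * c) + q * (c * C) * u + d * (Y * v)
        l₂ = solve-∀
      cy : c * y ≡ Y * u - X * v
      cy = begin
        c * y                                                              ≡⟨ l c (c ^ n) ρ v t q Y ⟩
        Y * (ρ * v + t * c) - (ρ * Y + q * (c * c ^ n)) * v                ≡⟨ cong₂ (λ w z → Y * w - z * v) u≡ X≡ ⟨
        Y * u - X * v                                                      ∎
        where
        l : ∀ c C ρ v t q Y → c * (Y * t - q * C * v) ≡ Y * (ρ * v + t * c) - (ρ * Y + q * (c * C)) * v
        l = solve-∀
      X≡πβ : X ≡ u * x - d * (v * y)
      X≡πβ = ℤ.*-cancelˡ-≡ c _ _ (begin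
        c * X                                                              ≡⟨ cong (_* X) N ⟨
        (u * u + d * (v * v)) * X                                          ≡⟨ l₁ d u v X Y ⟩
        u * (X * u + d * (Y * v)) - d * (v * (Y * u - X * v))              ≡⟨ cong₂ (λ w z → u * w - d * (v * z)) cx cy ⟨
        u * (c * x) - d * (v * (c * y))                                    ≡⟨ l₂ c d u v x y ⟩
        c * (u * x - d * (v * y))                                          ∎)
        where
        l₁ : ∀ d u v X Y → (u * u + d * (v * v)) * X ≡ u * (X * u + d * (Y * v)) - d * (v * (Y * u - X * v))
        l₁ = solve-∀
        l₂ : ∀ c d u v x y → u * (c * x) - d * (v * (c * y)) ≡ c * (u * x - d * (v * y))
        l₂ = solve-∀
      Y≡πβ : Y ≡ u * y + v * x
      Y≡πβ = ℤ.*-cancelˡ-≡ c _ _ (begin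
        c * Y                                                              ≡⟨ cong (_* Y) N ⟨
        (u * u + d * (v * v)) * Y                                          ≡⟨ l₁ d u v X Y ⟩
        u * (Y * u - X * v) + v * (X * u + d * (Y * v))                    ≡⟨ cong₂ (λ w z → u * z + v * w) cx cy ⟨
        u * (c * y) + v * (c * x)                                          ≡⟨ l₂ c u v x y ⟩
        c * (u * y + v * x)                                                ∎)
        where
        l₁ : ∀ d u v X Y → (u * u + d * (v * v)) * Y ≡ u * (Y * u - X * v) + v * (X * u + d * (Y * v))
        l₁ = solve-∀
        l₂ : ∀ c u v x y → u * (c * y) + v * (c * x) ≡ c * (u * y + v * x)
        l₂ = solve-∀
      multiply : (∃₂ λ a b → a * a + d * (b * b) ≡ 1ℤ ×
          x ≡ a * re u D n - d * (b * (v * im u D n)) × y ≡ a * (v * im u D n) + b * re u D n) →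
        ∃₂ λ a b → a * a + d * (b * b) ≡ 1ℤ ×
          X ≡ a * re u D (suc n) - d * (b * (v * im u D (suc n))) × Y ≡ a * (v * im u D (suc n)) + b * re u D (suc n)
      multiply (a , b , N₁ , x≡ , y≡) = a , b , N₁ ,
        trans X≡πβ (trans (cong₂ (λ w z → u * w - d * (v * z)) x≡ y≡) (lX d u v a b (re u D n) (im u D n))) ,
        trans Y≡πβ (trans (cong₂ (λ w z → u * z + v * w) x≡ y≡) (lY d u v a b (re u D n) (im u D n)))
        where
        lX : ∀ d u v a b R I → u * (a * R - d * (b * (v * I))) - d * (v * (a * (v * I) + b * R)) ≡
          a * (u * R - d * (v * v) * I) - d * (b * (v * (R + u * I)))
        lX = solve-∀
        lY : ∀ d u v a b R I → u * (a * (v * I) + b * R) + v * (a * R - d * (b * (v * I))) ≡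
          a * (v * (R + u * I)) + b * (u * R - d * (v * v) * I)
        lY = solve-∀

  -- Parity

  Even Odd : ℕ → Set
  Even n = ∃ λ h → n ≡ 2 ℕ.* h
  Odd n = ∃ λ h → n ≡ suc (2 ℕ.* h)

  2*suc : ∀ h → 2 ℕ.* suc h ≡ suc (suc (2 ℕ.* h))
  2*suc = ℕ-Ring.solve-∀

  parity : ∀ n → Even n ⊎ Odd n
  parity zero    = inj₁ (0 , refl)
  parity (suc n) with parity n
  ... | inj₁ (h , refl) = inj₂ (h , refl)
  ... | inj₂ (h , refl) = inj₁ (suc h , sym (2*suc h))

  odd-* : ∀ {m n} → Odd m → Odd n → Odd (m ℕ.* n)
  odd-* (g , refl) (h , refl) = h ℕ.+ g ℕ.* suc (2 ℕ.* h) , eq g h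
    where
    eq : ∀ g h → suc (2 ℕ.* g) ℕ.* suc (2 ℕ.* h) ≡ suc (2 ℕ.* (h ℕ.+ g ℕ.* suc (2 ℕ.* h)))
    eq = ℕ-Ring.solve-∀

  odd-^ : ∀ {m} k → Odd m → Odd (m ℕ.^ k)
  odd-^ zero    _ = 0 , refl
  odd-^ (suc k) o = odd-* o (odd-^ k o)

  even⇒≋0 : ∀ {n} → Even n → + n ≋ 0ℤ [mod + 2 ]
  even⇒≋0 (h , eq) = ∣⇒≋0 (ℕ.divides h (trans eq (ℕ.*-comm 2 h)))

  odd⇒≋1 : ∀ {n} → Odd n → + n ≋ 1ℤ [mod + 2 ]
  odd⇒≋1 (h , refl) = +-cong-≋ (≋-refl {x = 1ℤ}) (even⇒≋0 (h , refl))

  1≋̸0 : ¬ 1ℤ ≋ 0ℤ [mod + 2 ]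
  1≋̸0 = from-no (2 ℕ.∣? 1) ∘ ≋⇒∣

  parity-ℤ : ∀ x → x ≋ 0ℤ [mod + 2 ] ⊎ x ≋ 1ℤ [mod + 2 ]
  parity-ℤ (+ n) with parity n
  ... | inj₁ e = inj₁ (even⇒≋0 e)
  ... | inj₂ o = inj₂ (odd⇒≋1 o)
  parity-ℤ -[1+ n ] with parity (suc n)
  ... | inj₁ e = inj₁ (neg-cong-≋ (even⇒≋0 e))
  ... | inj₂ o = inj₂ (≋-trans (neg-cong-≋ (odd⇒≋1 o)) (modulo (- 1ℤ) refl))

  ∣∣-odd : ∀ x → x ≋ 1ℤ [mod + 2 ] → Odd ∣ x ∣
  ∣∣-odd (+ n) p with parity n
  ... | inj₁ e = contradiction (≋-trans (≋-sym p) (even⇒≋0 e)) 1≋̸0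
  ... | inj₂ o = o
  ∣∣-odd -[1+ n ] p with parity (suc n)
  ... | inj₁ e = contradiction (≋-trans (≋-sym p) (neg-cong-≋ (even⇒≋0 e))) 1≋̸0
  ... | inj₂ o = o

  odd⇒coprime-2 : ∀ {m} → Odd m → Coprime m 2
  odd⇒coprime-2 (h , refl) {d} (d∣m , d∣2) = ℕ.∣1⇒≡1
    (ℕ.∣m+n∣m⇒∣n (subst (d ℕ.∣_) (ℕ.+-comm 1 (2 ℕ.* h)) d∣m) (ℕ.∣m⇒∣m*n h d∣2))

  odd∣2^*⇒∣ : ∀ {m n} k → Odd m → m ℕ.∣ 2 ℕ.^ k ℕ.* n → m ℕ.∣ n
  odd∣2^*⇒∣ {m} {n} zero    o m∣ = subst (m ℕ.∣_) (ℕ.+-identityʳ n) m∣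
  odd∣2^*⇒∣ {m} {n} (suc k) o m∣ = odd∣2^*⇒∣ k o (coprime-divisor (odd⇒coprime-2 o) (subst (m ℕ.∣_) (ℕ.*-assoc 2 (2 ℕ.^ k) n) m∣))

  module _ {u D : ℤ} (u≋1 : u ≋ 1ℤ [mod + 2 ]) (D≋0 : D ≋ 0ℤ [mod + 2 ]) where

    re-odd : ∀ n → re u D n ≋ 1ℤ [mod + 2 ]
    re-odd zero    = ≋-refl
    re-odd (suc n) = +-cong-≋ (*-cong-≋ u≋1 (re-odd n)) (neg-cong-≋ (*-cong-≋ D≋0 (≋-refl {x = im u D n})))

    im-parity : ∀ n → im u D n ≋ + n [mod + 2 ]
    im-parity zero    = ≋-refl
    im-parity (suc n) = +-cong-≋ (re-odd n) (≋-respʳ (*-cong-≋ u≋1 (im-parity n)) (ℤ.*-identityˡ (+ n)))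

  -- Odd powers in ℤ[√-d] whose imaginary part is a power of two

  -- For d = 1 the generator is only determined up to i, which allows to choose v even.
  represent-odd : ∀ d → d ≡ 1 ⊎ d ≡ 2 → ∀ c ρ → Odd c → c ℕ.∣ ρ ℕ.* ρ ℕ.+ d →
    ∃₂ λ u v → + u * + u + + d * (v * v) ≡ + c × + u ≋ + ρ * v [mod + c ] ×
      + u ≋ 1ℤ [mod + 2 ] × + d * (v * v) ≋ 0ℤ [mod + 2 ] × (d ≡ 1 → v ≋ 0ℤ [mod + 2 ])
  represent-odd d d∈ c ρ odd-c c∣ = choose d∈
    where
    R : ℤ → ℤ → Set
    R u v = u * u + + d * (v * v) ≡ + c × u ≋ + ρ * v [mod + c ] ×
      u ≋ 1ℤ [mod + 2 ] × + d * (v * v) ≋ 0ℤ [mod + 2 ] × (d ≡ 1 → v ≋ 0ℤ [mod + 2 ])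

    nonNegative : ∀ u v → R u v → ∃₂ λ u v → R (+ u) v
    nonNegative (+ u) v r = u , v , r
    nonNegative -[1+ u ] v (N , u≋ , u≋1 , D≋0 , v≋0) = suc u , - v ,
      trans (cong (λ z → + suc u * + suc u + + d * z) (sq v)) N ,
      ≋-respʳ (neg-cong-≋ u≋) (ℤ.neg-distribʳ-* (+ ρ) v) ,
      ≋-trans (neg-cong-≋ u≋1) (modulo (- 1ℤ) refl) ,
      ≋-respˡ (cong (+ d *_) (sq v)) D≋0 ,
      λ d≡1 → neg-cong-≋ (v≋0 d≡1)
      where
      sq : ∀ v → - v * - v ≡ v * v
      sq = solve-∀

    u-odd : ∀ u v → u * u + + d * (v * v) ≡ + c → + d * (v * v) ≋ 0ℤ [mod + 2 ] → u ≋ 1ℤ [mod + 2 ]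
    u-odd u v N D≋0 with parity-ℤ u
    ... | inj₂ u≋1 = u≋1
    ... | inj₁ u≋0 = contradiction (≋-trans (≋-sym (odd⇒≋1 odd-c)) (≋-respˡ (sym N) (+-cong-≋ (*-cong-≋ u≋0 u≋0) D≋0))) 1≋̸0

    0<c : 0 ℕ.< c
    0<c = subst (0 ℕ.<_) (sym (proj₂ odd-c)) (s≤s z≤n)

    choose : d ≡ 1 ⊎ d ≡ 2 → ∃₂ λ u v → R (+ u) v
    choose (inj₂ refl) with represent 2 (s≤s z≤n) (s≤s (s≤s z≤n)) c ρ 0<c c∣
    ... | u , v , N , u≋ = nonNegative u v (N , u≋ , u-odd u v N D≋0 , D≋0 , λ ())
      where
      D≋0 : + 2 * (v * v) ≋ 0ℤ [mod + 2 ]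
      D≋0 = modulo (v * v) (trans (ℤ.*-comm (+ 2) (v * v)) (sym (ℤ.+-identityˡ _)))
    choose (inj₁ refl) with represent 1 (s≤s z≤n) (s≤s z≤n) c ρ 0<c c∣
    ... | u , v , N , u≋ with parity-ℤ v
    ... | inj₁ v≋0 = nonNegative u v (N , u≋ , u-odd u v N D≋0 , D≋0 , λ _ → v≋0)
      where
      D≋0 : 1ℤ * (v * v) ≋ 0ℤ [mod + 2 ]
      D≋0 = *-cong-≋ (≋-refl {x = 1ℤ}) (*-cong-≋ v≋0 v≋0)
    ... | inj₂ v≋1 with parity-ℤ u
    ... | inj₂ u≋1 = contradiction (≋-trans (≋-sym (odd⇒≋1 odd-c)) (≋-trans
        (≋-respˡ (sym N) (+-cong-≋ (*-cong-≋ u≋1 u≋1) (*-cong-≋ (≋-refl {x = 1ℤ}) (*-cong-≋ v≋1 v≋1)))) (modulo 1ℤ refl))) 1≋̸0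
    ... | inj₁ u≋0 = nonNegative (- v) u (swap u v N ,
        -v≋ , u-odd (- v) u (swap u v N) D≋0 , D≋0 , λ _ → u≋0)
      where
      swap : ∀ u v → u * u + 1ℤ * (v * v) ≡ + c → - v * - v + 1ℤ * (u * u) ≡ + c
      swap u v N = trans (eq u v) N
        where
        eq : ∀ u v → - v * - v + 1ℤ * (u * u) ≡ u * u + 1ℤ * (v * v)
        eq = solve-∀
      D≋0 : 1ℤ * (u * u) ≋ 0ℤ [mod + 2 ]
      D≋0 = *-cong-≋ (≋-refl {x = 1ℤ}) (*-cong-≋ u≋0 u≋0)
      ρ²+1≋0 : + ρ * + ρ + 1ℤ ≋ 0ℤ [mod + c ]
      ρ²+1≋0 = ≋-respˡ (sym (trans (ℤ.pos-+ (ρ ℕ.* ρ) 1) (cong (λ x → x + 1ℤ) (ℤ.pos-* ρ ρ)))) (∣⇒≋0 c∣)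
      -- Multiplication by i sends u + v i to -v + u i. The congruence survives because ρ² ≡ -1
      -- gives -v ≡ ρ (ρ v) ≡ ρ u.
      -v≋ : - v ≋ + ρ * u [mod + c ]
      -v≋ = ≋-trans (≋-respˡ (sym (ℤ.+-identityˡ (- v))) (≋-sym (≋-respˡ (eq (+ ρ) v) (+-cong-≋ (*-cong-≋ ρ²+1≋0 (≋-refl {x = v})) (≋-refl {x = - v})))))
        (*-cong-≋ (≋-refl {x = + ρ}) (≋-sym u≋))
        where
        eq : ∀ r v → r * (r * v) ≡ (r * r + 1ℤ) * v + - v
        eq = solve-∀

  *-self : ∀ x → x * x ≡ + (∣ x ∣ ℕ.* ∣ x ∣)
  *-self (+ n)    = sym (ℤ.pos-* n n)
  *-self -[1+ n ] = refl

  -- The units of ℤ[√-d] are ±1 and, for d = 1, also ±i. The latter are recorded only through the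
  -- odd b, which is enough to exclude them by parity.
  unit-parity : ∀ d a b → 0 ℕ.< d → a * a + + d * (b * b) ≡ 1ℤ →
    (∣ a ∣ ≡ 1 × b ≡ 0ℤ) ⊎ (d ≡ 1 × b ≋ 1ℤ [mod + 2 ])
  unit-parity d a b 0<d N = cases b ∣N∣
    where
    ∣N∣ : ∣ a ∣ ℕ.* ∣ a ∣ ℕ.+ d ℕ.* (∣ b ∣ ℕ.* ∣ b ∣) ≡ 1
    ∣N∣ = ℤ.+-injective (trans (cong₂ (λ x y → x + y) (sym (*-self a))
      (trans (ℤ.pos-* d _) (cong (+ d *_) (sym (*-self b))))) N)
    1≤d*m*m : ∀ m → d ℕ.* (suc m ℕ.* suc m) ℕ.≤ 1 → d ≡ 1 × m ≡ 0
    1≤d*m*m m le =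
      ℕ.≤-antisym (ℕ.≤-trans (ℕ.m≤m*n d (suc m ℕ.* suc m)) le) 0<d ,
      ℕ.n≤0⇒n≡0 (ℕ.≤-pred (ℕ.≤-trans (ℕ.m≤m*n (suc m) (suc m))
        (ℕ.≤-trans (ℕ.m≤n*m (suc m ℕ.* suc m) d {{ℕ.>-nonZero 0<d}}) le)))
    cases : ∀ b → ∣ a ∣ ℕ.* ∣ a ∣ ℕ.+ d ℕ.* (∣ b ∣ ℕ.* ∣ b ∣) ≡ 1 →
      (∣ a ∣ ≡ 1 × b ≡ 0ℤ) ⊎ (d ≡ 1 × b ≋ 1ℤ [mod + 2 ])
    cases (+ zero) eq = inj₁ (ℕ.m*n≡1⇒m≡1 ∣ a ∣ ∣ a ∣
      (trans (sym (trans (cong (∣ a ∣ ℕ.* ∣ a ∣ ℕ.+_) (ℕ.*-zeroʳ d)) (ℕ.+-identityʳ _))) eq) , refl)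
    cases (+ suc m) eq with 1≤d*m*m m (ℕ.≤-trans (ℕ.m≤n+m _ _) (ℕ.≤-reflexive eq))
    ... | d≡1 , refl = inj₂ (d≡1 , ≋-refl)
    cases -[1+ m ] eq with 1≤d*m*m m (ℕ.≤-trans (ℕ.m≤n+m _ _) (ℕ.≤-reflexive eq))
    ... | d≡1 , refl = inj₂ (d≡1 , modulo (- 1ℤ) refl)

  pos-norm : ∀ d X Y → + (X ℕ.* X ℕ.+ d ℕ.* (Y ℕ.* Y)) ≡ + X * + X + + d * (+ Y * + Y)
  pos-norm d X Y = cong₂ (λ x y → x + y) (ℤ.pos-* X X) (trans (ℤ.pos-* d (Y ℕ.* Y)) (cong (+ d *_) (ℤ.pos-* Y Y)))

  -- As C = 2h + 1, `suc h` is the inverse of 2 modulo C. So ρ is X / 2^k, and dividing X² + d 4^k ≡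
  -- 0 by 4^k gives ρ² ≡ -d.
  sqrt-mod-norm : ∀ d X k C h → C ≡ suc (2 ℕ.* h) → C ℕ.∣ X ℕ.* X ℕ.+ d ℕ.* (2 ℕ.^ k ℕ.* 2 ℕ.^ k) →
    let ρ = X ℕ.* suc h ℕ.^ k in
    + (ρ ℕ.* ρ ℕ.+ d) ≋ 0ℤ [mod + C ] × + X ≋ + ρ * + (2 ℕ.^ k) [mod + C ]
  sqrt-mod-norm d X k C h C≡ NX = ρ²+d≋0 , ≋-respˡ (sym (ℤ.*-identityʳ (+ X)))
      (≋-respʳ (*-cong-≋ (≋-refl {x = + X}) (≋-sym IE≋1)) (trans (sym (ℤ.*-assoc (+ X) (+ I) (+ E)))
        (cong (_* + E) (sym (ℤ.pos-* X I)))))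
    where
    E = 2 ℕ.^ k
    I = suc h ℕ.^ k
    IE≋1 : + I * + E ≋ 1ℤ [mod + C ]
    IE≋1 = ≋-respˡ (trans (cong₂ _*_ (pos-^ (suc h) k) (pos-^ 2 k)) (sym (^-distribʳ-* (+ suc h) (+ 2) k)))
      (≋-respʳ (^-cong-≋ k (modulo 1ℤ 2[1+h])) (ℤ.^-zeroˡ k))
      where
      2[1+h] : + suc h * + 2 ≡ 1ℤ + 1ℤ * + C
      2[1+h] = trans (cong +_ (trans (ℕ.*-comm (suc h) 2) (trans (2*suc h) (cong suc (sym C≡)))))
        (cong (λ x → 1ℤ + x) (sym (ℤ.*-identityˡ (+ C))))
    NX≋0 : + X * + X + + d * (+ E * + E) ≋ 0ℤ [mod + C ]
    NX≋0 = ≋-respˡ (sym (pos-norm d X E)) (∣⇒≋0 NX)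
    ρ≡ : + ((X ℕ.* I) ℕ.* (X ℕ.* I) ℕ.+ d) ≡ (+ X * + I) * (+ X * + I) + + d * (1ℤ * 1ℤ)
    ρ≡ = cong₂ (λ x y → x + y) (trans (ℤ.pos-* (X ℕ.* I) (X ℕ.* I)) (cong (λ x → x * x) (ℤ.pos-* X I))) (sym (ℤ.*-identityʳ (+ d)))
    factor : ∀ X I E d → (X * I) * (X * I) + d * ((I * E) * (I * E)) ≡ I * I * (X * X + d * (E * E))
    factor = solve-∀
    ρ²+d≋0 : + ((X ℕ.* I) ℕ.* (X ℕ.* I) ℕ.+ d) ≋ 0ℤ [mod + C ]
    ρ²+d≋0 = ≋-trans
      (≋-respˡ ρ≡ (+-cong-≋ (≋-refl {x = (+ X * + I) * (+ X * + I)}) (*-cong-≋ (≋-refl {x = + d}) (*-cong-≋ (≋-sym IE≋1) (≋-sym IE≋1)))))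
      (≋-respˡ (factor (+ X) (+ I) (+ E) (+ d)) (≋-respʳ (*-cong-≋ (≋-refl {x = + I * + I}) NX≋0) (ℤ.*-zeroʳ (+ I * + I))))

  -- If the unit were ±i, the even v and the odd real part would make the imaginary part odd, yet it
  -- is 2^k with k > 0. So the unit is ±1 and 2^k is |v| times |im|. The second factor is odd
  -- because n is, hence 1.
  unit-associate : ∀ d → 0 ℕ.< d → ∀ k n u v a b D → Odd n → D ≡ + d * (v * v) →
    u ≋ 1ℤ [mod + 2 ] → D ≋ 0ℤ [mod + 2 ] → (d ≡ 1 → 0 ℕ.< k) → (d ≡ 1 → v ≋ 0ℤ [mod + 2 ]) →
    a * a + + d * (b * b) ≡ 1ℤ → + (2 ℕ.^ k) ≡ a * (v * im u D n) + b * re u D n →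
    ∣ v ∣ ≡ 2 ℕ.^ k × ∣ im u D n ∣ ≡ 1
  unit-associate d 0<d k n u v a b D odd-n D≡ u≋1 D≋0 0<k v≋0 N Y≡ = cases (unit-parity d a b 0<d N)
    where
    R = re u D n
    I = im u D n
    cases : (∣ a ∣ ≡ 1 × b ≡ 0ℤ) ⊎ (d ≡ 1 × b ≋ 1ℤ [mod + 2 ]) → ∣ v ∣ ≡ 2 ℕ.^ k × ∣ I ∣ ≡ 1
    cases (inj₂ (d≡1 , b≋1)) = contradiction (≋-trans (≋-sym Y≋1) (∣⇒≋0 (2∣2^ (0<k d≡1)))) 1≋̸0
      where
      Y≋1 : + (2 ℕ.^ k) ≋ 1ℤ [mod + 2 ]
      Y≋1 = ≋-respˡ Y≡ (≋-respʳ (+-cong-≋ (*-cong-≋ (≋-refl {x = a}) (*-cong-≋ (v≋0 d≡1) (≋-refl {x = I})))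
        (*-cong-≋ b≋1 (re-odd u≋1 D≋0 n))) (cong (_+ 1ℤ) (ℤ.*-zeroʳ a)))
      2∣2^ : ∀ {k} → 0 ℕ.< k → 2 ℕ.∣ 2 ℕ.^ k
      2∣2^ {suc k} _ = ℕ.m∣m*n (2 ℕ.^ k)
    cases (inj₁ (∣a∣≡1 , b≡0)) = sym (trans E≡ (trans (cong (∣ v ∣ ℕ.*_) ∣I∣≡1) (ℕ.*-identityʳ _))) , ∣I∣≡1
      where
      E≡ : 2 ℕ.^ k ≡ ∣ v ∣ ℕ.* ∣ I ∣
      E≡ = begin
        2 ℕ.^ k                      ≡⟨ cong ∣_∣ Y≡ ⟩
        ∣ a * (v * I) + b * R ∣      ≡⟨ cong (λ b → ∣ a * (v * I) + b * R ∣) b≡0 ⟩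
        ∣ a * (v * I) + 0ℤ ∣         ≡⟨ cong ∣_∣ (ℤ.+-identityʳ (a * (v * I))) ⟩
        ∣ a * (v * I) ∣              ≡⟨ ℤ.abs-* a _ ⟩
        ∣ a ∣ ℕ.* ∣ v * I ∣          ≡⟨ cong (ℕ._* ∣ v * I ∣) ∣a∣≡1 ⟩
        1 ℕ.* ∣ v * I ∣              ≡⟨ ℕ.*-identityˡ _ ⟩
        ∣ v * I ∣                    ≡⟨ ℤ.abs-* v I ⟩
        ∣ v ∣ ℕ.* ∣ I ∣              ∎
        where open ≡-Reasoning
      ∣I∣≡1 : ∣ I ∣ ≡ 1
      ∣I∣≡1 = ℕ.∣1⇒≡1 (odd∣2^*⇒∣ k (∣∣-odd _ (≋-trans (im-parity u≋1 D≋0 n) (odd⇒≋1 odd-n)))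
        (ℕ.divides ∣ v ∣ (trans (ℕ.*-identityʳ _) E≡)))

  -- The root u + v √-d inherits the whole power of two in its imaginary part. The square root of -d
  -- comes from `sqrt-mod-norm` modulo cⁿ, and reducing it modulo c selects the generator whose n-th
  -- power is the given element up to a unit.
  odd-power-norm : ∀ d → d ≡ 1 ⊎ d ≡ 2 → ∀ c X k n → Odd c → Odd n → (d ≡ 1 → 0 ℕ.< k) →
    X ℕ.* X ℕ.+ d ℕ.* (2 ℕ.^ k ℕ.* 2 ℕ.^ k) ≡ c ℕ.^ n →
    ∃ λ u → u ℕ.* u ℕ.+ d ℕ.* (2 ℕ.^ k ℕ.* 2 ℕ.^ k) ≡ c ×
      ∣ im (+ u) (+ (d ℕ.* (2 ℕ.^ k ℕ.* 2 ℕ.^ k))) n ∣ ≡ 1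
  odd-power-norm d d∈ c X k n odd-c odd-n 0<k NX =
    from-sqrt (X ℕ.* suc h ℕ.^ k) (proj₁ sqrt) (proj₂ sqrt)
    where
    h = proj₁ (odd-^ n odd-c)
    E = 2 ℕ.^ k
    sqrt = sqrt-mod-norm d X k (c ℕ.^ n) h (proj₂ (odd-^ n odd-c)) (ℕ.∣-reflexive (sym NX))
    0<d : ∀ {d} → d ≡ 1 ⊎ d ≡ 2 → 0 ℕ.< d
    0<d (inj₁ refl) = s≤s z≤n
    0<d (inj₂ refl) = s≤s z≤n
    c≢0 : NonZero c
    c≢0 = subst NonZero (sym (proj₂ odd-c)) _
    c∣cⁿ : c ℕ.∣ c ℕ.^ n
    c∣cⁿ = subst (λ n → c ℕ.∣ c ℕ.^ n) (sym (proj₂ odd-n)) (ℕ.m∣m*n (c ℕ.^ (2 ℕ.* proj₁ odd-n)))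
    Goal : Set
    Goal = ∃ λ u → u ℕ.* u ℕ.+ d ℕ.* (E ℕ.* E) ≡ c × ∣ im (+ u) (+ (d ℕ.* (E ℕ.* E))) n ∣ ≡ 1
    from-generator : ∀ u v D → D ≡ + d * (v * v) → + u * + u + + d * (v * v) ≡ + c → ∣ v ∣ ≡ E → ∣ im (+ u) D n ∣ ≡ 1 → Goal
    from-generator u v D D≡ N ∣v∣≡E ∣I∣≡1 = u ,
      ℤ.+-injective (trans (cong₂ (λ x y → x + y) (ℤ.pos-* u u) (trans (sym D≡′) D≡)) N) ,
      subst (λ D → ∣ im (+ u) D n ∣ ≡ 1) D≡′ ∣I∣≡1
      where
      D≡′ : D ≡ + (d ℕ.* (E ℕ.* E))
      D≡′ = trans D≡ (trans (cong (+ d *_) (trans (*-self v) (cong (λ e → + (e ℕ.* e)) ∣v∣≡E))) (sym (ℤ.pos-* d (E ℕ.* E))))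
    from-sqrt : ∀ ρ → + (ρ ℕ.* ρ ℕ.+ d) ≋ 0ℤ [mod + (c ℕ.^ n) ] → + X ≋ + ρ * + E [mod + (c ℕ.^ n) ] → Goal
    from-sqrt ρ ρ²+d≋0 X≋ =
      let u , v , N , u≋ , u≋1 , D≋0 , v≋0 = represent-odd d d∈ c ρ odd-c (ℕ.∣-trans c∣cⁿ (≋0⇒∣ ρ²+d≋0))
          a , b , N₁ , _ , Y≡ = root (+ d) (+ c) (+ ρ) (+ u) v {{c≢0}} N u≋ n (+ X) (+ E)
            (subst₂ (λ x C → x ≋ 0ℤ [mod C ]) (cong (_+ + d) (ℤ.pos-* ρ ρ)) (pos-^ c n) ρ²+d≋0)
            (trans (sym (pos-norm d X E)) (trans (cong +_ NX) (pos-^ c n)))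
            (subst (λ C → + X ≋ + ρ * + E [mod C ]) (pos-^ c n) X≋)
          ∣v∣≡E , ∣I∣≡1 = unit-associate d (0<d d∈) k n (+ u) v a b (+ d * (v * v)) odd-n refl u≋1 D≋0 0<k v≋0 N₁ Y≡
      in from-generator u v (+ d * (v * v)) refl N ∣v∣≡E ∣I∣≡1


  -- Gauss's lemma for an odd modulus

  signed : Bool → ℕ → ℤ
  signed false k = + suc k
  signed true  k = -[1+ k ]

  ∣signed∣ : ∀ b k → ∣ signed b k ∣ ≡ suc k
  ∣signed∣ false k = refl
  ∣signed∣ true  k = refl

  signed-injective : ∀ b b′ k k′ → signed b k ≡ signed b′ k′ → b ≡ b′ × k ≡ k′
  signed-injective false false k .k refl = refl , refl
  signed-injective true  true  k .k refl = refl , refl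

  -signed : ∀ b k → - signed b k ≡ signed (not b) k
  -signed false k = refl
  -signed true  k = refl

  -- Here `true` is the minus sign and an index k < h stands for k + 1, so the values `signed b k`
  -- run once through the non-zero residues modulo 2h + 1.
  module HalfSystem (h : ℕ) where

    n : ℤ
    n = + suc (2 ℕ.* h)

    small⇒≡ : ∀ {x y} → x ≋ y [mod n ] → ∣ x ∣ ℕ.≤ h → ∣ y ∣ ℕ.≤ h → x ≡ y
    small⇒≡ {x} {y} x≋y x≤ y≤ with ∣ x - y ∣ in eq
    ... | zero  = ℤ.i-j≡0⇒i≡j x y (ℤ.∣i∣≡0⇒i≡0 eq)
    ... | suc m = contradiction (subst (suc (2 ℕ.* h) ℕ.∣_) eq (≋⇒∣ x≋y)) (ℕ.>⇒∤ (s≤s (begin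
        suc m                ≡⟨ eq ⟨
        ∣ x - y ∣            ≤⟨ ℤ.∣i-j∣≤∣i∣+∣j∣ x y ⟩
        ∣ x ∣ ℕ.+ ∣ y ∣      ≤⟨ ℕ.+-mono-≤ x≤ y≤ ⟩
        h ℕ.+ h              ≡⟨ cong (h ℕ.+_) (ℕ.+-identityʳ h) ⟨
        2 ℕ.* h              ∎)))
      where open ℕ.≤-Reasoning

    signed-unique : ∀ b b′ (k k′ : Fin h) → signed b (toℕ k) ≋ signed b′ (toℕ k′) [mod n ] → b ≡ b′ × k ≡ k′
    signed-unique b b′ k k′ p =
      let b≡ , k≡ = signed-injective b b′ _ _ (small⇒≡ p (bound b k) (bound b′ k′)) in b≡ , toℕ-injective k≡
      where
      bound : ∀ b (k : Fin h) → ∣ signed b (toℕ k) ∣ ℕ.≤ h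
      bound b k = subst (ℕ._≤ h) (sym (∣signed∣ b (toℕ k))) (toℕ<n k)

    reduce : ∀ x → ¬ x ≋ 0ℤ [mod n ] → ∃₂ λ b (k : Fin h) → x ≋ signed b (toℕ k) [mod n ]
    reduce x x≢0 = from-remainder (x ℤ.%ℕ N) (ℤ.n%ℕd<d x N) (modulo (x ℤ./ℕ N) (ℤ.a≡a%ℕn+[a/ℕn]*n x N))
      where
      N = suc (2 ℕ.* h)
      from-remainder : ∀ r → r ℕ.< N → x ≋ + r [mod n ] → ∃₂ λ b (k : Fin h) → x ≋ signed b (toℕ k) [mod n ]
      from-remainder zero    _   x≋ = contradiction x≋ x≢0
      from-remainder (suc k) r<N x≋ with k ℕ.<? h
      ... | yes k<h = false , fromℕ< k<h , ≋-respʳ x≋ (cong (λ k → + suc k) (sym (toℕ-fromℕ< k<h)))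
      -- A remainder k + 1 above h becomes -(k′ + 1), where (k + 1) + (k′ + 1) = 2h + 1.
      ... | no  k≮h with ℕ.m≤n⇒∃[o]m+o≡n (ℕ.≤-pred r<N)
      ... | k′ , eq = true , fromℕ< k′<h , ≋-respʳ (≋-trans x≋ (modulo 1ℤ r≡)) (cong -[1+_] (sym (toℕ-fromℕ< k′<h)))
        where
        k′<h : k′ ℕ.< h
        k′<h = ℕ.+-cancelˡ-< h k′ h (begin-strict
          h ℕ.+ k′          <⟨ s≤s (ℕ.+-monoˡ-≤ k′ (ℕ.≮⇒≥ k≮h)) ⟩
          suc (k ℕ.+ k′)    ≡⟨ eq ⟩
          2 ℕ.* h           ≡⟨ cong (h ℕ.+_) (ℕ.+-identityʳ h) ⟩
          h ℕ.+ h           ∎)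
          where open ℕ.≤-Reasoning
        r≡ : + suc k ≡ -[1+ k′ ] + 1ℤ * n
        r≡ = trans (rearrange (+ suc k) (+ suc k′)) (cong (λ z → -[1+ k′ ] + z) (trans
          (cong +_ (trans (ℕ.+-suc (suc k) k′) (cong suc eq))) (sym (ℤ.*-identityˡ n))))
          where
          rearrange : ∀ x y → x ≡ - y + (x + y)
          rearrange = solve-∀

    *-signed : ∀ x b b′ k k′ → x * + suc k ≋ signed b′ k′ [mod n ] → x * signed b k ≋ signed (b xor b′) k′ [mod n ]
    *-signed x false b′ k k′ p = p
    *-signed x true  b′ k k′ p = ≋-respˡ (sym (ℤ.neg-distribʳ-* x (+ suc k))) (≋-respʳ (neg-cong-≋ p) (-signed b′ k′))

    module Multiplication (ρ ρ′ : ℤ) (ρ′ρ≋1 : ρ′ * ρ ≋ 1ℤ [mod n ]) where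

      unit : ∀ x → ρ′ * (ρ * x) ≋ x [mod n ]
      unit x = ≋-respˡ (sym (ℤ.*-assoc ρ′ ρ x)) (≋-respʳ (*-cong-≋ ρ′ρ≋1 (≋-refl {x = x})) (ℤ.*-identityˡ x))

      nonzero : ∀ (k : Fin h) → ¬ ρ * + suc (toℕ k) ≋ 0ℤ [mod n ]
      nonzero k p with small⇒≡ (≋-trans (≋-sym (unit (+ suc (toℕ k)))) (≋-respʳ (*-cong-≋ (≋-refl {x = ρ′}) p) (ℤ.*-zeroʳ ρ′))) (toℕ<n k) z≤n
      ... | ()

      ε : Fin h → Bool
      ε k = proj₁ (reduce (ρ * + suc (toℕ k)) (nonzero k))

      σ : Fin h → Fin h
      σ k = proj₁ (proj₂ (reduce (ρ * + suc (toℕ k)) (nonzero k)))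

      ρ* : ∀ k → ρ * + suc (toℕ k) ≋ signed (ε k) (toℕ (σ k)) [mod n ]
      ρ* k = proj₂ (proj₂ (reduce (ρ * + suc (toℕ k)) (nonzero k)))

    -- Gauss's lemma for a square: multiplication by ρ permutes the half system
    -- up to signs, so the signs for ρ² cancel in pairs.
    gauss-square : ∀ ρ ρ′ a → ρ′ * ρ ≋ 1ℤ [mod n ] → ρ * ρ ≋ a [mod n ] →
      ∀ (D : Fin h → Bool) → (∀ k → ∃ λ (τ : Fin h) → a * + suc (toℕ k) ≋ signed (D k) (toℕ τ) [mod n ]) →
      sum D ≡ false
    gauss-square ρ ρ′ a ρ′ρ≋1 ρ²≋a D a* = begin
      sum D                         ≡⟨ sum-cong-≗ D≗ ⟩
      sum (λ k → ε k xor ε (σ k))   ≡⟨ ∑-distrib-+ ε (ε ∘ σ) ⟩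
      sum ε xor sum (ε ∘ σ)         ≡⟨ cong (sum ε xor_) (sum-permute ε (permutation σ σ⁻¹ σσ⁻¹ σ⁻¹σ)) ⟨
      sum ε xor sum ε               ≡⟨ xor-same (sum ε) ⟩
      false                         ∎
      where
      open ≡-Reasoning
      ρρ′≋1 = ≋-respˡ (ℤ.*-comm ρ ρ′) ρ′ρ≋1
      open Multiplication ρ ρ′ ρ′ρ≋1
      open Multiplication ρ′ ρ ρρ′≋1 using () renaming (ε to ε⁻¹; σ to σ⁻¹; ρ* to ρ′*; unit to unit⁻¹)
      σ⁻¹σ : ∀ k → σ⁻¹ (σ k) ≡ k
      σ⁻¹σ k = proj₂ (signed-unique (ε k xor ε⁻¹ (σ k)) false _ _ (≋-trans
        (≋-sym (*-signed ρ′ (ε k) (ε⁻¹ (σ k)) _ _ (ρ′* (σ k))))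
        (≋-trans (*-cong-≋ (≋-refl {x = ρ′}) (≋-sym (ρ* k))) (unit (+ suc (toℕ k))))))
      σσ⁻¹ : ∀ k → σ (σ⁻¹ k) ≡ k
      σσ⁻¹ k = proj₂ (signed-unique (ε⁻¹ k xor ε (σ⁻¹ k)) false _ _ (≋-trans
        (≋-sym (*-signed ρ (ε⁻¹ k) (ε (σ⁻¹ k)) _ _ (ρ* (σ⁻¹ k))))
        (≋-trans (*-cong-≋ (≋-refl {x = ρ}) (≋-sym (ρ′* k))) (unit⁻¹ (+ suc (toℕ k))))))
      D≗ : ∀ k → D k ≡ ε k xor ε (σ k)
      D≗ k = proj₁ (signed-unique (D k) (ε k xor ε (σ k)) _ _ (≋-trans (≋-sym (proj₂ (a* k)))
        (≋-trans (≋-respʳ (*-cong-≋ (≋-sym ρ²≋a) (≋-refl {x = + suc (toℕ k)})) (ℤ.*-assoc ρ ρ _))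
          (≋-trans (*-cong-≋ (≋-refl {x = ρ}) (ρ* k)) (*-signed ρ (ε k) (ε (σ k)) _ _ (ρ* (σ k)))))))

  -- The summand lives on ℕ instead of `Fin`, so that a range can be split and shifted without
  -- transporting indices.
  xor-sum : (ℕ → Bool) → ℕ → Bool
  xor-sum f zero    = false
  xor-sum f (suc n) = f 0 xor xor-sum (f ∘ suc) n

  sum≡xor-sum : ∀ n f → sum {n} (f ∘ toℕ) ≡ xor-sum f n
  sum≡xor-sum zero    f = refl
  sum≡xor-sum (suc n) f = cong (f 0 xor_) (sum≡xor-sum n (f ∘ suc))

  xor-sum-cong : ∀ {f g} → (∀ k → f k ≡ g k) → ∀ n → xor-sum f n ≡ xor-sum g n
  xor-sum-cong f≗g zero    = refl
  xor-sum-cong f≗g (suc n) = cong₂ _xor_ (f≗g 0) (xor-sum-cong (f≗g ∘ suc) n)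

  xor-sum-+ : ∀ f m n → xor-sum f (m ℕ.+ n) ≡ xor-sum f m xor xor-sum (λ k → f (m ℕ.+ k)) n
  xor-sum-+ f zero    n = refl
  xor-sum-+ f (suc m) n = trans (cong (f 0 xor_) (xor-sum-+ (f ∘ suc) m n)) (sym (xor-assoc (f 0) _ _))

  xor-sum-periodic : ∀ f L → (∀ k → f (L ℕ.+ k) ≡ f k) → xor-sum f (L ℕ.+ L) ≡ false
  xor-sum-periodic f L f-periodic = trans (xor-sum-+ f L L)
    (trans (cong (xor-sum f L xor_) (xor-sum-cong f-periodic L)) (xor-same (xor-sum f L)))

  -- The signs of multiplication by -4e modulo 8ce - 1

  module GaussSigns (c e h : ℕ) .{{_ : NonZero c}} .{{_ : NonZero e}} (h+1≡ : suc h ≡ 4 ℕ.* (c ℕ.* e)) where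

    open HalfSystem h

    private instance
      2c≢0 : NonZero (2 ℕ.* c)
      2c≢0 = ℕ.m*n≢0 2 c

    h+1≡ℤ : + suc h ≡ + 4 * (+ c * + e)
    h+1≡ℤ = trans (cong +_ h+1≡) (trans (ℤ.pos-* 4 (c ℕ.* e)) (cong (+ 4 *_) (ℤ.pos-* c e)))

    n≡ : n ≡ + 8 * (+ c * + e) - 1ℤ
    n≡ = trans (cong (λ m → + m - 1ℤ) (sym (2*suc h))) (cong (_- 1ℤ)
      (trans (ℤ.pos-* 2 (suc h)) (trans (cong (+ 2 *_) h+1≡ℤ) (eq (+ c) (+ e)))))
      where
      eq : ∀ c e → + 2 * (+ 4 * (c * e)) ≡ + 8 * (c * e)
      eq = solve-∀

    -- Write j = r + 2c q with r < 2c. Since 8ce ≡ 1, the product -4e j is congruent to -(q + 4e r).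
    -- For j ≤ h one has q < 2e, and then q + 4e r is at most h exactly when r < c. Otherwise adding
    -- n brings the product into the positive half.
    D : ℕ → Bool
    D j = does (j ℕ.% (2 ℕ.* c) ℕ.<? c)

    4e[1+k]≤h+1 : ∀ {k} → k ℕ.< c → 4 ℕ.* e ℕ.+ 4 ℕ.* (e ℕ.* k) ℕ.≤ suc h
    4e[1+k]≤h+1 {k} k<c = begin
      4 ℕ.* e ℕ.+ 4 ℕ.* (e ℕ.* k)   ≡⟨ eq e k ⟩
      4 ℕ.* (suc k ℕ.* e)           ≤⟨ ℕ.*-monoʳ-≤ 4 (ℕ.*-monoˡ-≤ e k<c) ⟩
      4 ℕ.* (c ℕ.* e)               ≡⟨ h+1≡ ⟨
      suc h                         ∎
      where
      open ℕ.≤-Reasoning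
      eq : ∀ e k → 4 ℕ.* e ℕ.+ 4 ℕ.* (e ℕ.* k) ≡ 4 ℕ.* (suc k ℕ.* e)
      eq = ℕ-Ring.solve-∀

    -4e*-small : ∀ q r → q ℕ.< 2 ℕ.* e → r ℕ.< c → 0 ℕ.< r ℕ.+ q ℕ.* (2 ℕ.* c) →
      ∃ λ (τ : Fin h) → - (+ 4 * + e) * + (r ℕ.+ q ℕ.* (2 ℕ.* c)) ≋ -[1+ toℕ τ ] [mod n ]
    -4e*-small q r q<2e r<c 0<j = go (q ℕ.+ 4 ℕ.* (e ℕ.* r)) refl
      where
      j≡ : + (r ℕ.+ q ℕ.* (2 ℕ.* c)) ≡ + r + + q * (+ 2 * + c)
      j≡ = cong (λ x → + r + x) (trans (ℤ.pos-* q (2 ℕ.* c)) (cong (+ q *_) (ℤ.pos-* 2 c)))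
      w≡ : + (q ℕ.+ 4 ℕ.* (e ℕ.* r)) ≡ + q + + 4 * (+ e * + r)
      w≡ = cong (λ x → + q + x) (trans (ℤ.pos-* 4 (e ℕ.* r)) (cong (+ 4 *_) (ℤ.pos-* e r)))
      ring : ∀ c e q r → - (+ 4 * e) * (r + q * (+ 2 * c)) ≡ - (q + + 4 * (e * r)) + - q * (+ 8 * (c * e) - 1ℤ)
      ring = solve-∀
      go : ∀ w → q ℕ.+ 4 ℕ.* (e ℕ.* r) ≡ w →
        ∃ λ (τ : Fin h) → - (+ 4 * + e) * + (r ℕ.+ q ℕ.* (2 ℕ.* c)) ≋ -[1+ toℕ τ ] [mod n ]
      go zero w≡0 = contradiction (cong₂ (λ r q → r ℕ.+ q ℕ.* (2 ℕ.* c)) r≡0 (ℕ.m+n≡0⇒m≡0 q w≡0)) (ℕ.>⇒≢ 0<j)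
        where
        r≡0 : r ≡ 0
        r≡0 = ℕ.m*n≡0⇒m≡0 r e (trans (ℕ.*-comm r e) (ℕ.m*n≡0⇒m≡0 (e ℕ.* r) 4 (trans (ℕ.*-comm (e ℕ.* r) 4) (ℕ.m+n≡0⇒n≡0 q w≡0))))
      go (suc t) w≡t = fromℕ< t<h , modulo (- + q) (begin
          - (+ 4 * + e) * + (r ℕ.+ q ℕ.* (2 ℕ.* c))                   ≡⟨ cong (- (+ 4 * + e) *_) j≡ ⟩
          - (+ 4 * + e) * (+ r + + q * (+ 2 * + c))                   ≡⟨ ring (+ c) (+ e) (+ q) (+ r) ⟩
          - (+ q + + 4 * (+ e * + r)) + - + q * (+ 8 * (+ c * + e) - 1ℤ) ≡⟨ cong₂ (λ x y → - x + - + q * y) (trans (cong +_ (sym w≡t)) w≡) n≡ ⟨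
          -[1+ t ] + - + q * n                                        ≡⟨ cong (λ t → -[1+ t ] + - + q * n) (toℕ-fromℕ< t<h) ⟨
          -[1+ toℕ (fromℕ< t<h) ] + - + q * n                         ∎)
        where
        open ≡-Reasoning
        t<h : t ℕ.< h
        t<h = ℕ.≤-pred (subst (ℕ._< suc h) w≡t (ℕ.<-≤-trans
          (ℕ.+-monoˡ-< (4 ℕ.* (e ℕ.* r)) (ℕ.<-≤-trans q<2e (ℕ.*-monoˡ-≤ e {2} {4} (s≤s (s≤s z≤n))))) (4e[1+k]≤h+1 r<c)))

    -4e*-large : ∀ q s → q ℕ.< 2 ℕ.* e → s ℕ.< c →
      ∃ λ (τ : Fin h) → - (+ 4 * + e) * + (c ℕ.+ s ℕ.+ q ℕ.* (2 ℕ.* c)) ≋ + suc (toℕ τ) [mod n ]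
    -4e*-large q s q<2e s<c = go (ℕ.m≤n⇒∃[o]m+o≡n w<h)
      where
      w = q ℕ.+ 4 ℕ.* (e ℕ.* s)
      w<h : w ℕ.< h
      w<h = ℕ.≤-pred (begin
        suc (suc w)                                        ≤⟨ ℕ.+-mono-≤ (ℕ.m≤m*n 1 e) (ℕ.+-monoˡ-≤ (4 ℕ.* (e ℕ.* s)) q<2e) ⟩
        1 ℕ.* e ℕ.+ (2 ℕ.* e ℕ.+ 4 ℕ.* (e ℕ.* s))          ≤⟨ ℕ.m≤n+m _ e ⟩
        e ℕ.+ (1 ℕ.* e ℕ.+ (2 ℕ.* e ℕ.+ 4 ℕ.* (e ℕ.* s)))  ≡⟨ eq e (e ℕ.* s) ⟩
        4 ℕ.* e ℕ.+ 4 ℕ.* (e ℕ.* s)                        ≤⟨ 4e[1+k]≤h+1 s<c ⟩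
        suc h                                              ∎)
        where
        open ℕ.≤-Reasoning
        eq : ∀ e x → e ℕ.+ (1 ℕ.* e ℕ.+ (2 ℕ.* e ℕ.+ 4 ℕ.* x)) ≡ 4 ℕ.* e ℕ.+ 4 ℕ.* x
        eq = ℕ-Ring.solve-∀
      j≡ : + (c ℕ.+ s ℕ.+ q ℕ.* (2 ℕ.* c)) ≡ + c + + s + + q * (+ 2 * + c)
      j≡ = cong (λ x → + c + + s + x) (trans (ℤ.pos-* q (2 ℕ.* c)) (cong (+ q *_) (ℤ.pos-* 2 c)))
      w≡ : + w ≡ + q + + 4 * (+ e * + s)
      w≡ = cong (λ x → + q + x) (trans (ℤ.pos-* 4 (e ℕ.* s)) (cong (+ 4 *_) (ℤ.pos-* e s)))
      ring : ∀ c e q s → - (+ 4 * e) * (c + s + q * (+ 2 * c)) ≡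
        + 4 * (c * e) - (1ℤ + (q + + 4 * (e * s))) + (- q - 1ℤ) * (+ 8 * (c * e) - 1ℤ)
      ring = solve-∀
      cancel : ∀ x y → y ≡ x + y - x
      cancel = solve-∀
      go : (∃ λ τ → suc w ℕ.+ τ ≡ h) →
        ∃ λ (τ : Fin h) → - (+ 4 * + e) * + (c ℕ.+ s ℕ.+ q ℕ.* (2 ℕ.* c)) ≋ + suc (toℕ τ) [mod n ]
      go (τ , eq) = fromℕ< τ<h , modulo (- + q - 1ℤ) (begin
          - (+ 4 * + e) * + (c ℕ.+ s ℕ.+ q ℕ.* (2 ℕ.* c))                  ≡⟨ cong (- (+ 4 * + e) *_) j≡ ⟩
          - (+ 4 * + e) * (+ c + + s + + q * (+ 2 * + c))                  ≡⟨ ring (+ c) (+ e) (+ q) (+ s) ⟩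
          + 4 * (+ c * + e) - (1ℤ + (+ q + + 4 * (+ e * + s))) + (- + q - 1ℤ) * (+ 8 * (+ c * + e) - 1ℤ)
            ≡⟨ cong₂ (λ x y → x + (- + q - 1ℤ) * y) τ≡ n≡ ⟨
          + suc τ + (- + q - 1ℤ) * n                                       ≡⟨ cong (λ t → + suc t + (- + q - 1ℤ) * n) (toℕ-fromℕ< τ<h) ⟨
          + suc (toℕ (fromℕ< τ<h)) + (- + q - 1ℤ) * n                      ∎)
        where
        open ≡-Reasoning
        τ<h : τ ℕ.< h
        τ<h = subst (τ ℕ.<_) eq (s≤s (ℕ.m≤n+m τ w))
        τ≡ : + suc τ ≡ + 4 * (+ c * + e) - (1ℤ + (+ q + + 4 * (+ e * + s)))
        τ≡ = trans (cancel (+ suc w) (+ suc τ)) (cong₂ _-_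
          (trans (cong +_ (trans (ℕ.+-suc (suc w) τ) (cong suc eq))) h+1≡ℤ) (cong (λ x → 1ℤ + x) w≡))

    -4e* : ∀ (k : Fin h) → ∃ λ (τ : Fin h) → - (+ 4 * + e) * + suc (toℕ k) ≋ signed (D (suc (toℕ k))) (toℕ τ) [mod n ]
    -4e* k = cases (r ℕ.<? c)
      where
      j = suc (toℕ k)
      q = j ℕ./ (2 ℕ.* c)
      r = j ℕ.% (2 ℕ.* c)
      j≡ : j ≡ r ℕ.+ q ℕ.* (2 ℕ.* c)
      j≡ = ℕ.m≡m%n+[m/n]*n j (2 ℕ.* c)
      q<2e : q ℕ.< 2 ℕ.* e
      q<2e = ℕ.m<n*o⇒m/o<n (subst (j ℕ.<_) (trans h+1≡ (eq c e)) (s≤s (toℕ<n k)))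
        where
        eq : ∀ c e → 4 ℕ.* (c ℕ.* e) ≡ 2 ℕ.* e ℕ.* (2 ℕ.* c)
        eq = ℕ-Ring.solve-∀
      cases : ∀ (d : Dec (r ℕ.< c)) → ∃ λ (τ : Fin h) → - (+ 4 * + e) * + j ≋ signed (does d) (toℕ τ) [mod n ]
      cases (yes r<c) = subst (λ j → ∃ λ (τ : Fin h) → - (+ 4 * + e) * + j ≋ -[1+ toℕ τ ] [mod n ]) (sym j≡)
        (-4e*-small q r q<2e r<c (subst (0 ℕ.<_) j≡ (s≤s z≤n)))
      cases (no  r≮c) with ℕ.m≤n⇒∃[o]m+o≡n (ℕ.≮⇒≥ r≮c)
      ... | s , c+s≡r = subst (λ j → ∃ λ (τ : Fin h) → - (+ 4 * + e) * + j ≋ + suc (toℕ τ) [mod n ])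
        (trans (cong (ℕ._+ q ℕ.* (2 ℕ.* c)) c+s≡r) (sym j≡))
        (-4e*-large q s q<2e (ℕ.+-cancelˡ-< c s c (subst₂ ℕ._<_ (sym c+s≡r) (cong (c ℕ.+_) (ℕ.+-identityʳ c)) (ℕ.m%n<n j (2 ℕ.* c)))))

    -- Dividing k by 2c shows that the sign of - 4e k depends only on k mod 2c;
    -- as h + 1 = 2c (2e), the signs over [0, h + 1) cancel, which leaves the
    -- contribution of k = 0.
    -4e-nonresidue : ∀ ρ → ¬ ρ * ρ ≋ - (+ 4 * + e) [mod n ]
    -4e-nonresidue ρ ρ²≋ = contradiction (trans (sym (cong (true xor_) signs)) signs₀) λ ()
      where
      inverse : ∀ c e → - (+ 2 * c) * - (+ 4 * e) ≡ 1ℤ + 1ℤ * (+ 8 * (c * e) - 1ℤ)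
      inverse = solve-∀
      -- -2c inverts -4e, as their product is 8ce ≡ 1, so -2c ρ inverts a square root ρ of -4e.
      ρ′ρ≋1 : (- (+ 2 * + c) * ρ) * ρ ≋ 1ℤ [mod n ]
      ρ′ρ≋1 = ≋-respˡ (ℤ.*-assoc (- (+ 2 * + c)) ρ ρ) (≋-trans (*-cong-≋ (≋-refl {x = - (+ 2 * + c)}) ρ²≋)
        (modulo 1ℤ (trans (inverse (+ c) (+ e)) (cong (λ m → 1ℤ + 1ℤ * m) (sym n≡)))))
      signs : xor-sum (D ∘ suc) h ≡ false
      signs = trans (sym (sum≡xor-sum h (D ∘ suc)))
        (gauss-square ρ (- (+ 2 * + c) * ρ) (- (+ 4 * + e)) ρ′ρ≋1 ρ²≋ (D ∘ suc ∘ toℕ) -4e*)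
      D0 : D 0 ≡ true
      D0 = dec-true (0 ℕ.% (2 ℕ.* c) ℕ.<? c) (subst (ℕ._< c) (sym (ℕ.m<n⇒m%n≡m (ℕ.>-nonZero⁻¹ (2 ℕ.* c)))) (ℕ.>-nonZero⁻¹ c))
      D-periodic : ∀ k → D (2 ℕ.* c ℕ.* e ℕ.+ k) ≡ D k
      D-periodic k = cong (λ r → does (r ℕ.<? c)) (trans (cong (ℕ._% (2 ℕ.* c)) (eq c e k)) (ℕ.[m+kn]%n≡m%n k e (2 ℕ.* c)))
        where
        eq : ∀ c e k → 2 ℕ.* c ℕ.* e ℕ.+ k ≡ k ℕ.+ e ℕ.* (2 ℕ.* c)
        eq = ℕ-Ring.solve-∀
      signs₀ : true xor xor-sum (D ∘ suc) h ≡ false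
      signs₀ = trans (cong (_xor xor-sum (D ∘ suc) h) (sym D0))
        (trans (cong (xor-sum D) (trans h+1≡ (eq c e))) (xor-sum-periodic D (2 ℕ.* c ℕ.* e) D-periodic))
        where
        eq : ∀ c e → 4 ℕ.* (c ℕ.* e) ≡ 2 ℕ.* c ℕ.* e ℕ.+ 2 ℕ.* c ℕ.* e
        eq = ℕ-Ring.solve-∀

  -- Powers modulo small numbers, and 5^x + 2 = 3^z for large z

  ∣⇒≋ : ∀ {x y n} → ∣ n ∣ ℕ.∣ ∣ x - y ∣ → x ≋ y [mod n ]
  ∣⇒≋ {x} {y} {n} n∣ with ∣ᵤ⇒∣ {n} {x - y} n∣
  ... | divides q x-y≡ = modulo q (trans (split x y) (cong (λ z → y + z) x-y≡))
    where
    split : ∀ x y → x ≡ y + (x - y)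
    split = solve-∀

  +modulus : ∀ {x y n} → x ≡ y + n → x ≋ y [mod n ]
  +modulus {y = y} {n} p = modulo 1ℤ (trans p (cong (λ z → y + z) (sym (ℤ.*-identityˡ n))))

  -1^even : ∀ {n} → Even n → (- 1ℤ) ^ n ≡ 1ℤ
  -1^even (h , refl) = trans (sym (ℤ.^-*-assoc (- 1ℤ) 2 h)) (ℤ.^-zeroˡ h)

  -1^odd : ∀ {n} → Odd n → (- 1ℤ) ^ n ≡ - 1ℤ
  -1^odd (h , refl) = cong (- 1ℤ *_) (-1^even (h , refl))

  ^-double : ∀ x k → x ^ (2 ℕ.* k) ≡ x ^ k * x ^ k
  ^-double x k = trans (cong (λ n → x ^ (k ℕ.+ n)) (ℕ.+-identityʳ k)) (ℤ.^-distribˡ-+-* x k k)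

  ^-period : ∀ {x n} p → x ^ p ≋ 1ℤ [mod n ] → .{{_ : NonZero p}} → ∀ k → x ^ k ≋ x ^ (k ℕ.% p) [mod n ]
  ^-period {x} {n} p xᵖ≋1 k = ≋-respˡ split (≋-respʳ
      (*-cong-≋ (≋-refl {x = x ^ (k ℕ.% p)}) (≋-respʳ (^-cong-≋ (k ℕ./ p) xᵖ≋1) (ℤ.^-zeroˡ (k ℕ./ p))))
      (ℤ.*-identityʳ _))
    where
    split : x ^ k ≡ x ^ (k ℕ.% p) * (x ^ p) ^ (k ℕ./ p)
    split = trans (cong (x ^_) (trans (ℕ.m≡m%n+[m/n]*n k p) (cong (k ℕ.% p ℕ.+_) (ℕ.*-comm (k ℕ./ p) p))))
      (trans (ℤ.^-distribˡ-+-* x (k ℕ.% p) (p ℕ.* (k ℕ./ p))) (cong (x ^ (k ℕ.% p) *_) (sym (ℤ.^-*-assoc x p (k ℕ./ p)))))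

  -- Modulo 81 the right side vanishes, which leaves only x ≡ 20 modulo 54, the order of 5. The
  -- prime 109 is suited to finish because 5^54 ≡ 1 holds there too, so 5^x is one known residue,
  -- while 3^27 ≡ 1 leaves just 27 powers of 3 to compare.
  5^x+2≢3^[4+z] : ∀ x z → ¬ 5 ℕ.^ x ℕ.+ 2 ≡ 3 ℕ.^ (4 ℕ.+ z)
  5^x+2≢3^[4+z] x z eq = from-yes (all? {27} λ s → ¬? (109 ℕ.∣? ∣ (+ 5) ^ 20 + + 2 - (+ 3) ^ toℕ s ∣)) s
    (≋⇒∣ {(+ 5) ^ 20 + + 2} {(+ 3) ^ toℕ s} {+ 109} (≋-trans (+-cong-≋ (≋-sym 5^x≋109) (≋-refl {x = + 2}))
      (≋-respˡ eqℤ (≋-respʳ (^-period 27 (∣⇒≋ (from-yes (109 ℕ.∣? ∣ (+ 3) ^ 27 - 1ℤ ∣))) (4 ℕ.+ z))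
        (cong ((+ 3) ^_) (sym (toℕ-fromℕ< (ℕ.m%n<n (4 ℕ.+ z) 27))))))))
    where
    s : Fin 27
    s = fromℕ< (ℕ.m%n<n (4 ℕ.+ z) 27)
    r : Fin 54
    r = fromℕ< (ℕ.m%n<n x 54)
    eqℤ : (+ 5) ^ x + + 2 ≡ (+ 3) ^ (4 ℕ.+ z)
    eqℤ = trans (cong (_+ + 2) (sym (pos-^ 5 x))) (trans (cong +_ eq) (pos-^ 3 (4 ℕ.+ z)))
    5^x≋ : ∀ {n} → (+ 5) ^ 54 ≋ 1ℤ [mod n ] → (+ 5) ^ x ≋ (+ 5) ^ toℕ r [mod n ]
    5^x≋ p = ≋-respʳ (^-period 54 p x) (cong ((+ 5) ^_) (sym (toℕ-fromℕ< (ℕ.m%n<n x 54))))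
    3^z≋0 : (+ 3) ^ (4 ℕ.+ z) ≋ 0ℤ [mod + 81 ]
    3^z≋0 = modulo ((+ 3) ^ z) (l ((+ 3) ^ z))
      where
      l : ∀ t → + 3 * (+ 3 * (+ 3 * (+ 3 * t))) ≡ 0ℤ + t * + 81
      l = solve-∀
    r≡20 : toℕ r ≡ 20
    r≡20 = from-yes (all? {54} λ r → (81 ℕ.∣? ∣ (+ 5) ^ toℕ r + + 2 - 0ℤ ∣) →-dec (toℕ r ℕ.≟ 20)) r
      (≋⇒∣ {(+ 5) ^ toℕ r + + 2} {0ℤ} {+ 81} (≋-trans (+-cong-≋ (≋-sym (5^x≋ (∣⇒≋ (from-yes (81 ℕ.∣? ∣ (+ 5) ^ 54 - 1ℤ ∣))))) (≋-refl {x = + 2}))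
        (≋-respˡ eqℤ 3^z≋0)))
    5^x≋109 : (+ 5) ^ x ≋ (+ 5) ^ 20 [mod + 109 ]
    5^x≋109 = ≋-respʳ (5^x≋ (∣⇒≋ (from-yes (109 ℕ.∣? ∣ (+ 5) ^ 54 - 1ℤ ∣)))) (cong ((+ 5) ^_) r≡20)

  -- Imaginary parts of powers of 1 + √-D

  re-+ : ∀ u D m n → re u D (m ℕ.+ n) ≡ re u D m * re u D n - D * (im u D m * im u D n)
  im-+ : ∀ u D m n → im u D (m ℕ.+ n) ≡ re u D m * im u D n + im u D m * re u D n
  re-+ u D zero    n = eq D (re u D n) (im u D n)
    where
    eq : ∀ D r i → r ≡ 1ℤ * r - D * (0ℤ * i)
    eq = solve-∀
  re-+ u D (suc m) n = trans (cong₂ (λ r i → u * r - D * i) (re-+ u D m n) (im-+ u D m n))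
    (eq u D (re u D m) (im u D m) (re u D n) (im u D n))
    where
    eq : ∀ u D r i s j → u * (r * s - D * (i * j)) - D * (r * j + i * s) ≡
      (u * r - D * i) * s - D * ((r + u * i) * j)
    eq = solve-∀
  im-+ u D zero    n = eq (re u D n) (im u D n)
    where
    eq : ∀ r i → i ≡ 1ℤ * i + 0ℤ * r
    eq = solve-∀
  im-+ u D (suc m) n = trans (cong₂ (λ r i → r + u * i) (re-+ u D m n) (im-+ u D m n))
    (eq u D (re u D m) (im u D m) (re u D n) (im u D n))
    where
    eq : ∀ u D r i s j → r * s - D * (i * j) + u * (r * j + i * s) ≡ (u * r - D * i) * j + (r + u * i) * s
    eq = solve-∀

  module _ {n u D D′ : ℤ} (D≋ : D ≋ D′ [mod n ]) where
    re-cong : ∀ k → re u D k ≋ re u D′ k [mod n ]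
    im-cong : ∀ k → im u D k ≋ im u D′ k [mod n ]
    re-cong zero    = ≋-refl
    re-cong (suc k) = +-cong-≋ (*-cong-≋ (≋-refl {x = u}) (re-cong k)) (neg-cong-≋ (*-cong-≋ D≋ (im-cong k)))
    im-cong zero    = ≋-refl
    im-cong (suc k) = +-cong-≋ (re-cong k) (*-cong-≋ (≋-refl {x = u}) (im-cong k))

  -- With e the 2-adic valuation of k, (1 + √-D)ᵏ ≡ 1 + 2ᵉ √-D modulo 2ᵉ⁺¹.
  2-adic : ∀ N k → 0 ℕ.< k → ∃ λ e →
    re 1ℤ (+ 4 * N) k ≋ 1ℤ [mod + 2 * (+ 2) ^ e ] × im 1ℤ (+ 4 * N) k ≋ (+ 2) ^ e [mod + 2 * (+ 2) ^ e ]
  2-adic N = <-rec _ step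
    where
    D = + 4 * N
    D≋0 : D ≋ 0ℤ [mod + 2 ]
    D≋0 = modulo (+ 2 * N) (eq N)
      where
      eq : ∀ N → + 4 * N ≡ 0ℤ + + 2 * N * + 2
      eq = solve-∀
    Goal : ℕ → Set
    Goal k = 0 ℕ.< k → ∃ λ e → re 1ℤ D k ≋ 1ℤ [mod + 2 * (+ 2) ^ e ] × im 1ℤ D k ≋ (+ 2) ^ e [mod + 2 * (+ 2) ^ e ]
    step : ∀ k → (∀ {h} → h ℕ.< k → Goal h) → Goal k
    step k rec 0<k with parity k
    ... | inj₂ odd-k = 0 , re-odd ≋-refl D≋0 k , ≋-trans (im-parity ≋-refl D≋0 k) (odd⇒≋1 odd-k)
    ... | inj₁ (zero , refl) = contradiction 0<k λ ()
    ... | inj₁ (h@(suc h′) , refl) with rec {h} (ℕ.m<m+n h (s≤s z≤n)) (s≤s z≤n)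
    -- Squaring the power for h = k / 2. The real part stays 1 modulo 2^(e+2) because D carries a
    -- factor 4.
    ... | e , modulo r re≡ , modulo s im≡ = suc e ,
      modulo (r + r * r * t - N * t * ((1ℤ + + 2 * s) * (1ℤ + + 2 * s)))
        (trans (cong (λ k → re 1ℤ D (h ℕ.+ k)) (ℕ.+-identityʳ h)) (trans (re-+ 1ℤ D h h)
          (trans (cong₂ (λ x y → x * x - D * (y * y)) re≡ im≡) (eqʳ N t r s)))) ,
      modulo (s + r * t * (1ℤ + + 2 * s))
        (trans (cong (λ k → im 1ℤ D (h ℕ.+ k)) (ℕ.+-identityʳ h)) (trans (im-+ 1ℤ D h h)
          (trans (cong₂ (λ x y → x * y + y * x) re≡ im≡) (eqⁱ t r s))))
      where
      t = (+ 2) ^ e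
      eqʳ : ∀ N t r s → (1ℤ + r * (+ 2 * t)) * (1ℤ + r * (+ 2 * t)) - + 4 * N * ((t + s * (+ 2 * t)) * (t + s * (+ 2 * t))) ≡
        1ℤ + (r + r * r * t - N * t * ((1ℤ + + 2 * s) * (1ℤ + + 2 * s))) * (+ 2 * (+ 2 * t))
      eqʳ = solve-∀
      eqⁱ : ∀ t r s → (1ℤ + r * (+ 2 * t)) * (t + s * (+ 2 * t)) + (t + s * (+ 2 * t)) * (1ℤ + r * (+ 2 * t)) ≡
        + 2 * t + (s + r * t * (1ℤ + + 2 * s)) * (+ 2 * (+ 2 * t))
      eqⁱ = solve-∀

  -- The imaginary part of the power k + 2 is the sum of both coordinates of the power k + 1. With e
  -- the 2-adic valuation of k + 1, the value 1 would mean 1 + 2^e ≡ 1 modulo 2^(e+1).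
  im≢1 : ∀ N k → ¬ im 1ℤ (+ 4 * N) (suc (suc k)) ≡ 1ℤ
  im≢1 N k im≡1 with 2-adic N (suc k) (s≤s z≤n)
  ... | e , re≋1 , im≋ = contradiction 2t∣t (ℕ.>⇒∤ {{ℕ.m^n≢0 2 e}} (ℕ.^-monoʳ-< 2 (s≤s (s≤s z≤n)) (ℕ.n<1+n e)))
    where
    t = (+ 2) ^ e
    1+t≋1 : 1ℤ + t ≋ 1ℤ [mod + 2 * t ]
    1+t≋1 = ≋-respʳ (+-cong-≋ (≋-sym re≋1) (≋-sym (≋-respˡ (ℤ.*-identityˡ (im 1ℤ (+ 4 * N) (suc k))) im≋))) im≡1
    cancel : ∀ t → t ≡ - 1ℤ + (1ℤ + t)
    cancel = solve-∀
    2t∣t : 2 ℕ.^ suc e ℕ.∣ 2 ℕ.^ e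
    2t∣t = ≋0⇒∣ (subst₂ (λ x n → x ≋ 0ℤ [mod n ]) (sym (pos-^ 2 e)) (sym (pos-^ 2 (suc e)))
      (≋-respˡ (cancel t) (+-cong-≋ (≋-refl {x = - 1ℤ}) 1+t≋1)))

  -- Modulo 8 the coefficient is k, so k ≡ 7 (mod 8), and (1 + i)⁷ = 8 - 8i,
  -- (1 + i)⁸ = 16, so modulo 3 the coefficient is 1.
  im≢-1 : ∀ N k → + 4 * N ≋ 0ℤ [mod + 8 ] → + 4 * N ≋ 1ℤ [mod + 3 ] → ¬ im 1ℤ (+ 4 * N) k ≡ - 1ℤ
  im≢-1 N k D≋0 D≋1 im≡-1 = absurd (≋0⇒∣ {8} {suc k} (+-cong-≋ (≋-refl {x = 1ℤ}) (≋-trans (≋-sym (im≋ k)) (≋-reflexive im≡-1))))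
    where
    D = + 4 * N
    re≋1 : ∀ k → re 1ℤ D k ≋ 1ℤ [mod + 8 ]
    re≋1 zero    = ≋-refl
    re≋1 (suc k) = +-cong-≋ (*-cong-≋ (≋-refl {x = 1ℤ}) (re≋1 k)) (neg-cong-≋ (*-cong-≋ D≋0 (≋-refl {x = im 1ℤ D k})))
    im≋ : ∀ k → im 1ℤ D k ≋ + k [mod + 8 ]
    im≋ zero    = ≋-refl
    im≋ (suc k) = +-cong-≋ (re≋1 k) (≋-respˡ (ℤ.*-identityˡ (im 1ℤ D k)) (im≋ k))
    re-8 : ∀ t → re 1ℤ 1ℤ (t ℕ.* 8) ≋ 1ℤ [mod + 3 ]
    im-8 : ∀ t → im 1ℤ 1ℤ (t ℕ.* 8) ≋ 0ℤ [mod + 3 ]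
    re-8 zero    = ≋-refl
    re-8 (suc t) = ≋-respˡ (re-+ 1ℤ 1ℤ 8 (t ℕ.* 8)) (≋-trans
      (+-cong-≋ (*-cong-≋ (≋-refl {x = + 16}) (re-8 t)) (≋-refl {x = - (1ℤ * (0ℤ * im 1ℤ 1ℤ (t ℕ.* 8)))})) (modulo (+ 5) refl))
    im-8 zero    = ≋-refl
    im-8 (suc t) = ≋-respˡ (im-+ 1ℤ 1ℤ 8 (t ℕ.* 8))
      (+-cong-≋ (*-cong-≋ (≋-refl {x = + 16}) (im-8 t)) (≋-refl {x = 0ℤ * re 1ℤ 1ℤ (t ℕ.* 8)}))
    absurd : ¬ 8 ℕ.∣ suc k
    absurd (ℕ.divides (suc t) refl) = from-no (3 ℕ.∣? 2) (≋⇒∣ {1ℤ} { - 1ℤ} {+ 3} (≋-trans (≋-sym im-7) (≋-trans (≋-sym (im-cong {u = 1ℤ} D≋1 k)) (≋-reflexive im≡-1))))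
      where
      im-7 : im 1ℤ 1ℤ (7 ℕ.+ t ℕ.* 8) ≋ 1ℤ [mod + 3 ]
      im-7 = ≋-respˡ (im-+ 1ℤ 1ℤ 7 (t ℕ.* 8)) (≋-trans
        (+-cong-≋ (*-cong-≋ (≋-refl {x = + 8}) (im-8 t)) (*-cong-≋ (≋-refl {x = - (+ 8)}) (re-8 t))) (modulo (- (+ 3)) refl))

  -- Divisors of ρ² + 1 and ρ² + 2

  square-residue : Fin 3 → ℤ
  square-residue zero             = 0ℤ
  square-residue (suc zero)       = 1ℤ
  square-residue (suc (suc zero)) = + 4

  square-mod-8 : ∀ x → ∃ λ r → x * x ≋ square-residue r [mod + 8 ]
  square-mod-8 x with parity-ℤ x
  ... | inj₁ (modulo q refl) with parity-ℤ q
  ... | inj₁ (modulo p refl) = zero , modulo (+ 2 * (p * p)) (eq p)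
    where
    eq : ∀ p → (0ℤ + (0ℤ + p * + 2) * + 2) * (0ℤ + (0ℤ + p * + 2) * + 2) ≡ 0ℤ + + 2 * (p * p) * + 8
    eq = solve-∀
  ... | inj₂ (modulo p refl) = suc (suc zero) , modulo (+ 2 * (p * p + p)) (eq p)
    where
    eq : ∀ p → (0ℤ + (1ℤ + p * + 2) * + 2) * (0ℤ + (1ℤ + p * + 2) * + 2) ≡ + 4 + + 2 * (p * p + p) * + 8
    eq = solve-∀
  square-mod-8 x | inj₂ (modulo q refl) with parity-ℤ q
  ... | inj₁ (modulo p refl) = suc zero , modulo (p * (+ 2 * p + 1ℤ)) (eq p)
    where
    eq : ∀ p → (1ℤ + (0ℤ + p * + 2) * + 2) * (1ℤ + (0ℤ + p * + 2) * + 2) ≡ 1ℤ + p * (+ 2 * p + 1ℤ) * + 8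
    eq = solve-∀
  ... | inj₂ (modulo p refl) = suc zero , modulo ((1ℤ + + 2 * p) * (1ℤ + p)) (eq p)
    where
    eq : ∀ p → (1ℤ + (1ℤ + p * + 2) * + 2) * (1ℤ + (1ℤ + p * + 2) * + 2) ≡ 1ℤ + (1ℤ + + 2 * p) * (1ℤ + p) * + 8
    eq = solve-∀

  -- By `represent` a divisor of ρ² + 1 is itself a sum of two squares, and such a sum is never 3
  -- modulo 4.
  3+4g∤ρ²+1 : ∀ g ρ → ¬ 3 ℕ.+ 4 ℕ.* g ℕ.∣ ρ ℕ.* ρ ℕ.+ 1
  3+4g∤ρ²+1 g ρ c∣ =
    let u , v , N , _ = represent 1 (s≤s z≤n) (s≤s z≤n) (3 ℕ.+ 4 ℕ.* g) ρ (s≤s z≤n) c∣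
        r , u²≋ = square-mod-8 u
        s , v²≋ = square-mod-8 v
    in from-yes (all? λ r → all? λ s → ¬? (4 ℕ.∣? ∣ square-residue r + 1ℤ * square-residue s - + 3 ∣)) r s
      (≋⇒∣ {square-residue r + 1ℤ * square-residue s} {+ 3} {+ 4} (≋-trans (≋-weaken (modulo (+ 2) refl)
        (+-cong-≋ (≋-sym u²≋) (*-cong-≋ (≋-refl {x = 1ℤ}) (≋-sym v²≋))))
        (≋-respˡ N (≋-respʳ (+-cong-≋ (≋-refl {x = + 3}) (∣⇒≋0 (ℕ.m∣m*n g))) refl))))

  -- A divisor of ρ² + 2 has the form u² + 2v², which never takes the value 7 modulo 8.
  7+8g∤ρ²+2 : ∀ g ρ → ¬ 7 ℕ.+ 8 ℕ.* g ℕ.∣ ρ ℕ.* ρ ℕ.+ 2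
  7+8g∤ρ²+2 g ρ c∣ =
    let u , v , N , _ = represent 2 (s≤s z≤n) (s≤s (s≤s z≤n)) (7 ℕ.+ 8 ℕ.* g) ρ (s≤s z≤n) c∣
        r , u²≋ = square-mod-8 u
        s , v²≋ = square-mod-8 v
    in from-yes (all? λ r → all? λ s → ¬? (8 ℕ.∣? ∣ square-residue r + + 2 * square-residue s - + 7 ∣)) r s
      (≋⇒∣ {square-residue r + + 2 * square-residue s} {+ 7} {+ 8} (≋-trans
        (+-cong-≋ (≋-sym u²≋) (*-cong-≋ (≋-refl {x = + 2}) (≋-sym v²≋)))
        (≋-respˡ N (≋-respʳ (+-cong-≋ (≋-refl {x = + 7}) (∣⇒≋0 (ℕ.m∣m*n g))) refl))))

  ∣∣≡1 : ∀ x → ∣ x ∣ ≡ 1 → x ≡ 1ℤ ⊎ x ≡ - 1ℤ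
  ∣∣≡1 (+ _)    refl = inj₁ refl
  ∣∣≡1 -[1+ _ ] refl = inj₂ refl

  ^-double-ℕ : ∀ x k → x ℕ.^ (2 ℕ.* k) ≡ x ℕ.^ k ℕ.* x ℕ.^ k
  ^-double-ℕ x k = trans (cong (λ n → x ℕ.^ (k ℕ.+ n)) (ℕ.+-identityʳ k)) (ℕ.^-distribˡ-+-* x k k)

  pos-equation : ∀ b x c y d z → b ℕ.^ x ℕ.+ c ℕ.^ y ≡ d ℕ.^ z → (+ b) ^ x + (+ c) ^ y ≡ (+ d) ^ z
  pos-equation b x c y d z eq = trans (cong₂ (λ s t → s + t) (sym (pos-^ b x)) (sym (pos-^ c y))) (trans (cong +_ eq) (pos-^ d z))

  0^≋0 : ∀ {b n} x → 0 ℕ.< x → b ≋ 0ℤ [mod n ] → b ^ x ≋ 0ℤ [mod n ]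
  0^≋0 {b} (suc x) _ b≋0 = *-cong-≋ b≋0 (≋-refl {x = b ^ x})

  1^≋1 : ∀ {b n} x → b ≋ 1ℤ [mod n ] → b ^ x ≋ 1ℤ [mod n ]
  1^≋1 x b≋1 = ≋-respʳ (^-cong-≋ x b≋1) (ℤ.^-zeroˡ x)

  4∣2^[2+k] : ∀ k → 4 ℕ.∣ 2 ℕ.^ (2 ℕ.+ k)
  4∣2^[2+k] k = ℕ.divides (2 ℕ.^ k) (eq (2 ℕ.^ k))
    where
    eq : ∀ t → 2 ℕ.* (2 ℕ.* t) ≡ t ℕ.* 4
    eq = ℕ-Ring.solve-∀

  -- Modulo 7 the equation reads 4 ≡ 5^z. Cubing gives 1 ≡ (-1)^z, as 4³ ≡ 1 and 5³ ≡ -1, and z is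
  -- odd.
  7^x+4≢5^z : ∀ x z → 0 ℕ.< x → Odd z → ¬ 7 ℕ.^ x ℕ.+ 2 ℕ.^ 2 ≡ 5 ℕ.^ z
  7^x+4≢5^z x z 0<x odd-z eq = from-no (7 ℕ.∣? 2) (≋⇒∣ {1ℤ} { - 1ℤ} {+ 7} (≋-trans (modulo (- (+ 9)) refl)
      (≋-trans (^-cong-≋ 3 4≋) (≋-respˡ (trans (ℤ.^-*-assoc (+ 5) z 3) (trans (cong ((+ 5) ^_) (ℕ.*-comm z 3)) (sym (ℤ.^-*-assoc (+ 5) 3 z))))
        (≋-respʳ (^-cong-≋ z (modulo (+ 18) refl)) (-1^odd odd-z))))))
    where
    4≋ : + 4 ≋ (+ 5) ^ z [mod + 7 ]
    4≋ = ≋-respʳ (+-cong-≋ (≋-sym (0^≋0 {+ 7} x 0<x (modulo 1ℤ refl))) (≋-refl {x = + 4})) (pos-equation 7 x 2 2 5 z eq)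

  -- The case z odd with m = 1, a = 2g + 1 and exponent 2 + y of M

  module OddZUnitM (g x y z : ℕ) (0<x : 0 ℕ.< x) (odd-z : Odd z)
    (eq : (3 ℕ.+ 4 ℕ.* g) ℕ.^ x ℕ.+ 2 ℕ.^ (2 ℕ.+ y) ≡ (1 ℕ.+ 4 ℕ.* g) ℕ.^ z) where

    B C : ℕ
    B = 3 ℕ.+ 4 ℕ.* g
    C = 1 ℕ.+ 4 ℕ.* g
    eqℤ : (+ B) ^ x + (+ 2) ^ (2 ℕ.+ y) ≡ (+ C) ^ z
    eqℤ = pos-equation B x 2 (2 ℕ.+ y) C z eq

    x-even : Even x
    x-even with parity x
    ... | inj₁ e = e
    ... | inj₂ o = contradiction (≋⇒∣ { - 1ℤ} {1ℤ} {+ 4} (≋-trans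
        (+-cong-≋ (≋-sym (≋-respʳ (^-cong-≋ x B≋-1) (-1^odd o))) (≋-sym 2^≋0))
        (≋-respˡ eqℤ (1^≋1 z C≋1)))) (from-no (4 ℕ.∣? 2))
      where
      B≋-1 : + B ≋ - 1ℤ [mod + 4 ]
      B≋-1 = +-cong-≋ {x = - 1ℤ} (modulo 1ℤ refl) (∣⇒≋0 (ℕ.m∣m*n g))
      C≋1 : + C ≋ 1ℤ [mod + 4 ]
      C≋1 = +-cong-≋ (≋-refl {x = 1ℤ}) (∣⇒≋0 (ℕ.m∣m*n g))
      2^≋0 : (+ 2) ^ (2 ℕ.+ y) ≋ 0ℤ [mod + 4 ]
      2^≋0 = ≋-respˡ (sym (pos-^ 2 (2 ℕ.+ y))) (∣⇒≋0 (4∣2^[2+k] y))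

    -- Modulo B the base C is -2. If both exponents 2 + y and z were odd, the equation would become
    -- 2E² ≡ -2W² with powers of two E and W, so B would divide E² + W² and -1 would be a square
    -- modulo B ≡ 3 (mod 4).
    y-even : Even (2 ℕ.+ y)
    y-even with parity (2 ℕ.+ y)
    ... | inj₁ e = e
    ... | inj₂ (j , 2+y≡) = ⊥-elim (3+4g∤ρ²+1 g (2 ℕ.^ w ℕ.* suc (1 ℕ.+ 2 ℕ.* g) ℕ.^ j)
        (≋0⇒∣ (proj₁ (sqrt-mod-norm 1 (2 ℕ.^ w) j B (1 ℕ.+ 2 ℕ.* g) (B≡ g)
          (subst (B ℕ.∣_) (cong (2 ℕ.^ w ℕ.* 2 ℕ.^ w ℕ.+_) (sym (ℕ.*-identityˡ _))) B∣)))))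
      where
      B≡ : ∀ g → 3 ℕ.+ 4 ℕ.* g ≡ suc (2 ℕ.* (1 ℕ.+ 2 ℕ.* g))
      B≡ = ℕ-Ring.solve-∀
      w = proj₁ odd-z
      z≡ = proj₂ odd-z
      E W : ℤ
      E = (+ 2) ^ j
      W = (+ 2) ^ w
      2^≡ : (+ 2) ^ (2 ℕ.+ y) ≡ + 2 * (E * E)
      2^≡ = trans (cong ((+ 2) ^_) 2+y≡) (cong (+ 2 *_) (^-double (+ 2) j))
      -2^≡ : (- (+ 2)) ^ z ≡ - (+ 2) * (W * W)
      -2^≡ = trans (cong ((- (+ 2)) ^_) z≡) (cong (- (+ 2) *_)
        (trans (sym (ℤ.^-*-assoc (- (+ 2)) 2 w)) (trans (ℤ.^-*-assoc (+ 2) 2 w) (^-double (+ 2) w))))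
      2E²≋ : + 2 * (E * E) ≋ - (+ 2) * (W * W) [mod + B ]
      2E²≋ = ≋-respˡ (sym 2^≡) (≋-trans (≋-respˡ (sym (ℤ.+-identityˡ ((+ 2) ^ (2 ℕ.+ y))))
        (+-cong-≋ (≋-sym (0^≋0 x 0<x (+modulus (sym (ℤ.+-identityˡ (+ B)))))) (≋-refl {x = (+ 2) ^ (2 ℕ.+ y)})))
        (≋-respˡ eqℤ (≋-respʳ (^-cong-≋ z (+modulus refl)) -2^≡)))
      sum≡ : + (2 ℕ.^ 1 ℕ.* (2 ℕ.^ w ℕ.* 2 ℕ.^ w ℕ.+ 2 ℕ.^ j ℕ.* 2 ℕ.^ j)) ≡ + 2 * (E * E) + + 2 * (W * W)
      sum≡ = trans (ℤ.pos-* 2 (2 ℕ.^ w ℕ.* 2 ℕ.^ w ℕ.+ 2 ℕ.^ j ℕ.* 2 ℕ.^ j)) (trans (cong (+ 2 *_) (cong₂ (λ s t → s + t)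
        (trans (ℤ.pos-* (2 ℕ.^ w) (2 ℕ.^ w)) (cong (λ t → t * t) (pos-^ 2 w)))
        (trans (ℤ.pos-* (2 ℕ.^ j) (2 ℕ.^ j)) (cong (λ t → t * t) (pos-^ 2 j))))) (ring E W))
        where
        ring : ∀ E W → + 2 * (W * W + E * E) ≡ + 2 * (E * E) + + 2 * (W * W)
        ring = solve-∀
      cancel : ∀ W → - (+ 2) * (W * W) + + 2 * (W * W) ≡ 0ℤ
      cancel = solve-∀
      B∣ : B ℕ.∣ 2 ℕ.^ w ℕ.* 2 ℕ.^ w ℕ.+ 2 ℕ.^ j ℕ.* 2 ℕ.^ j
      B∣ = odd∣2^*⇒∣ 1 (1 ℕ.+ 2 ℕ.* g , B≡ g)
        (≋0⇒∣ (≋-respˡ sum≡ (≋-respʳ (+-cong-≋ 2E²≋ (≋-refl {x = + 2 * (W * W)})) (cancel W))))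

    z≢1 : ¬ z ≡ 1
    z≢1 refl = ℕ.<-irrefl (sym eq) (begin-strict
      C ℕ.* 1                           ≡⟨ ℕ.*-identityʳ C ⟩
      C                                 <⟨ s≤s (ℕ.n≤1+n _) ⟩
      B                                 ≡⟨ ℕ.^-identityʳ B ⟨
      B ℕ.^ 1                           ≤⟨ ℕ.^-monoʳ-≤ B 0<x ⟩
      B ℕ.^ x                           ≤⟨ ℕ.m≤m+n _ _ ⟩
      B ℕ.^ x ℕ.+ 2 ℕ.^ (2 ℕ.+ y)       ∎)
      where open ℕ.≤-Reasoning

    impossible : suc (2 ℕ.* g) ℕ.∣ 2 ℕ.^ (1 ℕ.+ y) ℕ.+ 1 → ⊥
    impossible a∣ = from-root (odd-power-norm 1 (inj₁ refl) C (B ℕ.^ h) k z odd-C odd-z (λ _ → 0<k k 2+y≡) norm)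
      where
      h = proj₁ x-even
      k = proj₁ y-even
      2+y≡ = proj₂ y-even
      E = 2 ℕ.^ k
      2^≡E² : 2 ℕ.^ (2 ℕ.+ y) ≡ E ℕ.* E
      2^≡E² = trans (cong (2 ℕ.^_) 2+y≡) (^-double-ℕ 2 k)
      0<k : ∀ k → 2 ℕ.+ y ≡ 2 ℕ.* k → 0 ℕ.< k
      0<k (suc k) _ = s≤s z≤n
      odd-C : Odd C
      odd-C = 2 ℕ.* g , cong suc (ℕ.*-assoc 2 2 g)
      norm : B ℕ.^ h ℕ.* B ℕ.^ h ℕ.+ 1 ℕ.* (E ℕ.* E) ≡ C ℕ.^ z
      norm = trans (cong₂ ℕ._+_ (sym (trans (cong (B ℕ.^_) (proj₂ x-even)) (^-double-ℕ B h)))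
        (trans (ℕ.*-identityˡ _) (sym 2^≡E²))) eq
      -- The divisibility by a = 2g + 1 enters as a bound: it leaves u² = 1 + 4g - E² ≤ 1, and u = 0
      -- would make the odd C equal to the even E².
      4g≤ : 4 ℕ.* g ℕ.≤ E ℕ.* E
      4g≤ = begin
        4 ℕ.* g                ≡⟨ ℕ.*-assoc 2 2 g ⟩
        2 ℕ.* (2 ℕ.* g)        ≤⟨ ℕ.*-monoʳ-≤ 2 (ℕ.≤-pred (subst (suc (2 ℕ.* g) ℕ.≤_) (ℕ.+-comm _ 1)
                                    (ℕ.∣⇒≤ {{subst NonZero (ℕ.+-comm 1 _) _}} a∣))) ⟩
        2 ℕ.^ (2 ℕ.+ y)        ≡⟨ 2^≡E² ⟩
        E ℕ.* E                ∎
        where open ℕ.≤-Reasoning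
      from-root : (∃ λ u → u ℕ.* u ℕ.+ 1 ℕ.* (E ℕ.* E) ≡ C × ∣ im (+ u) (+ (1 ℕ.* (E ℕ.* E))) z ∣ ≡ 1) → ⊥
      from-root (zero , E²≡C , _) = contradiction (ℕ.∣1⇒≡1 (ℕ.∣m+n∣m⇒∣n {m = 4 ℕ.* g} (subst (4 ℕ.∣_)
          (trans (sym (trans (ℕ.*-identityˡ _) (sym 2^≡E²))) (trans E²≡C (ℕ.+-comm 1 (4 ℕ.* g)))) (4∣2^[2+k] y)) (ℕ.m∣m*n g))) λ ()
      from-root (suc (suc u) , N , _) = ℕ.<-irrefl (sym N) (begin-strict
        1 ℕ.+ 4 ℕ.* g                                           ≤⟨ s≤s (ℕ.≤-trans 4g≤ (ℕ.≤-reflexive (sym (ℕ.*-identityˡ _)))) ⟩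
        1 ℕ.+ 1 ℕ.* (E ℕ.* E)                                   <⟨ ℕ.+-monoˡ-< (1 ℕ.* (E ℕ.* E)) {1} {suc (suc u) ℕ.* suc (suc u)} (s≤s (s≤s z≤n)) ⟩
        suc (suc u) ℕ.* suc (suc u) ℕ.+ 1 ℕ.* (E ℕ.* E)         ∎)
        where open ℕ.≤-Reasoning
      from-root (suc zero , N , ∣I∣≡1) = [ im≢1-z , im≢-1-z k refl ]′
          (∣∣≡1 _ (trans (cong (λ D → ∣ im 1ℤ D z ∣) (sym D≡)) ∣I∣≡1))
        where
        4g≡E² : 4 ℕ.* g ≡ E ℕ.* E
        4g≡E² = ℕ.suc-injective (sym (trans (cong suc (sym (ℕ.*-identityˡ (E ℕ.* E)))) N))
        D≡ : + (1 ℕ.* (E ℕ.* E)) ≡ + 4 * + g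
        D≡ = trans (cong +_ (trans (ℕ.*-identityˡ _) (sym 4g≡E²))) (ℤ.pos-* 4 g)
        im≢1-z : ¬ im 1ℤ (+ 4 * + g) z ≡ 1ℤ
        im≢1-z = exclude (proj₁ odd-z) (proj₂ odd-z)
          where
          exclude : ∀ w → z ≡ suc (2 ℕ.* w) → ¬ im 1ℤ (+ 4 * + g) z ≡ 1ℤ
          exclude zero    z≡ = contradiction z≡ z≢1
          exclude (suc w) z≡ = im≢1 (+ g) (w ℕ.+ suc (w ℕ.+ 0)) ∘ subst (λ z → im 1ℤ (+ 4 * + g) z ≡ 1ℤ) z≡
        -- Here D = E² = 4^k. The argument modulo 8 behind `im≢-1` needs k ≥ 2; k = 1 means g = 1
        -- and the single equation 7^x + 4 = 5^z.
        im≢-1-z : ∀ k → k ≡ proj₁ y-even → ¬ im 1ℤ (+ 4 * + g) z ≡ - 1ℤ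
        im≢-1-z zero          k≡ = contradiction (0<k _ 2+y≡) (subst (λ k → ¬ 0 ℕ.< k) k≡ λ ())
        im≢-1-z (suc zero)    k≡ = λ _ → 7^x+4≢5^z x z 0<x odd-z (subst₂ (λ g y → (3 ℕ.+ 4 ℕ.* g) ℕ.^ x ℕ.+ 2 ℕ.^ y ≡ (1 ℕ.+ 4 ℕ.* g) ℕ.^ z) g≡1 2+y≡2 eq)
          where
          2+y≡2 : 2 ℕ.+ y ≡ 2
          2+y≡2 = trans 2+y≡ (cong (2 ℕ.*_) (sym k≡))
          g≡1 : g ≡ 1
          g≡1 = ℕ.*-cancelˡ-≡ g 1 4 (trans 4g≡E² (cong (λ k → 2 ℕ.^ k ℕ.* 2 ℕ.^ k) (sym k≡)))
        im≢-1-z (suc (suc j)) k≡ = im≢-1 (+ g) z 4g≋0 4g≋1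
          where
          4g≡ : + 4 * + g ≡ + (2 ℕ.^ (2 ℕ.+ j)) * + (2 ℕ.^ (2 ℕ.+ j))
          4g≡ = trans (sym (ℤ.pos-* 4 g)) (trans (cong +_ (trans 4g≡E² (cong (λ k → 2 ℕ.^ k ℕ.* 2 ℕ.^ k) (sym k≡)))) (ℤ.pos-* (2 ℕ.^ (2 ℕ.+ j)) (2 ℕ.^ (2 ℕ.+ j))))
          4g≋0 : + 4 * + g ≋ 0ℤ [mod + 8 ]
          4g≋0 = ≋-respˡ (trans 4g≡ (trans (cong (λ t → t * t) (pos-^ 2 (2 ℕ.+ j))) (eight ((+ 2) ^ j)))) (modulo (+ 2 * ((+ 2) ^ j * (+ 2) ^ j)) (sym (ℤ.+-identityˡ _)))
            where
            eight : ∀ t → + 2 * (+ 2 * t) * (+ 2 * (+ 2 * t)) ≡ + 2 * (t * t) * + 8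
            eight = solve-∀
          4g≋1 : + 4 * + g ≋ 1ℤ [mod + 3 ]
          4g≋1 = ≋-respˡ 4g≡ (≋-respˡ (cong (λ t → t * t) (pos-^ 2 (2 ℕ.+ j))) (≋-respˡ (sym (^-double (+ 2) (2 ℕ.+ j)))
            (≋-respʳ (^-cong-≋ {x = + 2} { - 1ℤ} (2 ℕ.* (2 ℕ.+ j)) (modulo 1ℤ refl)) (-1^even (2 ℕ.+ j , refl)))))

  -- Coprime factors of a perfect power

  coprime-^ʳ : ∀ {m n} k → Coprime m n → Coprime m (n ℕ.^ k)
  coprime-^ʳ zero    _ = λ (_ , d∣1) → ℕ.∣1⇒≡1 d∣1
  coprime-^ʳ {m} {n} (suc k) c {d} (d∣m , d∣) =
    coprime-^ʳ k c (d∣m , coprime-divisor (λ (e∣d , e∣n) → c (ℕ.∣-trans e∣d d∣m , e∣n)) d∣)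

  odd-divisor : ∀ {d o} → Odd o → d ℕ.∣ o → Odd d
  odd-divisor {d} odd-o d∣o with parity d
  ... | inj₂ odd-d = odd-d
  ... | inj₁ (h , refl) = contradiction
    (odd⇒coprime-2 odd-o (ℕ.∣-trans (ℕ.m∣m*n h) d∣o , ℕ.∣-refl)) λ ()

  coprime-2^-odd : ∀ {o} k → Odd o → Coprime (2 ℕ.^ k) o
  coprime-2^-odd k odd-o = Coprime.sym (coprime-^ʳ k (odd⇒coprime-2 odd-o))

  -- If f divides b N, then it divides both f N and b N, hence `gcd f b` times N. So the factors b
  -- can be traded for the gcd one at a time.
  ∣gcd^* : ∀ f b k n → f ℕ.∣ b ℕ.^ k ℕ.* n → f ℕ.∣ gcd f b ℕ.^ k ℕ.* n
  ∣gcd^* f b zero    n f∣ = f∣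
  ∣gcd^* f b (suc k) n f∣ = subst (f ℕ.∣_) (rotate (gcd f b ℕ.^ k) (gcd f b) n)
    (∣gcd^* f b k (gcd f b ℕ.* n) (subst (f ℕ.∣_) (swap (gcd f b) (b ℕ.^ k) n)
      (subst (f ℕ.∣_) (trans (sym (c*gcd[m,n]≡gcd[cm,cn] (b ℕ.^ k ℕ.* n) f b)) (ℕ.*-comm (b ℕ.^ k ℕ.* n) (gcd f b)))
        (gcd-greatest (ℕ.n∣m*n (b ℕ.^ k ℕ.* n)) (subst (f ℕ.∣_) (trans (ℕ.*-assoc b (b ℕ.^ k) n) (ℕ.*-comm b (b ℕ.^ k ℕ.* n))) f∣)))))
    where
    swap : ∀ g c n → g ℕ.* (c ℕ.* n) ≡ c ℕ.* (g ℕ.* n)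
    swap = ℕ-Ring.solve-∀
    rotate : ∀ c g n → c ℕ.* (g ℕ.* n) ≡ g ℕ.* c ℕ.* n
    rotate = ℕ-Ring.solve-∀

  ^-distribʳ-*ℕ : ∀ x y k → (x ℕ.* y) ℕ.^ k ≡ x ℕ.^ k ℕ.* y ℕ.^ k
  ^-distribʳ-*ℕ x y zero    = refl
  ^-distribʳ-*ℕ x y (suc k) = trans (cong (x ℕ.* y ℕ.*_) (^-distribʳ-*ℕ x y k)) (interchange x y (x ℕ.^ k) (y ℕ.^ k))
    where
    interchange : ∀ x y a b → x ℕ.* y ℕ.* (a ℕ.* b) ≡ x ℕ.* a ℕ.* (y ℕ.* b)
    interchange = ℕ-Ring.solve-∀

  coprime-∣-* : ∀ {m n k} → Coprime m n → m ℕ.∣ k → n ℕ.∣ k → m ℕ.* n ℕ.∣ k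
  coprime-∣-* {m} {n} c (ℕ.divides q refl) n∣ =
    subst (m ℕ.* n ℕ.∣_) (ℕ.*-comm m q) (ℕ.*-monoʳ-∣ m (coprime-divisor (Coprime.sym c) (subst (n ℕ.∣_) (ℕ.*-comm q m) n∣)))

  -- The roots are p = gcd f b and q = gcd g b. Then f ≤ p^x and g ≤ q^x by `∣gcd^*`, while p q ≤ b
  -- because p and q are coprime divisors of b. As f g = b^x, all these inequalities are equalities,
  -- and no prime is ever mentioned.
  coprime-factors-of-power : ∀ f g b k → 0 ℕ.< b → Coprime f g → f ℕ.* g ≡ b ℕ.^ suc k →
    ∃₂ λ p q → f ≡ p ℕ.^ suc k × g ≡ q ℕ.^ suc k × p ℕ.* q ≡ b
  coprime-factors-of-power f g b k 0<b c fg≡ = p , q , f≡ , g≡ , pq≡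
    where
    x = suc k
    p = gcd f b
    q = gcd g b
    instance
      b≢0 : NonZero b
      b≢0 = ℕ.>-nonZero 0<b
      fg≢0 : NonZero (f ℕ.* g)
      fg≢0 = subst NonZero (sym fg≡) (ℕ.m^n≢0 b x)
      f≢0 : NonZero f
      f≢0 = ℕ.m*n≢0⇒m≢0 f
      g≢0 : NonZero g
      g≢0 = ℕ.m*n≢0⇒n≢0 f
      p≢0 : NonZero p
      p≢0 = ℕ.≢-nonZero λ p≡0 → ℕ.≢-nonZero⁻¹ b (gcd[m,n]≡0⇒n≡0 f p≡0)
      q≢0 : NonZero q
      q≢0 = ℕ.≢-nonZero λ q≡0 → ℕ.≢-nonZero⁻¹ b (gcd[m,n]≡0⇒n≡0 g q≡0)
      pˣ≢0 : NonZero (p ℕ.^ x)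
      pˣ≢0 = ℕ.m^n≢0 p x
      qˣ≢0 : NonZero (q ℕ.^ x)
      qˣ≢0 = ℕ.m^n≢0 q x
    ∣p^ : ∀ h → h ℕ.∣ b ℕ.^ x → h ℕ.∣ gcd h b ℕ.^ x
    ∣p^ h h∣ = subst (h ℕ.∣_) (ℕ.*-identityʳ _) (∣gcd^* h b x 1 (subst (h ℕ.∣_) (sym (ℕ.*-identityʳ _)) h∣))
    f≤ : f ℕ.≤ p ℕ.^ x
    f≤ = ℕ.∣⇒≤ (∣p^ f (subst (f ℕ.∣_) fg≡ (ℕ.m∣m*n g)))
    g≤ : g ℕ.≤ q ℕ.^ x
    g≤ = ℕ.∣⇒≤ (∣p^ g (subst (g ℕ.∣_) fg≡ (ℕ.n∣m*n f)))
    pq≤b : p ℕ.* q ℕ.≤ b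
    pq≤b = ℕ.∣⇒≤ (coprime-∣-* (λ (d∣p , d∣q) → c (ℕ.∣-trans d∣p (gcd[m,n]∣m f b) , ℕ.∣-trans d∣q (gcd[m,n]∣m g b)))
      (gcd[m,n]∣n f b) (gcd[m,n]∣n g b))
    pˣqˣ≤fg : p ℕ.^ x ℕ.* q ℕ.^ x ℕ.≤ f ℕ.* g
    pˣqˣ≤fg = begin
      p ℕ.^ x ℕ.* q ℕ.^ x    ≡⟨ ^-distribʳ-*ℕ p q x ⟨
      (p ℕ.* q) ℕ.^ x        ≤⟨ ℕ.^-monoˡ-≤ x pq≤b ⟩
      b ℕ.^ x                ≡⟨ fg≡ ⟨
      f ℕ.* g                ∎
      where open ℕ.≤-Reasoning
    f≡ : f ≡ p ℕ.^ x
    f≡ = ℕ.≤-antisym f≤ (ℕ.*-cancelʳ-≤ (p ℕ.^ x) f (q ℕ.^ x) (ℕ.≤-trans pˣqˣ≤fg (ℕ.*-monoʳ-≤ f g≤)))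
    g≡ : g ≡ q ℕ.^ x
    g≡ = ℕ.≤-antisym g≤ (ℕ.*-cancelˡ-≤ (p ℕ.^ x) (ℕ.≤-trans pˣqˣ≤fg (ℕ.*-monoˡ-≤ g f≤)))
    pq≡ : p ℕ.* q ≡ b
    pq≡ = ℕ.≤-antisym pq≤b (ℕ.≮⇒≥ λ pq<b → ℕ.<-irrefl
      (trans (^-distribʳ-*ℕ p q x) (trans (cong₂ ℕ._*_ (sym f≡) (sym g≡)) fg≡)) (ℕ.^-monoˡ-< x pq<b))

  -- The case z even: common facts, and the equation with y = 2

  module EvenZ (a m C x y z : ℕ) (1<a : 1 ℕ.< a) (0<m : 0 ℕ.< m) (0<y : 0 ℕ.< y) (0<z : 0 ℕ.< z)
    (C+1≡ : suc C ≡ 2 ℕ.* a ℕ.* m) (z-even : Even z)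
    (eq : (2 ℕ.+ C) ℕ.^ x ℕ.+ (2 ℕ.* m) ℕ.^ y ≡ C ℕ.^ z) where

    M : ℕ
    M = 2 ℕ.* m

    instance
      m≢0 : NonZero m
      m≢0 = ℕ.>-nonZero 0<m
      M≢0 : NonZero M
      M≢0 = ℕ.m*n≢0 2 m

    eqℤ : (+ (2 ℕ.+ C)) ^ x + (+ M) ^ y ≡ (+ C) ^ z
    eqℤ = pos-equation (2 ℕ.+ C) x M y C z eq

    C+1≡aM : suc C ≡ a ℕ.* M
    C+1≡aM = trans C+1≡ (assoc a m)
      where
      assoc : ∀ a m → 2 ℕ.* a ℕ.* m ≡ a ℕ.* (2 ℕ.* m)
      assoc = ℕ-Ring.solve-∀

    B≋1 : + (2 ℕ.+ C) ≋ 1ℤ [mod + suc C ]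
    B≋1 = +modulus refl

    C≋-1 : + C ≋ - 1ℤ [mod + suc C ]
    C≋-1 = +modulus refl

    A∣M^y : suc C ℕ.∣ M ℕ.^ y
    A∣M^y = ≋0⇒∣ (≋-respˡ (trans (pos-^ M y) (cancel ((+ M) ^ y))) (+-cong-≋ (≋-refl {x = - 1ℤ})
      (≋-trans (+-cong-≋ (≋-sym (1^≋1 x B≋1)) (≋-refl {x = (+ M) ^ y}))
        (≋-respˡ eqℤ (≋-respʳ (^-cong-≋ z C≋-1) (-1^even z-even))))))
      where
      cancel : ∀ t → t ≡ - 1ℤ + (1ℤ + t)
      cancel = solve-∀

    y≥2 : ∃ λ y′ → y ≡ 2 ℕ.+ y′
    y≥2 = go y 0<y A∣M^y
      where
      go : ∀ y → 0 ℕ.< y → suc C ℕ.∣ M ℕ.^ y → ∃ λ y′ → y ≡ 2 ℕ.+ y′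
      go (suc zero) _ A∣ = contradiction (ℕ.∣⇒≤ (subst₂ ℕ._∣_ C+1≡aM (ℕ.^-identityʳ M) A∣)) (ℕ.<⇒≱ (subst (M ℕ.<_) (ℕ.*-comm M a) (ℕ.m<m*n M a 1<a)))
      go (suc (suc y′)) _ _ = y′ , refl

  -- Size decides: C is at most its power M + f, so f (f + 2M) ≤ 2 + M + f. As f ≥ 1 this gives M ≤
  -- 2, and with M = 2 it gives f = 1, whence C = 3.
  square-case-exponent-1 : ∀ a m f C w → 0 ℕ.< m → 0 ℕ.< f → suc C ≡ a ℕ.* (2 ℕ.* m) →
    f ℕ.* (f ℕ.+ (2 ℕ.* m ℕ.+ 2 ℕ.* m)) ≡ 2 ℕ.+ C → 2 ℕ.* m ℕ.+ f ≡ C ℕ.^ w →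
    a ≡ 2 × m ≡ 1 × w ≡ 1
  square-case-exponent-1 a m f C w 0<m 0<f C+1≡ product P≡ = conclude m≡1 f≡1 C+1≡ product P≡
    where
    C≤ : ∀ w C → 2 ℕ.* m ℕ.+ f ≡ C ℕ.^ w → C ℕ.≤ 2 ℕ.* m ℕ.+ f
    C≤ w       zero    _  = z≤n
    C≤ zero    (suc _) P≡ = contradiction P≡ (ℕ.>⇒≢ (ℕ.≤-trans (s≤s (ℕ.≤-trans 0<f (ℕ.m≤n+m f _))) (ℕ.+-monoˡ-≤ f (ℕ.+-monoˡ-≤ (m ℕ.+ 0) 0<m))))
    C≤ (suc k) c@(suc _) P≡ = subst (c ℕ.≤_) (sym P≡) (ℕ.m≤m*n c (c ℕ.^ k) {{ℕ.m^n≢0 c k}})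
    bound : f ℕ.* (f ℕ.+ (2 ℕ.* m ℕ.+ 2 ℕ.* m)) ℕ.≤ 2 ℕ.+ (2 ℕ.* m ℕ.+ f)
    bound = ℕ.≤-trans (ℕ.≤-reflexive product) (s≤s (s≤s (C≤ w C P≡)))
    m≡1 : m ≡ 1
    m≡1 = ℕ.≤-antisym (ℕ.*-cancelˡ-≤ 2 (ℕ.+-cancelʳ-≤ (2 ℕ.* m ℕ.+ f) (2 ℕ.* m) 2 (begin
        2 ℕ.* m ℕ.+ (2 ℕ.* m ℕ.+ f)                 ≡⟨ rearrange (2 ℕ.* m) f ⟩
        f ℕ.+ (2 ℕ.* m ℕ.+ 2 ℕ.* m)                 ≤⟨ ℕ.m≤n*m _ f {{ℕ.>-nonZero 0<f}} ⟩
        f ℕ.* (f ℕ.+ (2 ℕ.* m ℕ.+ 2 ℕ.* m))         ≤⟨ bound ⟩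
        2 ℕ.+ (2 ℕ.* m ℕ.+ f)                       ∎))) 0<m
      where
      open ℕ.≤-Reasoning
      rearrange : ∀ M f → M ℕ.+ (M ℕ.+ f) ≡ f ℕ.+ (M ℕ.+ M)
      rearrange = ℕ-Ring.solve-∀
    3^≡3 : ∀ w → 3 ≡ 3 ℕ.^ w → w ≡ 1
    3^≡3 (suc zero)    _ = refl
    3^≡3 (suc (suc w)) p = contradiction (ℕ.m*n≡1⇒m≡1 3 (3 ℕ.^ w) (sym (ℕ.*-cancelˡ-≡ 1 (3 ℕ.* 3 ℕ.^ w) 3 p))) λ ()
    f≡1 : f ≡ 1
    f≡1 = ℕ.≤-antisym (ℕ.*-cancelʳ-≤ f 1 (f ℕ.+ 4) {{subst NonZero (ℕ.+-comm 4 f) _}} (begin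
        f ℕ.* (f ℕ.+ 4)                             ≡⟨ cong (λ m → f ℕ.* (f ℕ.+ (2 ℕ.* m ℕ.+ 2 ℕ.* m))) m≡1 ⟨
        f ℕ.* (f ℕ.+ (2 ℕ.* m ℕ.+ 2 ℕ.* m))         ≤⟨ bound ⟩
        2 ℕ.+ (2 ℕ.* m ℕ.+ f)                       ≡⟨ cong (λ m → 2 ℕ.+ (2 ℕ.* m ℕ.+ f)) m≡1 ⟩
        4 ℕ.+ f                                     ≡⟨ ℕ.+-comm 4 f ⟩
        f ℕ.+ 4                                     ≡⟨ ℕ.*-identityˡ _ ⟨
        1 ℕ.* (f ℕ.+ 4)                             ∎)) 0<f
      where open ℕ.≤-Reasoning
    conclude : ∀ {m f C} → m ≡ 1 → f ≡ 1 → suc C ≡ a ℕ.* (2 ℕ.* m) → f ℕ.* (f ℕ.+ (2 ℕ.* m ℕ.+ 2 ℕ.* m)) ≡ 2 ℕ.+ C →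
      2 ℕ.* m ℕ.+ f ≡ C ℕ.^ w → a ≡ 2 × m ≡ 1 × w ≡ 1
    conclude refl refl C+1≡ refl P≡ = sym (ℕ.*-cancelʳ-≡ 2 a 2 C+1≡) , refl , 3^≡3 w P≡

  -- For y = 2, C^w - M and C^w + M are coprime x-th powers p^x and q^x with
  -- p q = B, whereas q^x - p^x = 2 M < B.
  square-case : ∀ a m C x w → 1 ℕ.< a → 0 ℕ.< m → Odd x → suc C ≡ a ℕ.* (2 ℕ.* m) →
    (2 ℕ.+ C) ℕ.^ x ℕ.+ (2 ℕ.* m) ℕ.* (2 ℕ.* m) ≡ C ℕ.^ w ℕ.* C ℕ.^ w →
    a ≡ 2 × m ≡ 1 × x ≡ 1 × w ≡ 1
  square-case a m C x w 1<a 0<m (t , refl) C+1≡ eq = from-difference (ℕ.m≤n⇒∃[o]m+o≡n M≤P)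
    where
    M = 2 ℕ.* m
    B = 2 ℕ.+ C
    P = C ℕ.^ w
    Goal = a ≡ 2 × m ≡ 1 × suc (2 ℕ.* t) ≡ 1 × w ≡ 1
    2M<B : M ℕ.+ M ℕ.< B
    2M<B = s≤s (begin
      M ℕ.+ M            ≡⟨ cong (M ℕ.+_) (ℕ.+-identityʳ M) ⟨
      2 ℕ.* M            ≤⟨ ℕ.*-monoˡ-≤ M 1<a ⟩
      a ℕ.* M            ≡⟨ C+1≡ ⟨
      suc C              ∎)
      where open ℕ.≤-Reasoning
    M≤P : M ℕ.≤ P
    M≤P = ℕ.≮⇒≥ λ P<M → ℕ.<-irrefl (sym eq) (ℕ.<-≤-trans (ℕ.*-mono-< P<M P<M) (ℕ.m≤n+m (M ℕ.* M) _))
    instance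
      Bˣ≢0 : NonZero (B ℕ.^ x)
      Bˣ≢0 = ℕ.m^n≢0 B x
    from-difference : (∃ λ f → M ℕ.+ f ≡ P) → Goal
    from-difference (f , M+f≡P) = from-powers t (coprime-factors-of-power f (f ℕ.+ (M ℕ.+ M)) B (2 ℕ.* t) (s≤s z≤n) coprime product)
      where
      product : f ℕ.* (f ℕ.+ (M ℕ.+ M)) ≡ B ℕ.^ x
      product = ℕ.+-cancelʳ-≡ (M ℕ.* M) _ _ (trans (square f M) (trans (cong (λ p → p ℕ.* p) M+f≡P) (sym eq)))
        where
        square : ∀ f M → f ℕ.* (f ℕ.+ (M ℕ.+ M)) ℕ.+ M ℕ.* M ≡ (M ℕ.+ f) ℕ.* (M ℕ.+ f)
        square = ℕ-Ring.solve-∀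
      -- B = 1 + aM is visibly 1 only modulo M; its square is 1 modulo 2M.
      coprime-B : Coprime (M ℕ.+ M) B
      coprime-B {d} (d∣2M , d∣B) = ℕ.∣1⇒≡1 (ℕ.∣m+n∣m⇒∣n (subst (d ℕ.∣_) B²≡ (ℕ.∣m⇒∣m*n B d∣B))
        (ℕ.∣m⇒∣m*n (a ℕ.+ a ℕ.* a ℕ.* m) d∣2M))
        where
        expand : ∀ a m → (1 ℕ.+ a ℕ.* (2 ℕ.* m)) ℕ.* (1 ℕ.+ a ℕ.* (2 ℕ.* m)) ≡ (2 ℕ.* m ℕ.+ 2 ℕ.* m) ℕ.* (a ℕ.+ a ℕ.* a ℕ.* m) ℕ.+ 1
        expand = ℕ-Ring.solve-∀
        B²≡ : B ℕ.* B ≡ (M ℕ.+ M) ℕ.* (a ℕ.+ a ℕ.* a ℕ.* m) ℕ.+ 1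
        B²≡ = trans (cong (λ c → suc c ℕ.* suc c) C+1≡) (expand a m)
      coprime : Coprime f (f ℕ.+ (M ℕ.+ M))
      coprime {d} (d∣f , d∣g) = coprime-^ʳ x coprime-B
        (ℕ.∣m+n∣m⇒∣n d∣g d∣f , subst (d ℕ.∣_) product (ℕ.∣m⇒∣m*n _ d∣f))
      0<f : 0 ℕ.< f
      0<f = ℕ.n≢0⇒n>0 λ { refl → ℕ.≢-nonZero⁻¹ (B ℕ.^ x) (sym product) }
      from-powers : ∀ t → (∃₂ λ p q → f ≡ p ℕ.^ suc (2 ℕ.* t) × f ℕ.+ (M ℕ.+ M) ≡ q ℕ.^ suc (2 ℕ.* t) × p ℕ.* q ≡ B) →
        a ≡ 2 × m ≡ 1 × suc (2 ℕ.* t) ≡ 1 × w ≡ 1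
      from-powers zero (p , q , f≡ , g≡ , pq≡) =
        let a≡2 , m≡1 , w≡1 = square-case-exponent-1 a m f C w 0<m 0<f C+1≡
              (trans (cong₂ ℕ._*_ (trans f≡ (ℕ.*-identityʳ p)) (trans g≡ (ℕ.*-identityʳ q))) pq≡) M+f≡P
        in a≡2 , m≡1 , refl , w≡1
      from-powers (suc s) (p , q , f≡ , g≡ , pq≡) = contradiction q²≤2M (ℕ.<⇒≱ (begin-strict
          M ℕ.+ M            <⟨ 2M<B ⟩
          B                  ≡⟨ pq≡ ⟨
          p ℕ.* q            ≤⟨ ℕ.*-monoˡ-≤ q (ℕ.<⇒≤ p<q) ⟩
          q ℕ.* q            ∎))
        where
        open ℕ.≤-Reasoning
        X = s ℕ.+ suc (s ℕ.+ 0)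
        p<q : p ℕ.< q
        p<q = ℕ.≰⇒> λ q≤p → ℕ.<⇒≱ (ℕ.m<m+n f (ℕ.<-≤-trans 0<m (ℕ.≤-trans (ℕ.m≤m+n m (m ℕ.+ 0)) (ℕ.m≤m+n M M))))
          (subst₂ ℕ._≤_ (sym g≡) (sym f≡) (ℕ.^-monoˡ-≤ (suc (suc X)) q≤p))
        -- For p < q and x ≥ 3 the gap q^x - p^x is at least q^(x-1) ≥ q². On the other side 2M < p
        -- q ≤ q².
        q²≤2M : q ℕ.* q ℕ.≤ M ℕ.+ M
        q²≤2M = ℕ.+-cancelʳ-≤ f (q ℕ.* q) (M ℕ.+ M) (begin
          q ℕ.* q ℕ.+ f                                      ≡⟨ cong₂ ℕ._+_ (cong (q ℕ.*_) (sym (ℕ.*-identityʳ q))) f≡ ⟩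
          q ℕ.^ 2 ℕ.+ p ℕ.* p ℕ.^ suc X                      ≤⟨ ℕ.+-mono-≤ (ℕ.^-monoʳ-≤ q {{ℕ.>-nonZero (ℕ.≤-<-trans z≤n p<q)}} {2} {suc X} (s≤s 1≤X))
                                                                 (ℕ.*-monoʳ-≤ p (ℕ.^-monoˡ-≤ (suc X) (ℕ.<⇒≤ p<q))) ⟩
          suc p ℕ.* q ℕ.^ suc X                              ≤⟨ ℕ.*-monoˡ-≤ (q ℕ.^ suc X) p<q ⟩
          q ℕ.* q ℕ.^ suc X                                  ≡⟨ g≡ ⟨
          f ℕ.+ (M ℕ.+ M)                                    ≡⟨ ℕ.+-comm f (M ℕ.+ M) ⟩
          M ℕ.+ M ℕ.+ f                                      ∎)
          where
          1≤X : 1 ℕ.≤ X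
          1≤X = ℕ.≤-trans (s≤s z≤n) (ℕ.m≤n+m (suc (s ℕ.+ 0)) s)

  -- The case z even, x odd

  module EvenZOddX (a m C x y z : ℕ) (1<a : 1 ℕ.< a) (0<m : 0 ℕ.< m) (0<y : 0 ℕ.< y) (0<z : 0 ℕ.< z)
    (C+1≡ : suc C ≡ 2 ℕ.* a ℕ.* m) (z-even : Even z)
    (eq : (2 ℕ.+ C) ℕ.^ x ℕ.+ (2 ℕ.* m) ℕ.^ y ≡ C ℕ.^ z) (x-odd : Odd x) where

    open EvenZ a m C x y z 1<a 0<m 0<y 0<z C+1≡ z-even eq

    t w y′ : ℕ
    t = proj₁ x-odd
    w = proj₁ z-even
    y′ = proj₁ y≥2

    h : ℕ
    h = a ℕ.* m

    C+1≡2h : suc C ≡ 2 ℕ.* h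
    C+1≡2h = trans C+1≡ (ℕ.*-assoc 2 a m)

    -- Since A is even, (A ± 1)² ≡ 1 modulo 2A. So the equation becomes (1 + A) + M^y ≡ 1, that is
    -- M^y ≡ -A modulo 2A.
    M^y≡A*odd : ∃ λ T → M ℕ.^ y ≡ suc C ℕ.* suc (2 ℕ.* T)
    M^y≡A*odd = from-∣ (≋0⇒∣ M^y+A≋0)
      where
      H = + h
      N = + (2 ℕ.* suc C)
      A≡ : + suc C ≡ + 2 * H
      A≡ = trans (cong +_ C+1≡2h) (ℤ.pos-* 2 h)
      N≡ : N ≡ + 4 * H
      N≡ = trans (ℤ.pos-* 2 (suc C)) (trans (cong (+ 2 *_) A≡) (four H))
        where
        four : ∀ H → + 2 * (+ 2 * H) ≡ + 4 * H
        four = solve-∀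
      C²≋1 : (+ C) ^ 2 ≋ 1ℤ [mod N ]
      C²≋1 = modulo (H - 1ℤ) (trans (cong₂ (λ c d → c * (d * 1ℤ)) C≡ C≡) (trans (square H) (cong (λ N → 1ℤ + (H - 1ℤ) * N) (sym N≡))))
        where
        C≡ : + C ≡ + 2 * H - 1ℤ
        C≡ = cong (_- 1ℤ) A≡
        square : ∀ H → (+ 2 * H - 1ℤ) * ((+ 2 * H - 1ℤ) * 1ℤ) ≡ 1ℤ + (H - 1ℤ) * (+ 4 * H)
        square = solve-∀
      B²≋1 : (+ (2 ℕ.+ C)) ^ 2 ≋ 1ℤ [mod N ]
      B²≋1 = modulo (H + 1ℤ) (trans (cong₂ (λ c d → c * (d * 1ℤ)) B≡ B≡) (trans (square H) (cong (λ N → 1ℤ + (H + 1ℤ) * N) (sym N≡))))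
        where
        B≡ : + (2 ℕ.+ C) ≡ 1ℤ + + 2 * H
        B≡ = cong (λ x → 1ℤ + x) A≡
        square : ∀ H → (1ℤ + + 2 * H) * ((1ℤ + + 2 * H) * 1ℤ) ≡ 1ℤ + (H + 1ℤ) * (+ 4 * H)
        square = solve-∀
      B^x≋B : (+ (2 ℕ.+ C)) ^ x ≋ + (2 ℕ.+ C) [mod N ]
      B^x≋B = ≋-respˡ (trans (cong ((+ (2 ℕ.+ C)) ^_) (proj₂ x-odd)) (cong (+ (2 ℕ.+ C) *_) (sym (ℤ.^-*-assoc (+ (2 ℕ.+ C)) 2 t))))
        (≋-respʳ (*-cong-≋ (≋-refl {x = + (2 ℕ.+ C)}) (1^≋1 t B²≋1)) (ℤ.*-identityʳ (+ (2 ℕ.+ C))))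
      C^z≋1 : (+ C) ^ z ≋ 1ℤ [mod N ]
      C^z≋1 = ≋-respˡ (trans (cong ((+ C) ^_) (proj₂ z-even)) (sym (ℤ.^-*-assoc (+ C) 2 w))) (1^≋1 w C²≋1)
      M^y+A≋0 : + (M ℕ.^ y ℕ.+ suc C) ≋ 0ℤ [mod N ]
      M^y+A≋0 = ≋-respˡ (trans (cong (_+ + suc C) (pos-^ M y)) (split ((+ M) ^ y) (+ suc C)))
        (+-cong-≋ (≋-refl {x = - 1ℤ}) (≋-trans (+-cong-≋ (≋-sym B^x≋B) (≋-refl {x = (+ M) ^ y})) (≋-respˡ eqℤ C^z≋1)))
        where
        split : ∀ s A → s + A ≡ - 1ℤ + ((1ℤ + A) + s)
        split = solve-∀
      from-∣ : 2 ℕ.* suc C ℕ.∣ M ℕ.^ y ℕ.+ suc C → ∃ λ T → M ℕ.^ y ≡ suc C ℕ.* suc (2 ℕ.* T)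
      from-∣ (ℕ.divides zero    p) = contradiction (ℕ.m+n≡0⇒n≡0 (M ℕ.^ y) p) λ ()
      from-∣ (ℕ.divides (suc T) p) = T , ℕ.+-cancelʳ-≡ (suc C) _ _ (trans p (odd T (suc C)))
        where
        odd : ∀ T A → suc T ℕ.* (2 ℕ.* A) ≡ A ℕ.* suc (2 ℕ.* T) ℕ.+ A
        odd = ℕ-Ring.solve-∀

    -- Cancelling M from M^y = a M o, with o odd, leaves M^(y-1) = a o, so every power of two in
    -- M^(y-1) already divides a.
    a∣-from : ∀ k → 2 ℕ.^ k ℕ.∣ M ℕ.^ suc y′ → 2 ℕ.^ k ℕ.∣ a
    a∣-from k 2^k∣ = coprime-divisor (coprime-2^-odd k (proj₁ M^y≡A*odd , refl))
      (subst (2 ℕ.^ k ℕ.∣_) (trans M^y′≡ (ℕ.*-comm a _)) 2^k∣)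
      where
      o = suc (2 ℕ.* proj₁ M^y≡A*odd)
      M^y′≡ : M ℕ.^ suc y′ ≡ a ℕ.* o
      M^y′≡ = ℕ.*-cancelˡ-≡ _ _ M (trans (cong (M ℕ.^_) (sym (proj₂ y≥2))) (trans (proj₂ M^y≡A*odd)
        (trans (cong (ℕ._* o) (trans C+1≡aM (ℕ.*-comm a M))) (ℕ.*-assoc M a o))))

    C∣2^x+M^y : C ℕ.∣ M ℕ.^ y ℕ.+ 2 ℕ.^ x
    C∣2^x+M^y = ≋0⇒∣ (≋-respˡ (trans (cong₂ (λ s t → s + t) (pos-^ M y) (pos-^ 2 x)) (ℤ.+-comm ((+ M) ^ y) ((+ 2) ^ x)))
      (≋-trans (+-cong-≋ (≋-sym (^-cong-≋ x (+modulus refl))) (≋-refl {x = (+ M) ^ y}))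
        (≋-respˡ eqℤ (0^≋0 z 0<z (+modulus (sym (ℤ.+-identityˡ (+ C))))))))

    2^x≡ : 2 ℕ.^ x ≡ 2 ℕ.* (2 ℕ.^ t ℕ.* 2 ℕ.^ t)
    2^x≡ = trans (cong (2 ℕ.^_) (proj₂ x-odd)) (cong (2 ℕ.*_) (^-double-ℕ 2 t))

    2^∣M^ : ∀ {k n} → k ℕ.≤ n → 2 ℕ.^ k ℕ.∣ M ℕ.^ n
    2^∣M^ {k} {n} k≤n = ℕ.∣-trans (subst (2 ℕ.^ k ℕ.∣_) (sym (^-distribʳ-*ℕ 2 m k)) (ℕ.m∣m*n (m ℕ.^ k))) (M^∣ (ℕ.m≤n⇒∃[o]m+o≡n k≤n))
      where
      M^∣ : (∃ λ o → k ℕ.+ o ≡ n) → M ℕ.^ k ℕ.∣ M ℕ.^ n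
      M^∣ (o , refl) = subst (M ℕ.^ k ℕ.∣_) (sym (ℕ.^-distribˡ-+-* M k o)) (ℕ.m∣m*n (M ℕ.^ o))

    -- Now y ≥ 3, so a = 4c and C = 8cm - 1, the modulus of `GaussSigns` with e = m.
    y-odd-impossible : ¬ Odd y
    y-odd-impossible (zero , y≡1) = contradiction (trans (sym y≡1) (proj₂ y≥2)) λ ()
    y-odd-impossible (j@(suc i) , y≡) = from-∣a (a∣-from 2 (2^∣M^ (subst (2 ℕ.≤_) (sym 1+y′≡) (ℕ.m≤m*n 2 j))))
      where
      1+y′≡ : suc y′ ≡ 2 ℕ.* j
      1+y′≡ = ℕ.suc-injective (trans (sym (proj₂ y≥2)) y≡)
      from-∣a : 4 ℕ.∣ a → ⊥
      from-∣a (ℕ.divides c a≡) = GaussSigns.-4e-nonresidue c m h′ (ℕ.suc-pred (4 ℕ.* (c ℕ.* m))) (+ ρ)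
          (subst (λ C → + ρ * + ρ ≋ - (+ 4 * + m) [mod + C ]) C≡ ρ²≋)
        where
        E = 2 ℕ.^ t
        instance
          c≢0 : NonZero c
          c≢0 = ℕ.≢-nonZero λ c≡0 → ℕ.<⇒≱ 1<a (subst (ℕ._≤ 1) (sym (trans a≡ (cong (ℕ._* 4) c≡0))) z≤n)
          cm≢0 : NonZero (c ℕ.* m)
          cm≢0 = ℕ.m*n≢0 c m
          4cm≢0 : NonZero (4 ℕ.* (c ℕ.* m))
          4cm≢0 = ℕ.m*n≢0 4 (c ℕ.* m)
        h′ = ℕ.pred (4 ℕ.* (c ℕ.* m))
        C≡ : C ≡ suc (2 ℕ.* h′)
        C≡ = ℕ.suc-injective (trans C+1≡ (trans (cong (λ a → 2 ℕ.* a ℕ.* m) a≡) (trans (assoc c m)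
          (trans (cong (2 ℕ.*_) (sym (ℕ.suc-pred (4 ℕ.* (c ℕ.* m))))) (2*suc h′)))))
          where
          assoc : ∀ c m → 2 ℕ.* (c ℕ.* 4) ℕ.* m ≡ 2 ℕ.* (4 ℕ.* (c ℕ.* m))
          assoc = ℕ-Ring.solve-∀
        -- Multiplying M^y + 2^x by M makes the first term a square and turns the second into 4m E²
        -- with E = 2^t. Dividing by E² then exhibits -4m = -2M as a square modulo C.
        C∣ : C ℕ.∣ M ℕ.^ suc j ℕ.* M ℕ.^ suc j ℕ.+ 4 ℕ.* m ℕ.* (E ℕ.* E)
        C∣ = subst (C ℕ.∣_) (trans (cong (M ℕ.*_) (cong₂ ℕ._+_ (trans (cong (M ℕ.^_) y≡) (cong (M ℕ.*_) (^-double-ℕ M j))) 2^x≡))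
          (collect m (M ℕ.^ j) E)) (ℕ.∣n⇒∣m*n M C∣2^x+M^y)
          where
          collect : ∀ m J E → 2 ℕ.* m ℕ.* (2 ℕ.* m ℕ.* (J ℕ.* J) ℕ.+ 2 ℕ.* (E ℕ.* E)) ≡
            2 ℕ.* m ℕ.* J ℕ.* (2 ℕ.* m ℕ.* J) ℕ.+ 4 ℕ.* m ℕ.* (E ℕ.* E)
          collect = ℕ-Ring.solve-∀
        ρ = M ℕ.^ suc j ℕ.* suc h′ ℕ.^ t
        ρ²≋ : + ρ * + ρ ≋ - (+ 4 * + m) [mod + C ]
        ρ²≋ = ≋-respˡ (split (+ ρ) (+ 4 * + m)) (≋-respʳ (+-cong-≋ (≋-respˡ (sym (trans (ℤ.pos-+ (ρ ℕ.* ρ) (4 ℕ.* m))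
          (cong₂ (λ s t → s + t) (ℤ.pos-* ρ ρ) (ℤ.pos-* 4 m)))) (proj₁ (sqrt-mod-norm (4 ℕ.* m) (M ℕ.^ suc j) t C h′ C≡ C∣)))
          (≋-refl {x = - (+ 4 * + m)})) (ℤ.+-identityˡ _))
          where
          split : ∀ r k → r * r ≡ r * r + k + - k
          split = solve-∀

    -- From y ≥ 4 follows 8 ∣ a, hence C ≡ 7 (mod 8). Modulo C the sum M^y + 2^x is a square plus 2
    -- · 4^t, so dividing by 4^t makes -2 a square.
    y-even-large-impossible : ∀ i → ¬ y ≡ 2 ℕ.* (2 ℕ.+ i)
    y-even-large-impossible i y≡ = from-∣a (a∣-from 3 (2^∣M^ (s≤s (subst (2 ℕ.≤_) (sym y′≡) (ℕ.≤-trans (s≤s (s≤s z≤n)) (ℕ.m≤n+m (2 ℕ.+ i ℕ.+ 0) i))))))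
      where
      j = 2 ℕ.+ i
      y′≡ : y′ ≡ i ℕ.+ (2 ℕ.+ i ℕ.+ 0)
      y′≡ = ℕ.suc-injective (ℕ.suc-injective (trans (sym (proj₂ y≥2)) y≡))
      from-∣a : 8 ℕ.∣ a → ⊥
      from-∣a (ℕ.divides b a≡) = 7+8g∤ρ²+2 g ρ (subst (ℕ._∣ ρ ℕ.* ρ ℕ.+ 2) C≡
          (≋0⇒∣ (proj₁ (sqrt-mod-norm 2 (M ℕ.^ j) t C (3 ℕ.+ 4 ℕ.* g) (trans C≡ (halve g)) C∣))))
        where
        instance
          b≢0 : NonZero b
          b≢0 = ℕ.≢-nonZero λ b≡0 → ℕ.<⇒≱ 1<a (subst (ℕ._≤ 1) (sym (trans a≡ (cong (ℕ._* 8) b≡0))) z≤n)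
          bm≢0 : NonZero (b ℕ.* m)
          bm≢0 = ℕ.m*n≢0 b m
          2bm≢0 : NonZero (2 ℕ.* (b ℕ.* m))
          2bm≢0 = ℕ.m*n≢0 2 (b ℕ.* m)
        g = ℕ.pred (2 ℕ.* (b ℕ.* m))
        ρ = M ℕ.^ j ℕ.* suc (3 ℕ.+ 4 ℕ.* g) ℕ.^ t
        C≡ : C ≡ 7 ℕ.+ 8 ℕ.* g
        C≡ = ℕ.suc-injective (trans C+1≡ (trans (cong (λ a → 2 ℕ.* a ℕ.* m) a≡) (trans (assoc b m)
          (trans (cong (8 ℕ.*_) (sym (ℕ.suc-pred (2 ℕ.* (b ℕ.* m))))) (ℕ.*-suc 8 g)))))
          where
          assoc : ∀ b m → 2 ℕ.* (b ℕ.* 8) ℕ.* m ≡ 8 ℕ.* (2 ℕ.* (b ℕ.* m))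
          assoc = ℕ-Ring.solve-∀
        halve : ∀ g → 7 ℕ.+ 8 ℕ.* g ≡ suc (2 ℕ.* (3 ℕ.+ 4 ℕ.* g))
        halve = ℕ-Ring.solve-∀
        C∣ : C ℕ.∣ M ℕ.^ j ℕ.* M ℕ.^ j ℕ.+ 2 ℕ.* (2 ℕ.^ t ℕ.* 2 ℕ.^ t)
        C∣ = subst (C ℕ.∣_) (cong₂ ℕ._+_ (trans (cong (M ℕ.^_) y≡) (^-double-ℕ M j)) 2^x≡) C∣2^x+M^y

    solution : a ≡ 2 × m ≡ 1 × x ≡ 1 × y ≡ 2 × z ≡ 2
    solution = by-parity (parity y)
      where
      by-parity : Even y ⊎ Odd y → a ≡ 2 × m ≡ 1 × x ≡ 1 × y ≡ 2 × z ≡ 2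
      by-parity (inj₂ odd-y) = contradiction odd-y y-odd-impossible
      by-parity (inj₁ (zero , y≡0)) = contradiction 0<y (subst (λ y → ¬ 0 ℕ.< y) (sym y≡0) λ ())
      by-parity (inj₁ (suc (suc i) , y≡)) = contradiction y≡ (y-even-large-impossible i)
      by-parity (inj₁ (suc zero , y≡2)) =
        let a≡2 , m≡1 , x≡1 , w≡1 = square-case a m C x w 1<a 0<m x-odd C+1≡aM
              (trans (cong ((2 ℕ.+ C) ℕ.^ x ℕ.+_) (trans (cong (M ℕ.*_) (sym (ℕ.*-identityʳ M))) (cong (M ℕ.^_) (sym y≡2))))
                (trans eq (trans (cong (C ℕ.^_) (proj₂ z-even)) (^-double-ℕ C w))))
        in a≡2 , m≡1 , x≡1 , y≡2 , trans (proj₂ z-even) (cong (2 ℕ.*_) w≡1)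

  -- The case z even, x even

  ∣2^*⇒even : ∀ {s k} → 1 ℕ.< s → s ℕ.∣ 2 ℕ.^ k → Even s
  ∣2^*⇒even {s} {k} 1<s s∣ with parity s
  ... | inj₁ even-s = even-s
  ... | inj₂ odd-s = contradiction (ℕ.∣1⇒≡1 (odd∣2^*⇒∣ k odd-s (subst (s ℕ.∣_) (sym (ℕ.*-identityʳ _)) s∣))) (ℕ.>⇒≢ 1<s)

  coprime-even⇒odd : ∀ {d s} → Coprime d s → Even s → Odd d
  coprime-even⇒odd {d} c (k , s≡) with parity d
  ... | inj₂ odd-d = odd-d
  ... | inj₁ (h , d≡) = contradiction (c (subst (2 ℕ.∣_) (sym d≡) (ℕ.m∣m*n h) , subst (2 ℕ.∣_) (sym s≡) (ℕ.m∣m*n k))) λ ()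

  -- A divisor s > 1 of 2^k is even, so the coprime d is odd and s has to absorb all of 2^k.
  2-part : ∀ k n d s → Coprime d s → d ℕ.* s ≡ 2 ℕ.^ k ℕ.* n → 1 ℕ.< s → s ℕ.∣ 2 ℕ.^ k → s ≡ 2 ℕ.^ k × d ≡ n
  2-part k n d s c ds≡ 1<s s∣2^ = s≡ , d≡
    where
    instance
      s≢0 : NonZero s
      s≢0 = ℕ.>-nonZero (ℕ.<-trans (s≤s z≤n) 1<s)
    2^∣s : 2 ℕ.^ k ℕ.∣ s
    2^∣s = coprime-divisor (coprime-2^-odd k (coprime-even⇒odd c (∣2^*⇒even {k = k} 1<s s∣2^)))
      (subst (2 ℕ.^ k ℕ.∣_) (sym ds≡) (ℕ.m∣m*n n))
    s≡ : s ≡ 2 ℕ.^ k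
    s≡ = ℕ.∣-antisym s∣2^ 2^∣s
    d≡ : d ≡ n
    d≡ = ℕ.*-cancelʳ-≡ d n s (trans ds≡ (trans (cong (ℕ._* n) (sym s≡)) (ℕ.*-comm s n)))

  -- N = (Q - X)(Q + X), where the first factor is at least 1 and the second at least Q.
  difference-of-squares-bound : ∀ Q X N → Q ℕ.* Q ≡ X ℕ.* X ℕ.+ N → 0 ℕ.< N → Q ℕ.≤ N
  difference-of-squares-bound Q X N eq 0<N = go (ℕ.m≤n⇒∃[o]m+o≡n X<Q)
    where
    X<Q : X ℕ.< Q
    X<Q = ℕ.≰⇒> λ Q≤X → ℕ.<⇒≱ (ℕ.m<m+n (X ℕ.* X) 0<N) (subst (ℕ._≤ X ℕ.* X) eq (ℕ.*-mono-≤ Q≤X Q≤X))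
    go : (∃ λ f → suc X ℕ.+ f ≡ Q) → Q ℕ.≤ N
    go (f , Q≡) = subst₂ ℕ._≤_ Q≡ (sym N≡) (ℕ.m≤m+n (suc X ℕ.+ f) _)
      where
      expand : ∀ X f → suc (X ℕ.+ f) ℕ.* suc (X ℕ.+ f) ≡ X ℕ.* X ℕ.+ (suc (X ℕ.+ f) ℕ.+ (X ℕ.+ f ℕ.* suc (X ℕ.+ (X ℕ.+ f))))
      expand = ℕ-Ring.solve-∀
      N≡ : N ≡ suc (X ℕ.+ f) ℕ.+ (X ℕ.+ f ℕ.* suc (X ℕ.+ (X ℕ.+ f)))
      N≡ = ℕ.+-cancelˡ-≡ (X ℕ.* X) _ _ (trans (sym eq) (trans (cong (λ q → q ℕ.* q) (sym Q≡)) (expand X f)))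

  module EvenZEvenX (a m C x y z : ℕ) (1<a : 1 ℕ.< a) (0<m : 0 ℕ.< m) (0<x : 0 ℕ.< x) (0<y : 0 ℕ.< y) (0<z : 0 ℕ.< z)
    (C+1≡ : suc C ≡ 2 ℕ.* a ℕ.* m) (z-even : Even z)
    (eq : (2 ℕ.+ C) ℕ.^ x ℕ.+ (2 ℕ.* m) ℕ.^ y ≡ C ℕ.^ z) (x-even : Even x) where

    open EvenZ a m C x y z 1<a 0<m 0<y 0<z C+1≡ z-even eq

    u w y′ h B P R : ℕ
    u = proj₁ x-even
    w = proj₁ z-even
    y′ = proj₁ y≥2
    h = a ℕ.* m
    B = 2 ℕ.+ C
    P = C ℕ.^ w
    R = B ℕ.^ u

    instance
      h≢0 : NonZero h
      h≢0 = ℕ.m*n≢0 a m {{ℕ.>-nonZero (ℕ.<-trans (s≤s z≤n) 1<a)}}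

    C+1≡2h : suc C ≡ 2 ℕ.* h
    C+1≡2h = trans C+1≡ (ℕ.*-assoc 2 a m)

    odd-C : Odd C
    odd-C = ℕ.pred h , ℕ.suc-injective (trans C+1≡2h (trans (cong (2 ℕ.*_) (sym (ℕ.suc-pred h))) (2*suc (ℕ.pred h))))

    odd-B : Odd B
    odd-B = h , cong suc C+1≡2h

    P²≡ : P ℕ.* P ≡ R ℕ.* R ℕ.+ M ℕ.^ y
    P²≡ = sym (trans (cong (ℕ._+ M ℕ.^ y) (sym (trans (cong (B ℕ.^_) (proj₂ x-even)) (^-double-ℕ B u))))
      (trans eq (trans (cong (C ℕ.^_) (proj₂ z-even)) (^-double-ℕ C w))))

    R<P : R ℕ.< P
    R<P = ℕ.≰⇒> λ P≤R → ℕ.<⇒≱ (ℕ.m<m+n (R ℕ.* R) (ℕ.>-nonZero⁻¹ (M ℕ.^ y) {{ℕ.m^n≢0 M y}}))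
      (subst (ℕ._≤ R ℕ.* R) P²≡ (ℕ.*-mono-≤ P≤R P≤R))

    0<R : 0 ℕ.< R
    0<R = ℕ.>-nonZero⁻¹ R {{ℕ.m^n≢0 B u}}

    half-difference : ∃ λ d → 0 ℕ.< d × P ≡ R ℕ.+ 2 ℕ.* d
    half-difference with odd-^ w odd-C | odd-^ u odd-B
    ... | p , P≡ | r , R≡ with ℕ.m≤n⇒∃[o]m+o≡n (ℕ.*-cancelˡ-< 2 r p (ℕ.≤-pred (subst₂ ℕ._<_ R≡ P≡ R<P)))
    ... | o , r+o≡p = suc o , s≤s z≤n , trans P≡ (trans (cong (λ p → suc (2 ℕ.* p)) (sym r+o≡p)) (trans (split r o) (cong (ℕ._+ 2 ℕ.* suc o) (sym R≡))))
      where
      split : ∀ r o → suc (2 ℕ.* (suc r ℕ.+ o)) ≡ suc (2 ℕ.* r) ℕ.+ 2 ℕ.* suc o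
      split = ℕ-Ring.solve-∀

    -- d and s are (P - R) / 2 and (P + R) / 2: coprime, with product M^y / 4.
    d s : ℕ
    d = proj₁ half-difference
    s = R ℕ.+ d

    0<d : 0 ℕ.< d
    0<d = proj₁ (proj₂ half-difference)

    P≡R+2d : P ≡ R ℕ.+ 2 ℕ.* d
    P≡R+2d = proj₂ (proj₂ half-difference)

    1<s : 1 ℕ.< s
    1<s = ℕ.+-mono-≤ 0<R 0<d

    ds≡ : d ℕ.* s ≡ 2 ℕ.^ y′ ℕ.* m ℕ.^ y
    ds≡ = ℕ.*-cancelˡ-≡ _ _ 4 (ℕ.+-cancelˡ-≡ (R ℕ.* R) _ _ (trans (square R d) (trans (cong (λ p → p ℕ.* p) (sym P≡R+2d)) (trans P²≡
      (cong (R ℕ.* R ℕ.+_) (trans (^-distribʳ-*ℕ 2 m y) four))))))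
      where
      square : ∀ R d → R ℕ.* R ℕ.+ 4 ℕ.* (d ℕ.* (R ℕ.+ d)) ≡ (R ℕ.+ 2 ℕ.* d) ℕ.* (R ℕ.+ 2 ℕ.* d)
      square = ℕ-Ring.solve-∀
      assoc : ∀ t n → 2 ℕ.* (2 ℕ.* t) ℕ.* n ≡ 4 ℕ.* (t ℕ.* n)
      assoc = ℕ-Ring.solve-∀
      four : 2 ℕ.^ y ℕ.* m ℕ.^ y ≡ 4 ℕ.* (2 ℕ.^ y′ ℕ.* m ℕ.^ y)
      four = trans (cong (λ k → 2 ℕ.^ k ℕ.* m ℕ.^ y) (proj₂ y≥2)) (assoc (2 ℕ.^ y′) (m ℕ.^ y))

    coprime-P-R : Coprime P R
    coprime-P-R = coprime-^ʳ u (Coprime.sym (coprime-^ʳ w (Coprime.sym λ {g} (g∣C , g∣B) →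
      odd⇒coprime-2 odd-C (g∣C , ℕ.∣m+n∣m⇒∣n (subst (g ℕ.∣_) (ℕ.+-comm 2 C) g∣B) g∣C))))

    coprime-d-s : Coprime d s
    coprime-d-s {g} (g∣d , g∣s) = coprime-P-R (subst (g ℕ.∣_) (sym P≡R+2d) (ℕ.∣m∣n⇒∣m+n g∣R (ℕ.∣n⇒∣m*n 2 g∣d)) , g∣R)
      where
      g∣R : g ℕ.∣ R
      g∣R = ℕ.∣m+n∣m⇒∣n (subst (g ℕ.∣_) (ℕ.+-comm R d) g∣s) g∣d

    m∣h : m ℕ.∣ h
    m∣h = ℕ.n∣m*n a

    2h≋ : ∀ {x y} → x ≋ y [mod + suc C ] → x ≋ y [mod + (2 ℕ.* h) ]
    2h≋ {x} {y} = subst (λ n → x ≋ y [mod + n ]) C+1≡2h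

    R≋1 : + R ≋ 1ℤ [mod + (2 ℕ.* h) ]
    R≋1 = 2h≋ (≋-respˡ (pos-^ B u) (1^≋1 u B≋1))

    P≋-1^w : + P ≋ (- 1ℤ) ^ w [mod + (2 ℕ.* h) ]
    P≋-1^w = 2h≋ (≋-respˡ (pos-^ C w) (^-cong-≋ w C≋-1))

    -- For w even, P ≡ R ≡ 1 modulo 2h, so h divides d and the roles are swapped: s = 2^(y-2) and d
    -- = m^y. As s > d, this leaves m = 1 and d = 1, so h = a would divide 1.
    w-odd : Odd w
    w-odd with parity w
    ... | inj₂ o = o
    ... | inj₁ even-w = contradiction (ℕ.m*n≡1⇒m≡1 a m (ℕ.∣1⇒≡1 (subst (h ℕ.∣_) d≡1 h∣d))) (ℕ.>⇒≢ 1<a)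
      where
      cancel : ∀ R D → D ≡ R + D + - R
      cancel = solve-∀
      h∣d : h ℕ.∣ d
      h∣d = ℕ.*-cancelˡ-∣ 2 (≋0⇒∣ (≋-respˡ (trans (cancel (+ R) (+ (2 ℕ.* d))) (cong (_+ - (+ R)) (sym (cong +_ P≡R+2d))))
        (+-cong-≋ (≋-respʳ P≋-1^w (-1^even even-w)) (neg-cong-≋ R≋1))))
      s∣2^y′ : s ℕ.∣ 2 ℕ.^ y′
      s∣2^y′ = coprime-divisor {m = s} {n = m ℕ.^ y}
        (coprime-^ʳ y λ (g∣s , g∣m) → coprime-d-s (ℕ.∣-trans g∣m (ℕ.∣-trans m∣h h∣d) , g∣s))
        (subst (s ℕ.∣_) (trans ds≡ (ℕ.*-comm (2 ℕ.^ y′) (m ℕ.^ y))) (ℕ.n∣m*n d))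
      parts : s ≡ 2 ℕ.^ y′ × d ≡ m ℕ.^ y
      parts = 2-part y′ (m ℕ.^ y) d s coprime-d-s ds≡ 1<s s∣2^y′
      m≤1 : m ℕ.≤ 1
      m≤1 = ℕ.≮⇒≥ λ 1<m → ℕ.<⇒≱ (ℕ.m<n+m d 0<R) (begin
        s              ≡⟨ proj₁ parts ⟩
        2 ℕ.^ y′       ≤⟨ ℕ.^-monoʳ-≤ 2 (ℕ.≤-trans (ℕ.m≤n+m y′ 2) (ℕ.≤-reflexive (sym (proj₂ y≥2)))) ⟩
        2 ℕ.^ y        ≤⟨ ℕ.^-monoˡ-≤ y 1<m ⟩
        m ℕ.^ y        ≡⟨ proj₂ parts ⟨
        d              ∎)
        where open ℕ.≤-Reasoning
      d≡1 : d ≡ 1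
      d≡1 = trans (proj₂ parts) (trans (cong (ℕ._^ y) (ℕ.≤-antisym m≤1 0<m)) (ℕ.^-zeroˡ y))

    h∣s : h ℕ.∣ s
    h∣s = ℕ.*-cancelˡ-∣ 2 (≋0⇒∣ (≋-respˡ (trans (cong +_ (double R d)) (cong (_+ + R) (sym (cong +_ P≡R+2d))))
      (+-cong-≋ (≋-respʳ P≋-1^w (-1^odd w-odd)) R≋1)))
      where
      double : ∀ R d → 2 ℕ.* (R ℕ.+ d) ≡ R ℕ.+ 2 ℕ.* d ℕ.+ R
      double = ℕ-Ring.solve-∀

    -- Modulo h the sum s = R + d is 0 and R is 1.
    h∣1+d : h ℕ.∣ suc d
    h∣1+d = ≋0⇒∣ (≋-respˡ (split (+ R) (+ d)) (+-cong-≋ (∣⇒≋0 h∣s) (+-cong-≋ (≋-refl {x = 1ℤ})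
      (neg-cong-≋ (≋-weaken (∣⇒≋0 (ℕ.n∣m*n 2)) R≋1)))))
      where
      split : ∀ R d → 1ℤ + d ≡ R + d + (1ℤ + - R)
      split = solve-∀

    d∣2^y′ : d ℕ.∣ 2 ℕ.^ y′
    d∣2^y′ = coprime-divisor {m = d} {n = m ℕ.^ y} (coprime-^ʳ y λ (g∣d , g∣m) → coprime-d-s (g∣d , ℕ.∣-trans g∣m (ℕ.∣-trans m∣h h∣s)))
      (subst (d ℕ.∣_) (trans ds≡ (ℕ.*-comm (2 ℕ.^ y′) (m ℕ.^ y))) (ℕ.m∣m*n s))

    B≤R : B ℕ.≤ R
    B≤R = subst (ℕ._≤ R) (ℕ.^-identityʳ B) (ℕ.^-monoʳ-≤ B (0<u u (proj₂ x-even)))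
      where
      0<u : ∀ u → x ≡ 2 ℕ.* u → 0 ℕ.< u
      0<u zero    x≡0 = contradiction 0<x (subst (λ x → ¬ 0 ℕ.< x) (sym x≡0) λ ())
      0<u (suc _) _   = s≤s z≤n

    -- Needed because `2-part` can identify d only when d > 1. For d = 1, h ∣ 2 forces m = 1 and h =
    -- 2, so R + 1 would be a power of two; but R ≡ 1 modulo 4 makes R + 1 ≡ 2, and R ≥ B is too
    -- large for R + 1 = 2.
    d≢1 : ¬ d ≡ 1
    d≢1 d≡1 = exclude y′ R+1≡
      where
      h≤2 : a ℕ.* m ℕ.≤ 2
      h≤2 = ℕ.∣⇒≤ (subst (λ d → h ℕ.∣ suc d) d≡1 h∣1+d)
      m≡1 : m ≡ 1
      m≡1 = ℕ.≤-antisym (ℕ.*-cancelˡ-≤ 2 (ℕ.≤-trans (ℕ.*-monoˡ-≤ m 1<a) h≤2)) 0<m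
      h≡2 : h ≡ 2
      h≡2 = ℕ.≤-antisym h≤2 (ℕ.≤-trans 1<a (ℕ.m≤m*n a m))
      R+1≡ : R ℕ.+ 1 ≡ 2 ℕ.^ y′
      R+1≡ = begin
        R ℕ.+ 1                 ≡⟨ ℕ.*-identityˡ _ ⟨
        1 ℕ.* (R ℕ.+ 1)         ≡⟨ cong (λ d → d ℕ.* (R ℕ.+ d)) d≡1 ⟨
        d ℕ.* s                 ≡⟨ ds≡ ⟩
        2 ℕ.^ y′ ℕ.* m ℕ.^ y    ≡⟨ cong (2 ℕ.^ y′ ℕ.*_) (trans (cong (ℕ._^ y) m≡1) (ℕ.^-zeroˡ y)) ⟩
        2 ℕ.^ y′ ℕ.* 1          ≡⟨ ℕ.*-identityʳ _ ⟩
        2 ℕ.^ y′                ∎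
        where open ≡-Reasoning
      R≋1[4] : + R ≋ 1ℤ [mod + 4 ]
      R≋1[4] = subst (λ h → + R ≋ 1ℤ [mod + (2 ℕ.* h) ]) h≡2 R≋1
      exclude : ∀ k → R ℕ.+ 1 ≡ 2 ℕ.^ k → ⊥
      exclude zero          p = contradiction (ℕ.+-cancelʳ-≡ 1 R 0 p) (ℕ.>⇒≢ 0<R)
      exclude (suc zero)    p = contradiction (ℕ.+-cancelʳ-≡ 1 R 1 p) (ℕ.>⇒≢ (ℕ.≤-trans (s≤s (s≤s z≤n)) B≤R))
      exclude (suc (suc k)) p = from-no (4 ℕ.∣? 2) (≋⇒∣ {+ 2} {0ℤ} {+ 4} (≋-trans
        (+-cong-≋ (≋-sym R≋1[4]) (≋-refl {x = 1ℤ})) (∣⇒≋0 (subst (4 ℕ.∣_) (sym p) (4∣2^[2+k] k)))))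

    1<d : 1 ℕ.< d
    1<d = ℕ.≤∧≢⇒< 0<d (d≢1 ∘ sym)

    parts : d ≡ 2 ℕ.^ y′ × s ≡ m ℕ.^ y
    parts = 2-part y′ (m ℕ.^ y) s d (Coprime.sym coprime-d-s) (trans (ℕ.*-comm s d) ds≡) 1<d d∣2^y′

    even-d : Even d
    even-d = ∣2^*⇒even {k = y′} 1<d d∣2^y′

    odd-h : Odd h
    odd-h = odd-divisor (coprime-even⇒odd (Coprime.sym coprime-d-s) even-d) h∣s

    odd-m : Odd m
    odd-m = odd-divisor odd-h m∣h

    -- As h is odd, A ≡ 2 (mod 4), so C ≡ 1 and B ≡ -1. As d is even, P = R + 2d gives 1 ≡ (-1)^u
    -- modulo 4.
    u-even : Even u
    u-even with parity u
    ... | inj₁ e = e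
    ... | inj₂ odd-u = contradiction (≋⇒∣ {1ℤ} { - 1ℤ} {+ 4} (≋-trans (≋-sym (≋-respˡ (pos-^ C w) (1^≋1 w C≋1)))
        (≋-respˡ (cong +_ P≡R+2d) (+-cong-≋ (≋-respˡ (pos-^ B u) (≋-respʳ (^-cong-≋ u B≋-1) (-1^odd odd-u))) 2d≋0)))) (from-no (4 ℕ.∣? 2))
      where
      h₁ = proj₁ odd-h
      A≡ : suc C ≡ 2 ℕ.+ 4 ℕ.* h₁
      A≡ = trans C+1≡2h (trans (cong (2 ℕ.*_) (proj₂ odd-h)) (expand h₁))
        where
        expand : ∀ h → 2 ℕ.* suc (2 ℕ.* h) ≡ 2 ℕ.+ 4 ℕ.* h
        expand = ℕ-Ring.solve-∀
      C≋1 : + C ≋ 1ℤ [mod + 4 ]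
      C≋1 = ≋-respˡ (cong +_ (ℕ.suc-injective A≡)) (+-cong-≋ (≋-refl {x = 1ℤ}) (∣⇒≋0 (ℕ.m∣m*n h₁)))
      B≋-1 : + B ≋ - 1ℤ [mod + 4 ]
      B≋-1 = ≋-respˡ (cong (λ A → + suc A) A≡) (+-cong-≋ {x = - 1ℤ} (modulo 1ℤ refl) (∣⇒≋0 (ℕ.m∣m*n h₁)))
      2d≋0 : + (2 ℕ.* d) ≋ 0ℤ [mod + 4 ]
      2d≋0 = ∣⇒≋0 (subst (λ d → 4 ℕ.∣ 2 ℕ.* d) (sym (proj₂ even-d)) (ℕ.*-monoʳ-∣ 2 (ℕ.m∣m*n {2} (proj₁ even-d))))

    X : ℕ
    X = B ℕ.^ proj₁ u-even

    X²+2^y′≡m^y : X ℕ.* X ℕ.+ 2 ℕ.^ y′ ≡ m ℕ.^ y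
    X²+2^y′≡m^y = trans (cong₂ ℕ._+_ (sym (trans (cong (B ℕ.^_) (proj₂ u-even)) (^-double-ℕ B (proj₁ u-even)))) (sym (proj₁ parts))) (proj₂ parts)

    y′-odd : Odd y′
    y′-odd with parity y′
    ... | inj₂ o = o
    ... | inj₁ (k , y′≡) = ⊥-elim (exclude m refl)
      where
      E = 2 ℕ.^ k
      Q = m ℕ.^ suc k
      y≡ : y ≡ 2 ℕ.* suc k
      y≡ = trans (proj₂ y≥2) (trans (cong (2 ℕ.+_) y′≡) (sym (2*suc k)))
      Q²≡ : Q ℕ.* Q ≡ X ℕ.* X ℕ.+ E ℕ.* E
      Q²≡ = trans (sym (trans (cong (m ℕ.^_) y≡) (^-double-ℕ m (suc k)))) (trans (sym X²+2^y′≡m^y)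
        (cong (X ℕ.* X ℕ.+_) (trans (cong (2 ℕ.^_) y′≡) (^-double-ℕ 2 k))))
      0<E² : 0 ℕ.< E ℕ.* E
      0<E² = ℕ.>-nonZero⁻¹ (E ℕ.* E) {{ℕ.m*n≢0 E E {{ℕ.m^n≢0 2 k}} {{ℕ.m^n≢0 2 k}}}}
      Q≤E² : Q ℕ.≤ E ℕ.* E
      Q≤E² = difference-of-squares-bound Q X (E ℕ.* E) Q²≡ 0<E²
      -- The bound m^(k+1) = Q ≤ E² = 4^k rules out m ≥ 4 and leaves small values. For m = 1 the sum
      -- of two positive squares exceeds Q² = 1, m = 2 is even, and for m = 3 both squares are 1
      -- modulo 3 while Q² is 0.
      exclude : ∀ n → m ≡ n → ⊥
      exclude 0 m≡ = contradiction m≡ (ℕ.>⇒≢ 0<m)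
      exclude 1 m≡ = ℕ.<-irrefl (trans (cong (λ q → q ℕ.* q) (sym (trans (cong (ℕ._^ suc k) m≡) (ℕ.^-zeroˡ (suc k))))) Q²≡)
        (ℕ.+-mono-≤ (ℕ.>-nonZero⁻¹ (X ℕ.* X) {{ℕ.m*n≢0 X X {{X≢0}} {{X≢0}}}}) 0<E²)
        where
        X≢0 : NonZero X
        X≢0 = ℕ.m^n≢0 B (proj₁ u-even)
      exclude 2 m≡ = contradiction (odd⇒coprime-2 odd-m (subst (2 ℕ.∣_) (sym m≡) ℕ.∣-refl , ℕ.∣-refl)) λ ()
      exclude 3 m≡ = from-no (3 ℕ.∣? 2) (≋⇒∣ {+ 2} {0ℤ} {+ 3} (≋-trans (+-cong-≋ {y = 1ℤ} (≋-sym X²≋1) (≋-sym E²≋1))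
          (≋-respˡ (cong +_ (sym Q²≡)) (∣⇒≋0 (ℕ.∣m⇒∣m*n Q (ℕ.∣m⇒∣m*n (m ℕ.^ k) (subst (3 ℕ.∣_) (sym m≡) ℕ.∣-refl)))))))
        where
        X²≋1 : + (X ℕ.* X) ≋ 1ℤ [mod + 3 ]
        X²≋1 = ≋-respˡ (ℤ.pos-* X X) (*-cong-≋ X≋1 X≋1)
          where
          X≋1 : + X ≋ 1ℤ [mod + 3 ]
          X≋1 = ≋-respˡ (pos-^ B (proj₁ u-even)) (1^≋1 (proj₁ u-even)
            (≋-weaken (∣⇒≋0 (subst (3 ℕ.∣_) (sym C+1≡) (ℕ.∣n⇒∣m*n (2 ℕ.* a) (subst (3 ℕ.∣_) (sym m≡) ℕ.∣-refl)))) B≋1))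
        E²≋1 : + (E ℕ.* E) ≋ 1ℤ [mod + 3 ]
        E²≋1 = ≋-respˡ (trans (cong +_ (sym (^-double-ℕ 2 k))) (pos-^ 2 (2 ℕ.* k)))
          (≋-respʳ (^-cong-≋ {x = + 2} { - 1ℤ} (2 ℕ.* k) (modulo 1ℤ refl)) (-1^even (k , refl)))
      exclude (suc (suc (suc (suc n)))) m≡ = ℕ.<⇒≱ (begin-strict
        E ℕ.* E                ≡⟨ ^-distribʳ-*ℕ 2 2 k ⟨
        4 ℕ.^ k                <⟨ ℕ.^-monoʳ-< 4 (s≤s (s≤s z≤n)) (ℕ.n<1+n k) ⟩
        4 ℕ.^ suc k            ≤⟨ ℕ.^-monoˡ-≤ (suc k) (subst (4 ℕ.≤_) (sym m≡) (ℕ.m≤m+n 4 n)) ⟩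
        Q                      ∎) Q≤E²
        where open ℕ.≤-Reasoning

    impossible : ⊥
    impossible = from-root (odd-power-norm 2 (inj₂ refl) m X k y odd-m (suc k , y≡) (λ ()) norm)
      where
      k = proj₁ y′-odd
      E = 2 ℕ.^ k
      y≡ : y ≡ suc (2 ℕ.* suc k)
      y≡ = trans (proj₂ y≥2) (trans (cong (2 ℕ.+_) (proj₂ y′-odd)) (cong suc (sym (2*suc k))))
      2^y′≡ : 2 ℕ.^ y′ ≡ 2 ℕ.* (E ℕ.* E)
      2^y′≡ = trans (cong (2 ℕ.^_) (proj₂ y′-odd)) (cong (2 ℕ.*_) (^-double-ℕ 2 k))
      norm : X ℕ.* X ℕ.+ 2 ℕ.* (E ℕ.* E) ≡ m ℕ.^ y
      norm = trans (cong (X ℕ.* X ℕ.+_) (sym 2^y′≡)) X²+2^y′≡m^y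
      from-root : ∀ {I : ℕ → Set} → (∃ λ v → v ℕ.* v ℕ.+ 2 ℕ.* (E ℕ.* E) ≡ m × I v) → ⊥
      from-root (v , N , _) = ℕ.<⇒≱ 1<d (ℕ.≤-trans d≤m m≤1)
        where
        -- d = 2^(y-2) = 2E² is a summand of m = v² + 2E². Then 2m ≤ am ≤ 1 + d ≤ 1 + m leaves no
        -- room for d > 1.
        d≤m : d ℕ.≤ m
        d≤m = ℕ.≤-trans (ℕ.≤-reflexive (trans (proj₁ parts) 2^y′≡)) (ℕ.≤-trans (ℕ.m≤n+m _ (v ℕ.* v)) (ℕ.≤-reflexive N))
        m≤1 : m ℕ.≤ 1
        m≤1 = ℕ.+-cancelʳ-≤ m m 1 (begin
          m ℕ.+ m          ≡⟨ cong (m ℕ.+_) (ℕ.+-identityʳ m) ⟨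
          2 ℕ.* m          ≤⟨ ℕ.*-monoˡ-≤ m 1<a ⟩
          a ℕ.* m          ≤⟨ ℕ.∣⇒≤ h∣1+d ⟩
          suc d            ≤⟨ s≤s d≤m ⟩
          suc m            ∎)
          where open ℕ.≤-Reasoning

  -- The case z odd: reduction to m = 1

  5^x+2≡3^z : ∀ x z → 0 ℕ.< x → Odd z → 5 ℕ.^ x ℕ.+ 2 ≡ 3 ℕ.^ z → x ≡ 2 × z ≡ 3
  5^x+2≡3^z x z 0<x (w , refl) = by-size w
    where
    5^≡1 : ∀ x → 5 ℕ.^ x ≡ 1 → x ≡ 0
    5^≡1 zero    _ = refl
    5^≡1 (suc x) p = contradiction (ℕ.m*n≡1⇒m≡1 5 (5 ℕ.^ x) p) λ ()
    5^≡25 : ∀ x → 5 ℕ.^ x ≡ 25 → x ≡ 2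
    5^≡25 (suc zero)    ()
    5^≡25 (suc (suc x)) p = cong (2 ℕ.+_) (5^≡1 x (ℕ.*-cancelˡ-≡ _ _ 5 (ℕ.*-cancelˡ-≡ _ _ 5 p)))
    by-size : ∀ w → 5 ℕ.^ x ℕ.+ 2 ≡ 3 ℕ.^ suc (2 ℕ.* w) → x ≡ 2 × suc (2 ℕ.* w) ≡ 3
    by-size 0 p = contradiction (5^≡1 x (ℕ.+-cancelʳ-≡ 2 _ 1 p)) (ℕ.>⇒≢ 0<x)
    by-size 1 p = 5^≡25 x (ℕ.+-cancelʳ-≡ 2 _ 25 p) , refl
    by-size (suc (suc v)) p = contradiction (trans p (cong (3 ℕ.^_) (shift v))) (5^x+2≢3^[4+z] x (suc (2 ℕ.* v)))
      where
      shift : ∀ v → suc (2 ℕ.* suc (suc v)) ≡ 4 ℕ.+ suc (2 ℕ.* v)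
      shift = ℕ-Ring.solve-∀

  module OddZ (a m C x y z : ℕ) (1<a : 1 ℕ.< a) (0<m : 0 ℕ.< m) (0<x : 0 ℕ.< x) (0<y : 0 ℕ.< y)
    (C+1≡ : suc C ≡ 2 ℕ.* a ℕ.* m) (z-odd : Odd z)
    (eq : (2 ℕ.+ C) ℕ.^ x ℕ.+ (2 ℕ.* m) ℕ.^ y ≡ C ℕ.^ z) where

    M : ℕ
    M = 2 ℕ.* m

    A∣M^y+2 : suc C ℕ.∣ M ℕ.^ y ℕ.+ 2
    A∣M^y+2 = ≋0⇒∣ (≋-respˡ (trans (cong (_+ + 2) (pos-^ M y)) (split ((+ M) ^ y))) (+-cong-≋ (≋-refl {x = 1ℤ})
      (≋-trans (+-cong-≋ (≋-sym (1^≋1 x (+modulus refl))) (≋-refl {x = (+ M) ^ y}))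
        (≋-respˡ (pos-equation (2 ℕ.+ C) x M y C z eq) (≋-respʳ (^-cong-≋ z (+modulus refl)) (-1^odd z-odd))))))
      where
      split : ∀ t → t + + 2 ≡ 1ℤ + (1ℤ + t)
      split = solve-∀

    m≡1 : m ≡ 1
    m≡1 = ℕ.∣1⇒≡1 (ℕ.*-cancelˡ-∣ 2 (ℕ.∣m+n∣m⇒∣n (ℕ.∣-trans M∣A A∣M^y+2) (M∣M^ y 0<y)))
      where
      assoc : ∀ a m → 2 ℕ.* a ℕ.* m ≡ a ℕ.* (2 ℕ.* m)
      assoc = ℕ-Ring.solve-∀
      M∣A : M ℕ.∣ suc C
      M∣A = subst (M ℕ.∣_) (sym (trans C+1≡ (assoc a m))) (ℕ.n∣m*n a)
      M∣M^ : ∀ y → 0 ℕ.< y → M ℕ.∣ M ℕ.^ y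
      M∣M^ (suc y) _ = ℕ.m∣m*n (M ℕ.^ y)

    C+1≡2a : suc C ≡ 2 ℕ.* a
    C+1≡2a = trans C+1≡ (trans (cong (2 ℕ.* a ℕ.*_) m≡1) (ℕ.*-identityʳ _))

    eq₁ : (2 ℕ.+ C) ℕ.^ x ℕ.+ 2 ℕ.^ y ≡ C ℕ.^ z
    eq₁ = subst (λ m → (2 ℕ.+ C) ℕ.^ x ℕ.+ (2 ℕ.* m) ℕ.^ y ≡ C ℕ.^ z) m≡1 eq

    solution : a ≡ 2 × m ≡ 1 × x ≡ 2 × y ≡ 1 × z ≡ 3
    solution = by-y y 0<y eq₁ (subst₂ (λ A m → A ℕ.∣ (2 ℕ.* m) ℕ.^ y ℕ.+ 2) C+1≡2a m≡1 A∣M^y+2)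
      where
      by-y : ∀ y → 0 ℕ.< y → (2 ℕ.+ C) ℕ.^ x ℕ.+ 2 ℕ.^ y ≡ C ℕ.^ z → 2 ℕ.* a ℕ.∣ 2 ℕ.^ y ℕ.+ 2 →
        a ≡ 2 × m ≡ 1 × x ≡ 2 × y ≡ 1 × z ≡ 3
      by-y 1 _ p 2a∣ = a≡2 , m≡1 , proj₁ x,z , refl , proj₂ x,z
        where
        a≡2 : a ≡ 2
        a≡2 = ℕ.≤-antisym (ℕ.∣⇒≤ (ℕ.*-cancelˡ-∣ 2 2a∣)) 1<a
        x,z : x ≡ 2 × z ≡ 3
        x,z = 5^x+2≡3^z x z 0<x z-odd
          (subst (λ C → (2 ℕ.+ C) ℕ.^ x ℕ.+ 2 ≡ C ℕ.^ z) (ℕ.suc-injective (trans C+1≡2a (cong (2 ℕ.*_) a≡2))) p)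
      -- For y ≥ 2 the divisor a of 2^(y-1) + 1 is odd, so C = 2a - 1 has the form 1 + 4g required
      -- by `OddZUnitM`.
      by-y (suc (suc k)) _ p 2a∣ = ⊥-elim (OddZUnitM.impossible g x k z 0<x z-odd
          (subst (λ C → (2 ℕ.+ C) ℕ.^ x ℕ.+ 2 ℕ.^ (2 ℕ.+ k) ≡ C ℕ.^ z) C≡ p) (subst (ℕ._∣ 2 ℕ.^ suc k ℕ.+ 1) (proj₂ odd-a) a∣))
        where
        a∣ : a ℕ.∣ 2 ℕ.^ suc k ℕ.+ 1
        a∣ = ℕ.*-cancelˡ-∣ 2 (subst (2 ℕ.* a ℕ.∣_) (sym (ℕ.*-distribˡ-+ 2 (2 ℕ.^ suc k) 1)) 2a∣)
        odd-a : Odd a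
        odd-a = odd-divisor (2 ℕ.^ k , ℕ.+-comm (2 ℕ.^ suc k) 1) a∣
        g = proj₁ odd-a
        C≡ : C ≡ 1 ℕ.+ 4 ℕ.* g
        C≡ = ℕ.suc-injective (trans C+1≡2a (trans (cong (2 ℕ.*_) (proj₂ odd-a)) (expand g)))
          where
          expand : ∀ g → 2 ℕ.* suc (2 ℕ.* g) ≡ 2 ℕ.+ 4 ℕ.* g
          expand = ℕ-Ring.solve-∀

  -- The three parity cases together

  solutions : ∀ a m x y z → 1 ℕ.< a → 0 ℕ.< m → 0 ℕ.< x → 0 ℕ.< y → 0 ℕ.< z →
    (2 ℕ.* a ℕ.* m ℕ.+ 1) ℕ.^ x ℕ.+ (2 ℕ.* m) ℕ.^ y ≡ (2 ℕ.* a ℕ.* m ℕ.∸ 1) ℕ.^ z →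
    (a ≡ 2 × m ≡ 1 × x ≡ 2 × y ≡ 1 × z ≡ 3) ⊎ (a ≡ 2 × m ≡ 1 × x ≡ 1 × y ≡ 2 × z ≡ 2)
  solutions a m x y z 1<a 0<m 0<x 0<y 0<z eq = by-parity (parity z) (parity x)
    where
    C = 2 ℕ.* a ℕ.* m ℕ.∸ 1
    -- 2am is positive, so the truncated subtraction is a genuine predecessor; all cases work with C
    -- and write B as 2 + C.
    C+1≡ : suc C ≡ 2 ℕ.* a ℕ.* m
    C+1≡ = ℕ.m+[n∸m]≡n (ℕ.*-mono-≤ (ℕ.≤-trans (ℕ.<⇒≤ 1<a) (ℕ.m≤m+n a (a ℕ.+ 0))) 0<m)
    eq′ : (2 ℕ.+ C) ℕ.^ x ℕ.+ (2 ℕ.* m) ℕ.^ y ≡ C ℕ.^ z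
    eq′ = subst (λ B → B ℕ.^ x ℕ.+ (2 ℕ.* m) ℕ.^ y ≡ C ℕ.^ z) (trans (ℕ.+-comm _ 1) (cong suc (sym C+1≡))) eq
    by-parity : Even z ⊎ Odd z → Even x ⊎ Odd x →
      (a ≡ 2 × m ≡ 1 × x ≡ 2 × y ≡ 1 × z ≡ 3) ⊎ (a ≡ 2 × m ≡ 1 × x ≡ 1 × y ≡ 2 × z ≡ 2)
    by-parity (inj₂ z-odd)  _             = inj₁ (OddZ.solution a m C x y z 1<a 0<m 0<x 0<y C+1≡ z-odd eq′)
    by-parity (inj₁ z-even) (inj₂ x-odd)  = inj₂ (EvenZOddX.solution a m C x y z 1<a 0<m 0<y 0<z C+1≡ z-even eq′ x-odd)
    by-parity (inj₁ z-even) (inj₁ x-even) = ⊥-elim (EvenZEvenX.impossible a m C x y z 1<a 0<m 0<x 0<y 0<z C+1≡ z-even eq′ x-even)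

open import Data.Nat using (_+_; _*_; _∸_; _^_; _<_)

theorem1p1 : (a m x y z : ℕ) → 1 < a → 0 < m → 0 < x → 0 < y → 0 < z →
    ((2 * a * m + 1) ^ x + (2 * m) ^ y ≡ (2 * a * m ∸ 1) ^ z
    → (a ≡ 2 × m ≡ 1 × x ≡ 2 × y ≡ 1 × z ≡ 3) ⊎ (a ≡ 2 × m ≡ 1 × x ≡ 1 × y ≡ 2 × z ≡ 2))
    × ((a ≡ 2 × m ≡ 1 × x ≡ 2 × y ≡ 1 × z ≡ 3) ⊎ (a ≡ 2 × m ≡ 1 × x ≡ 1 × y ≡ 2 × z ≡ 2)
    → (2 * a * m + 1) ^ x + (2 * m) ^ y ≡ (2 * a * m ∸ 1) ^ z)
theorem1p1 a m x y z 1<a 0<m 0<x 0<y 0<z =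
  solutions a m x y z 1<a 0<m 0<x 0<y 0<z ,
  [ (λ { (refl , refl , refl , refl , refl) → refl }) , (λ { (refl , refl , refl , refl , refl) → refl }) ]′
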